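{- Let $\mathcal P_{\alpha_1,\ldots,\alpha_k}$ be a linear partition family. Then there exist $\delta>0$ and $N\in\mathbb N$ so that for every $n\ge N$ (with $(n,k,P_n)\in\mathcal P_{\alpha_1,\ldots,\alpha_k}$), the probability that the randomized rounding algorithm described below fails to solve $(n,k,P_n)$ is at most $e^{ -\delta n}$.
   Context: Setting. For positive integers $n,k$ let $s^{n,k}=\frac{n(n+1)}{2k}$ (the common target sum). Let $[\alpha_1,\ldots,\alpha_k]$ be a non-descending sequence of positive rational numbers with $\sum_{i=1}^k\alpha_i=1$. Put $A_j=\sum_{j'=1}^j\alpha_{j'}$, $\mathrm{slack}_j(A)=A_j(1-\frac{A_j}{2})-\frac{j}{2k}$ and $\mathrm{slack}(A)=\min_{1\le j<k}\mathrm{slack}_j(A)$, and assume $\mathrm{slack}(A)>0$. The linear partition family $\mathcal P_{\alpha_1,\ldots,\alpha_k}$ is the set of equal sum partition problems $(n,k,P_n=[\alpha_1 n,\ldots,\alpha_k n])$, where $n$ is a positive integer such that all $\alpha_j n$ are integers and $s^{n,k}$ is an integer; solving such an instance means partitioning $\{1,\ldots,n\}$ into sets $Q_1,\ldots,Q_k$ with $|Q_j|=\alpha_j n$ and element sum $S(Q_j)=s^{n,k}$ for all $j$. The algorithm (randomized rounding). (1) Form the fractional (fluid mixing) problem with $n$ sources and $k$ targets: $a_i=n-i+1$, $u_i=1$ for $i\in[n]$, $b_j=s^{n,k}$, $v_j=\alpha_j n$ for $j\in[k]$, and compute a fractional solution $x_{i,j}\ge 0$ with $\sum_j x_{i,j}=1$,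 $\sum_i u_i x_{i,j}=v_j$, $\sum_i a_i x_{i,j}=b_j$, using the following recursive procedure (sources and targets ordered by non-increasing density $a_i/u_i$, $b_j/v_j$): if $k=1$, send everything to the single target; else if $u_1=0$, drop the first source (its row is $[1,0,\ldots,0]$) and recurse; else if $v_1=0$, drop the first target (zero column) and recurse; else if $b_1/v_1=b_2/v_2$, merge the first two targets, recurse, and split the merged column in proportions $\gamma=v_1/(v_1+v_2)$ and $1-\gamma$; otherwise pour a fraction $\lambda=\min\big(1,\frac{v_1}{u_1},\frac{b_1v_2-v_1b_2}{a_1v_2-u_1b_2}\big)$ of the first source into the first target (subtract $\lambda a_1,\lambda u_1$ from $a_1,u_1,b_1,v_1$ accordingly), recurse, and set row 1 to $\lambda\delta_1+(1-\lambda)\cdot$(row 1 of the recursive solution). (2) Independently for each $i\in[n]$ choose $X_i\in[k]$ with $\Pr[X_i=j]=x_{i,j}$, and set $Q_j=\{n-i+1: X_i=j\}$. (3) While some $|Q_{j'}|>\alpha_{j'}n$ and some $|Q_{j''}|<\alpha_{j''}n$, move an element of $Q_{j'}$ to $Q_{j''}$. (4) While some $S(Q_j)\ne s^{n,k}$: let $j'$ maximize and $j''$ minimize $S(Q_j)$, let $\Delta=\min(S(Q_{j'})-s^{n,k},\,s^{n,k}-S(Q_{j''}))$; if there are $z'\in Q_{j'}$, $z''\in Q_{j''}$ with $0<z'-z''\le\Delta$, choose such a pair with $z'-z''$ maximal and swap them; otherwise return Failure. Finally return $Q_1,\ldots,Q_k$. -}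

module Defs where

open import Data.Bool using (Bool; true; false; if_then_else_)
open import Data.Nat as ℕ using (ℕ; zero; suc; _∸_; _⊓_; NonZero)
open import Data.Nat.Divisibility using (_∣_)
open import Data.Integer as ℤ using (ℤ; +_)
open import Data.Rational as ℚ using (ℚ; 0ℚ; 1ℚ; ½; _+_; _*_; _-_; _÷_)
open import Data.Rational.Properties as ℚP using ()
open import Data.Fin as Fin using (Fin; toℕ)
open import Data.Vec as Vec using (Vec; lookup; _[_]≔_)
open import Data.List as List using (List; []; _∷_; map; replicate; length; upTo)
open import Data.Product using (Σ; _×_; _,_; ∃)
open import Relation.Binary.PropositionalEquality using (_≡_)
open import Relation.Nullary using (¬_; yes; no; does)

ℕ→ℚ : ℕ → ℚ
ℕ→ℚ m = + m ℚ./ 1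

-- total division on ℚ (returns 0 when dividing by 0; never used with a
-- zero divisor on the instances of the theorem)
_÷'_ : ℚ → ℚ → ℚ
p ÷' q with q ℚP.≟ 0ℚ
... | yes _ = 0ℚ
... | no q≢0 = _÷_ p q {{ℚ.≢-nonZero q≢0}}

_^ℚ_ : ℚ → ℕ → ℚ
q ^ℚ zero = 1ℚ
q ^ℚ suc m = q * (q ^ℚ m)

sumFinℚ : ∀ {m} → (Fin m → ℚ) → ℚ
sumFinℚ {zero} f = 0ℚ
sumFinℚ {suc m} f = f Fin.zero + sumFinℚ (λ i → f (Fin.suc i))

prodFinℚ : ∀ {m} → (Fin m → ℚ) → ℚ
prodFinℚ {zero} f = 1ℚ
prodFinℚ {suc m} f = f Fin.zero * prodFinℚ (λ i → f (Fin.suc i))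

sumFinℕ : ∀ {m} → (Fin m → ℕ) → ℕ
sumFinℕ {zero} f = 0
sumFinℕ {suc m} f = f Fin.zero ℕ.+ sumFinℕ (λ i → f (Fin.suc i))

nz2k : ∀ k → .{{NonZero k}} → NonZero (2 ℕ.* k)
nz2k (suc k) = _

prefixSum : ∀ {k} → (Fin k → ℚ) → ℕ → ℚ
prefixSum α j = sumFinℚ (λ i → if toℕ i ℕ.<ᵇ j then α i else 0ℚ)

slack : (k : ℕ) .{{_ : NonZero k}} → (Fin k → ℚ) → ℕ → ℚ
slack k α j = A * (1ℚ - A * ½) - ℚ._/_ (+ j) (2 ℕ.* k) {{nz2k k}}
  where A = prefixSum α j

IsLinearFamilyParam : (k : ℕ) .{{_ : NonZero k}} → (Fin k → ℚ) → Set
IsLinearFamilyParam k α =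
  (∀ j → 0ℚ ℚ.< α j) ×
  (∀ i j → toℕ i ℕ.≤ toℕ j → α i ℚ.≤ α j) ×
  (sumFinℚ α ≡ 1ℚ) ×
  (∀ j → 1 ℕ.≤ j → j ℕ.< k → 0ℚ ℚ.< slack k α j)

-- s^{n,k} = n(n+1)/(2k)   (exact when 2k ∣ n(n+1))
sTarget : ℕ → (k : ℕ) .{{_ : NonZero k}} → ℕ
sTarget n k = ℕ._/_ (n ℕ.* suc n) (2 ℕ.* k) {{nz2k k}}

InFamily : (k : ℕ) .{{_ : NonZero k}} → (Fin k → ℚ) → ℕ → Set
InFamily k α n =
  (1 ℕ.≤ n) ×
  (∀ j → ∃ λ m → α j * ℕ→ℚ n ≡ ℕ→ℚ m) ×
  ((2 ℕ.* k) ∣ (n ℕ.* suc n))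

-- prescribed size α_j n (exact under InFamily)
targetSize : ∀ {k} → (Fin k → ℚ) → ℕ → Fin k → ℕ
targetSize α n j = ℤ.∣ ℚ.floor (α j * ℕ→ℚ n) ∣

-- Step (1): the recursive fractional (fluid mixing) procedure.
-- Sources / targets are lists of (amount a, volume u) resp. (b, v) pairs,
-- already in non-increasing density order (this order is preserved by
-- every step). The result is the list of rows x_{i,·}.
-- A fuel argument bounds the recursion depth; the initial fuel
-- 2(n+k)+2 is never exhausted.

pourRow : ℚ → List (List ℚ) → List (List ℚ)
pourRow λ' [] = []
pourRow λ' ([] ∷ rs) = [] ∷ rs
pourRow λ' ((h ∷ r) ∷ rs) =
  (λ' + (1ℚ - λ') * h ∷ map (λ y → (1ℚ - λ') * y) r) ∷ rs

splitCol : ℚ → List ℚ → List ℚ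
splitCol γ [] = []
splitCol γ (m ∷ r) = γ * m ∷ (1ℚ - γ) * m ∷ r

frac : ℕ → List (ℚ × ℚ) → List (ℚ × ℚ) → List (List ℚ)
frac zero ss ts = []
frac (suc f) ss [] = map (λ _ → []) ss
frac (suc f) ss (t ∷ []) = map (λ _ → 1ℚ ∷ []) ss
frac (suc f) [] (t₁ ∷ t₂ ∷ ts) = []
frac (suc f) ((a , u) ∷ ss) ((b₁ , v₁) ∷ (b₂ , v₂) ∷ ts) with u ℚP.≟ 0ℚ
... | yes _ = (1ℚ ∷ replicate (suc (length ts)) 0ℚ)
                ∷ frac f ss ((b₁ , v₁) ∷ (b₂ , v₂) ∷ ts)
... | no _ with v₁ ℚP.≟ 0ℚ
...   | yes _ = map (0ℚ ∷_) (frac f ((a , u) ∷ ss) ((b₂ , v₂) ∷ ts))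
...   | no _ with b₁ * v₂ ℚP.≟ b₂ * v₁
...     | yes _ = map (splitCol (v₁ ÷' (v₁ + v₂)))
                      (frac f ((a , u) ∷ ss) ((b₁ + b₂ , v₁ + v₂) ∷ ts))
...     | no _ = pourRow lam
                   (frac f ((a - lam * a , u - lam * u) ∷ ss)
                           ((b₁ - lam * a , v₁ - lam * u) ∷ (b₂ , v₂) ∷ ts))
  where
  lam : ℚ
  lam = (1ℚ ℚ.⊓ (v₁ ÷' u)) ℚ.⊓ ((b₁ * v₂ - v₁ * b₂) ÷' (a * v₂ - u * b₂))

entry : List (List ℚ) → ℕ → ℕ → ℚ
entry [] i j = 0ℚ
entry (r ∷ rs) (suc i) j = entry rs i j
entry ([] ∷ rs) zero j = 0ℚ
entry ((y ∷ r) ∷ rs) zero zero = y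
entry ((y ∷ r) ∷ rs) zero (suc j) = entry (r ∷ rs) zero j

-- the fractional solution for (n,k,P_n): source p (0-based, i = p+1)
-- has a_i = n - i + 1 = n - p, u_i = 1; target j has b_j = s^{n,k},
-- v_j = α_j n.
fracSol : (k : ℕ) .{{_ : NonZero k}} → (Fin k → ℚ) → ℕ → List (List ℚ)
fracSol k α n =
  frac (2 ℕ.* (n ℕ.+ k) ℕ.+ 2)
       (map (λ p → (ℕ→ℚ (n ∸ p) , 1ℚ)) (upTo n))
       (map (λ j → (ℕ→ℚ (sTarget n k) , α j * ℕ→ℚ n)) (List.allFin k))

x : (k : ℕ) .{{_ : NonZero k}} → (Fin k → ℚ) → (n : ℕ) → Fin n → Fin k → ℚ
x k α n p j = entry (fracSol k α n) (toℕ p) (toℕ j)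

-- Step (2): an outcome of the rounding is X ∈ [k]^n, X_i = lookup X p
-- (p = i - 1). Its probability is ∏_i x_{i,X_i}.

Outcome : ℕ → ℕ → Set
Outcome k n = Vec (Fin k) n

prob : (k : ℕ) .{{_ : NonZero k}} → (Fin k → ℚ) → (n : ℕ) → Outcome k n → ℚ
prob k α n X = prodFinℚ (λ p → x k α n p (lookup X p))

allOutcomes : (k n : ℕ) → List (Outcome k n)
allOutcomes k zero = Vec.[] ∷ []
allOutcomes k (suc n) =
  List.concatMap (λ X → map (λ j → j Vec.∷ X) (List.allFin k)) (allOutcomes k n)

probOf : (k : ℕ) .{{_ : NonZero k}} → (Fin k → ℚ) → (n : ℕ) →
         (Outcome k n → Bool) → ℚ
probOf k α n D =
  List.foldr _+_ 0ℚ (map (λ X → if D X then prob k α n X else 0ℚ) (allOutcomes k n))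

-- Steps (3),(4). A state σ assigns every position p ∈ Fin n to a set;
-- position p carries the element n - p (so Q_j = {n-i+1 : X_i = j}).

val : ∀ {n} → Fin n → ℕ
val {n} p = n ∸ toℕ p

size : ∀ {k n} → Vec (Fin k) n → Fin k → ℕ
size σ j = sumFinℕ (λ p → if does (lookup σ p Fin.≟ j) then 1 else 0)

sumQ : ∀ {k n} → Vec (Fin k) n → Fin k → ℕ
sumQ σ j = sumFinℕ (λ p → if does (lookup σ p Fin.≟ j) then val p else 0)

-- Step (3): the algorithm, started in state σ, can (for some choice of the
-- moves in step (3) and of the maximiser/minimiser/pair in step (4))
-- terminate with Failure.

module _ (k : ℕ) .{{_ : NonZero k}} (α : Fin k → ℚ) (n : ℕ) where

  s : ℕ
  s = sTarget n k

  Balanced : Vec (Fin k) n → Set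
  Balanced σ = ∀ j → sumQ σ j ≡ s

  IsMaxSum IsMinSum : Vec (Fin k) n → Fin k → Set
  IsMaxSum σ j' = ∀ j → sumQ σ j ℕ.≤ sumQ σ j'
  IsMinSum σ j'' = ∀ j → sumQ σ j'' ℕ.≤ sumQ σ j

  Δ : Vec (Fin k) n → Fin k → Fin k → ℕ
  Δ σ j' j'' = (sumQ σ j' ∸ s) ⊓ (s ∸ sumQ σ j'')

  ValidPair : Vec (Fin k) n → Fin k → Fin k → Fin n → Fin n → Set
  ValidPair σ j' j'' p' p'' =
    (lookup σ p' ≡ j') × (lookup σ p'' ≡ j'') ×
    (val p'' ℕ.< val p') × (val p' ∸ val p'' ℕ.≤ Δ σ j' j'')

  data Fails4 : Vec (Fin k) n → Set where
    fail : ∀ {σ} j' j'' → ¬ Balanced σ → IsMaxSum σ j' → IsMinSum σ j'' →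
           (∀ p' p'' → ¬ ValidPair σ j' j'' p' p'') → Fails4 σ
    swap : ∀ {σ} j' j'' p' p'' → ¬ Balanced σ → IsMaxSum σ j' → IsMinSum σ j'' →
           ValidPair σ j' j'' p' p'' →
           (∀ q' q'' → ValidPair σ j' j'' q' q'' →
              val q' ∸ val q'' ℕ.≤ val p' ∸ val p'') →
           Fails4 ((σ [ p' ]≔ j'') [ p'' ]≔ j') → Fails4 σ

  data Fails3 : Vec (Fin k) n → Set where
    move : ∀ {σ} j' j'' p →
           targetSize α n j' ℕ.< size σ j' → size σ j'' ℕ.< targetSize α n j'' →
           lookup σ p ≡ j' → Fails3 (σ [ p ]≔ j'') → Fails3 σ
    done : ∀ {σ} →
           ¬ ((∃ λ j' → targetSize α n j' ℕ.< size σ j') ×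
              (∃ λ j'' → size σ j'' ℕ.< targetSize α n j'')) →
           Fails4 σ → Fails3 σ

  Fails : Outcome k n → Set
  Fails X = Fails3 X

{-# OPTIONS --safe #-}

-- The fractional procedure pours the large elements until the densities of the first targets agree and
-- merges these targets. Positive slack leaves a volume proportional to n in the merged target as long
-- as some target is not merged yet. So linearly many small elements are poured only after all targets
-- have been merged, and each of them is put into every Q_j with probability at least some constant.
-- By an Azuma-Hoeffding bound, with exp (hY) replaced by 1 + hY to stay rational, all but exponentially
-- few outcomes have sizes within εn, sums within εn², and, for all j', j'' and every distance
-- d ≤ L = Θ(n), linearly many pairs z' ∈ Q_j', z'' ∈ Q_j'' with z' - z'' = d. Changing the set of one
-- element destroys at most two such pairs. A swap lowers Σ_j |S(Q_j) - s| + 2L #{j : S(Q_j) ≠ s} by at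
-- least 2L, because either it moves at least L or it has the exact size Δ and balances one more set. So
-- for small ε the algorithm balances all sums before it runs out of pairs.

module Submission where

open import Defs
open import Data.Rational using (ℚ)

-- Failure is nondeterministic: some choice of moves and swaps may fail. So the random part must
-- supply a property of the outcome that survives every choice. The distance of a swapped pair is
-- unknown, but pairs at every d ≤ L and the maximality of the chosen pair force it to be at least
-- min(Δ, L). Pair counts are quadratic in the independent choices. Revealing elements upwards makes
-- them linear in two stages: enough elements up to L lie in Q_j'', and given those, enough upper
-- partners lie in Q_j'. Each stage is a martingale bound and costs one factor c, the lower bound on
-- the probabilities of small elements. The scales: 1/q is at most α_1 and every slack; C = n/(2q),
-- as half of the slack pays for linear terms; L = floor(n/(4q)), so that both members of a pair are
-- at most C; Q is at least 1/c²; and ε = 1/E is so small that all moves and swaps together destroy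
-- fewer pairs than are guaranteed, which is more than L/(2Q). The base 1 - t stands in for exp(-δ),
-- and D is a Boolean test that contains all failing outcomes.

module Repair where

  open import Data.Nat
  open import Data.Nat.DivMod using (m≡m%n+[m/n]*n; m%n<n; m/n*n≤m)
  open import Data.Nat.Properties
  open import Data.Nat.Tactic.RingSolver using (solve-∀)
  open import Data.Bool using (if_then_else_)
  open import Data.Empty using (⊥; ⊥-elim)
  open import Data.Fin as Fin using (Fin)
  open import Data.Product using (∃; _×_; _,_; proj₁; proj₂)
  open import Data.Sum using (_⊎_; inj₁; inj₂)
  open import Data.Vec using (Vec; []; _∷_; lookup; _[_]≔_)
  open import Data.Vec.Properties using (lookup∘update′)
  open import Relation.Binary.PropositionalEquality
  open import Relation.Nullary using (¬_; yes; no; does; contradiction)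

  private variable
    k n : ℕ

  -- Sums and weights of the sets, and the effect of reassigning one element

  sumFinℕ-cong : ∀ {m} {f g : Fin m → ℕ} → (∀ i → f i ≡ g i) → sumFinℕ f ≡ sumFinℕ g
  sumFinℕ-cong {zero} eq = refl
  sumFinℕ-cong {suc m} eq = cong₂ _+_ (eq Fin.zero) (sumFinℕ-cong (λ i → eq (Fin.suc i)))

  sumFinℕ-mono : ∀ {m} {f g : Fin m → ℕ} → (∀ i → f i ≤ g i) → sumFinℕ f ≤ sumFinℕ g
  sumFinℕ-mono {zero} le = z≤n
  sumFinℕ-mono {suc m} le = +-mono-≤ (le Fin.zero) (sumFinℕ-mono (λ i → le (Fin.suc i)))

  sumFinℕ-+ : ∀ {m} (f g : Fin m → ℕ) → sumFinℕ (λ i → f i + g i) ≡ sumFinℕ f + sumFinℕ g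
  sumFinℕ-+ {zero} f g = refl
  sumFinℕ-+ {suc m} f g
    rewrite sumFinℕ-+ (λ i → f (Fin.suc i)) (λ i → g (Fin.suc i)) =
      interchange (f Fin.zero) (g Fin.zero) _ _
    where
    interchange : ∀ a b c d → (a + b) + (c + d) ≡ (a + c) + (b + d)
    interchange = solve-∀

  sumFinℕ-const : ∀ m c → sumFinℕ {m} (λ _ → c) ≡ m * c
  sumFinℕ-const zero c = refl
  sumFinℕ-const (suc m) c = cong (c +_) (sumFinℕ-const m c)

  sumFinℕ-zero : ∀ {m} {f : Fin m → ℕ} → (∀ i → f i ≡ 0) → sumFinℕ f ≡ 0
  sumFinℕ-zero {m} eq = trans (sumFinℕ-cong eq) (trans (sumFinℕ-const m 0) (*-zeroʳ m))

  sumFinℕ-tight : ∀ {m} {f g : Fin m → ℕ} → (∀ i → f i ≤ g i) → sumFinℕ f ≡ sumFinℕ g → ∀ i → f i ≡ g i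
  sumFinℕ-tight {suc m} {f} {g} le eq i = go i
    where
    tails = sumFinℕ-mono (λ i → le (Fin.suc i))
    head≡ : f Fin.zero ≡ g Fin.zero
    head≡ = ≤-antisym (le Fin.zero) (+-cancelʳ-≤ (sumFinℕ (λ i → g (Fin.suc i))) _ _
      (≤-trans (≤-reflexive (sym eq)) (+-monoʳ-≤ (f Fin.zero) tails)))
    go : ∀ i → f i ≡ g i
    go Fin.zero = head≡
    go (Fin.suc i) = sumFinℕ-tight (λ i → le (Fin.suc i))
      (+-cancelˡ-≡ (f Fin.zero) _ _ (trans eq (cong (_+ sumFinℕ (λ i → g (Fin.suc i))) (sym head≡)))) i

  δ : Fin k → Fin k → ℕ → ℕ
  δ i j c = if does (i Fin.≟ j) then c else 0

  δ-refl : ∀ (i : Fin k) c → δ i i c ≡ c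
  δ-refl i c with i Fin.≟ i
  ... | yes _ = refl
  ... | no i≢i = contradiction refl i≢i

  δ-≢ : ∀ {i j : Fin k} → i ≢ j → ∀ c → δ i j c ≡ 0
  δ-≢ {i = i} {j} i≢j c with i Fin.≟ j
  ... | yes i≡j = contradiction i≡j i≢j
  ... | no _ = refl

  δ≤ : ∀ (i j : Fin k) c → δ i j c ≤ c
  δ≤ i j c with i Fin.≟ j
  ... | yes _ = ≤-refl
  ... | no _ = z≤n

  sumFinℕ-δ : ∀ (i : Fin k) c → sumFinℕ (λ j → δ i j c) ≡ c
  sumFinℕ-δ {suc k} Fin.zero c = trans (cong (c +_) (sumFinℕ-zero {k} {λ i → δ Fin.zero (Fin.suc i) c} (λ _ → refl))) (+-identityʳ c)
  sumFinℕ-δ (Fin.suc i) c = sumFinℕ-δ i c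

  -- Both `sumQ` (with `val`) and `size` (with the constant 1) are instances by definition, so one
  -- update lemma serves moves and swaps.
  weight : (Fin n → ℕ) → Vec (Fin k) n → Fin k → ℕ
  weight f σ j = sumFinℕ (λ p → if does (lookup σ p Fin.≟ j) then f p else 0)

  -- The additive form avoids truncated subtraction, and no case distinction is needed when the old
  -- and the new set coincide.
  weight-update : ∀ (f : Fin n → ℕ) (σ : Vec (Fin k) n) p i j →
    weight f (σ [ p ]≔ i) j + δ (lookup σ p) j (f p) ≡ weight f σ j + δ i j (f p)
  weight-update f (h ∷ σ) Fin.zero i j = rotate (δ i j (f Fin.zero)) _ (δ h j (f Fin.zero))
    where
    rotate : ∀ a b c → (a + b) + c ≡ (c + b) + a
    rotate = solve-∀
  weight-update f (h ∷ σ) (Fin.suc p) i j =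
    trans (+-assoc (δ h j (f Fin.zero)) _ _)
      (trans (cong (δ h j (f Fin.zero) +_) (weight-update (λ q → f (Fin.suc q)) σ p i j))
        (sym (+-assoc (δ h j (f Fin.zero)) _ _)))

  weight-total : ∀ (f : Fin n → ℕ) (σ : Vec (Fin k) n) → sumFinℕ (weight f σ) ≡ sumFinℕ f
  weight-total {k = k} f [] = sumFinℕ-zero {k} (λ _ → refl)
  weight-total f (h ∷ σ) =
    trans (sumFinℕ-+ (λ j → δ h j (f Fin.zero)) (weight (λ q → f (Fin.suc q)) σ))
      (cong₂ _+_ (sumFinℕ-δ h (f Fin.zero)) (weight-total (λ q → f (Fin.suc q)) σ))

  -- Pairs of elements at a fixed distance

  rsum : ℕ → (ℕ → ℕ) → ℕ
  rsum zero f = 0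
  rsum (suc m) f = f m + rsum m f

  rsum-mono : ∀ m {f g : ℕ → ℕ} → (∀ i → f i ≤ g i) → rsum m f ≤ rsum m g
  rsum-mono zero le = z≤n
  rsum-mono (suc m) le = +-mono-≤ (le m) (rsum-mono m le)

  rsum-+ : ∀ m (f g : ℕ → ℕ) → rsum m (λ i → f i + g i) ≡ rsum m f + rsum m g
  rsum-+ zero f g = refl
  rsum-+ (suc m) f g rewrite rsum-+ m f g = interchange (f m) (g m) (rsum m f) (rsum m g)
    where
    interchange : ∀ a b c d → (a + b) + (c + d) ≡ (a + c) + (b + d)
    interchange = solve-∀

  rsum-zero : ∀ m {f : ℕ → ℕ} → (∀ i → i < m → f i ≡ 0) → rsum m f ≡ 0
  rsum-zero zero eq = refl
  rsum-zero (suc m) eq = cong₂ _+_ (eq m ≤-refl) (rsum-zero m (λ i i<m → eq i (m<n⇒m<1+n i<m)))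

  rsum-positive : ∀ m {f : ℕ → ℕ} → 0 < rsum m f → ∃ λ i → i < m × 0 < f i
  rsum-positive (suc m) {f} pos with f m in eq
  ... | suc c = m , ≤-refl , subst (0 <_) (sym eq) z<s
  ... | zero with rsum-positive m pos
  ...   | i , i<m , fi = i , m<n⇒m<1+n i<m , fi

  ι : ℕ → ℕ → ℕ
  ι a b with a ≟ b
  ... | yes _ = 1
  ... | no _ = 0

  ι-refl : ∀ a → ι a a ≡ 1
  ι-refl a with a ≟ a
  ... | yes _ = refl
  ... | no a≢a = contradiction refl a≢a

  ι-≢ : ∀ {a b} → a ≢ b → ι a b ≡ 0
  ι-≢ {a} {b} a≢b with a ≟ b
  ... | yes a≡b = contradiction a≡b a≢b
  ... | no _ = refl

  rsum-ι≤1 : ∀ m c v → rsum m (λ i → ι (suc (i + c)) v) ≤ 1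
  rsum-ι≤1 zero c v = z≤n
  rsum-ι≤1 (suc m) c v with suc (m + c) ≟ v
  ... | no _ = rsum-ι≤1 m c v
  ... | yes refl = ≤-reflexive (cong suc
        (rsum-zero m (λ i i<m → ι-≢ (λ eq → <⇒≢ i<m (+-cancelʳ-≡ c i m (suc-injective eq))))))

  -- Indexed by elements, not positions: 1 when the element m + 1 lies in Q_j, else 0.
  hit : Fin k → Vec (Fin k) n → ℕ → ℕ
  hit j [] m = 0
  hit {n = suc n} j (i ∷ σ) m with m ≟ n
  ... | yes _ = δ i j 1
  ... | no _ = hit j σ m

  hit≤1 : ∀ (j : Fin k) (σ : Vec (Fin k) n) m → hit j σ m ≤ 1
  hit≤1 j [] m = z≤n
  hit≤1 {n = suc n} j (i ∷ σ) m with m ≟ n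
  ... | yes _ = δ≤ i j 1
  ... | no _ = hit≤1 j σ m

  hit-position : ∀ (j : Fin k) (σ : Vec (Fin k) n) m → 0 < hit j σ m →
    ∃ λ p → lookup σ p ≡ j × val p ≡ suc m
  hit-position {n = suc n} j (i ∷ σ) m pos with m ≟ n
  ... | no _ with hit-position j σ m pos
  ...   | p , at , v = Fin.suc p , at , v
  hit-position {n = suc n} j (i ∷ σ) m pos | yes m≡n with i Fin.≟ j
  ... | yes i≡j = Fin.zero , i≡j , cong suc (sym m≡n)

  -- One-sided on purpose: only losses of pairs have to be controlled, and a loss can occur only at
  -- the reassigned element.
  hit-update : ∀ (j : Fin k) (σ : Vec (Fin k) n) p i m →
    hit j σ m ≤ hit j (σ [ p ]≔ i) m + ι (suc m) (val p)
  hit-update {n = suc n} j (h ∷ σ) Fin.zero i m with m ≟ n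
  ... | yes refl = ≤-trans (δ≤ h j 1)
          (≤-trans (≤-reflexive (sym (ι-refl (suc m)))) (m≤n+m (ι (suc m) (suc m)) (δ i j 1)))
  ... | no _ = m≤m+n (hit j σ m) _
  hit-update {n = suc n} j (h ∷ σ) (Fin.suc p) i m with m ≟ n
  ... | yes _ = m≤m+n (δ h j 1) _
  ... | no _ = hit-update j σ p i m

  -- Counts the pairs with smaller element m + 1 ≤ L in Q_j'' and larger element m + d + 1 in Q_j'.
  -- For d ≤ L no element above 2L is involved.
  pairs : ℕ → ℕ → Fin k → Fin k → Vec (Fin k) n → ℕ
  pairs L d j' j'' σ = rsum L (λ m → hit j'' σ m * hit j' σ (m + d))

  product-perturbed : ∀ {a b a' b' x y} → a ≤ 1 → b ≤ 1 → a ≤ a' + x → b ≤ b' + y →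
    a * b ≤ a' * b' + (x + y)
  product-perturbed z≤n b≤1 p q = z≤n
  product-perturbed (s≤s z≤n) z≤n p q = z≤n
  product-perturbed {a' = a'} {b'} {suc x} {y} (s≤s z≤n) (s≤s z≤n) p q = ≤-trans (s≤s z≤n) (m≤n+m (suc (x + y)) (a' * b'))
  product-perturbed {a' = a'} {b'} {zero} {suc y} (s≤s z≤n) (s≤s z≤n) p q = ≤-trans (s≤s z≤n) (m≤n+m (suc y) (a' * b'))
  product-perturbed {a' = a'} {b'} {zero} {zero} (s≤s z≤n) (s≤s z≤n) p q
    rewrite +-identityʳ a' | +-identityʳ b' | +-identityʳ (a' * b') = *-mono-≤ p q

  -- The reassigned element is the smaller member for at most one m and the larger member for at
  -- most one m.
  pairs-update : ∀ L d (j' j'' : Fin k) (σ : Vec (Fin k) n) p i →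
    pairs L d j' j'' σ ≤ pairs L d j' j'' (σ [ p ]≔ i) + 2
  pairs-update L d j' j'' σ p i = begin
    pairs L d j' j'' σ
      ≤⟨ rsum-mono L (λ m → product-perturbed {a' = hit j'' τ m} {b' = hit j' τ (m + d)} (hit≤1 j'' σ m) (hit≤1 j' σ (m + d))
           (hit-update j'' σ p i m) (hit-update j' σ p i (m + d))) ⟩
    rsum L (λ m → hit j'' τ m * hit j' τ (m + d) + (ι (suc m) (val p) + ι (suc (m + d)) (val p)))
      ≡⟨ rsum-+ L _ _ ⟩
    pairs L d j' j'' τ + rsum L (λ m → ι (suc m) (val p) + ι (suc (m + d)) (val p))
      ≡⟨ cong (pairs L d j' j'' τ +_) (rsum-+ L _ _) ⟩
    pairs L d j' j'' τ + (rsum L (λ m → ι (suc m) (val p)) + rsum L (λ m → ι (suc (m + d)) (val p)))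
      ≤⟨ +-monoʳ-≤ (pairs L d j' j'' τ) (+-mono-≤
           (≤-trans (rsum-mono L (λ m → ≤-reflexive (cong (λ z → ι (suc z) (val p)) (sym (+-identityʳ m)))))
             (rsum-ι≤1 L 0 (val p)))
           (rsum-ι≤1 L d (val p))) ⟩
    pairs L d j' j'' τ + 2 ∎
    where
    open ≤-Reasoning
    τ = σ [ p ]≔ i

  -- The potential argument for moves and swaps

  module Potential (k : ℕ) .{{_ : NonZero k}} (α : Fin k → ℚ) (n : ℕ)
    (total : sumFinℕ {n} val ≡ k * sTarget n k) (L : ℕ) (1≤L : 1 ≤ L) where

    t₀ : ℕ
    t₀ = sTarget n k

    sumQ-total : ∀ (σ : Vec (Fin k) n) → sumFinℕ (sumQ σ) ≡ sumFinℕ {k} (λ _ → t₀)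
    sumQ-total σ = trans (weight-total val σ) (trans total (sym (sumFinℕ-const k t₀)))

    -- The k sums add up to k times the target, so a maximum not above the target would force
    -- equality everywhere.
    max>s : ∀ σ j' → ¬ Balanced k α n σ → IsMaxSum k α n σ j' → t₀ < sumQ σ j'
    max>s σ j' unb mx with t₀ <? sumQ σ j'
    ... | yes lt = lt
    ... | no ≮ = ⊥-elim (unb (sumFinℕ-tight (λ j → ≤-trans (mx j) (≮⇒≥ ≮)) (sumQ-total σ)))

    min<s : ∀ σ j'' → ¬ Balanced k α n σ → IsMinSum k α n σ j'' → sumQ σ j'' < t₀
    min<s σ j'' unb mn with sumQ σ j'' <? t₀
    ... | yes lt = lt
    ... | no ≮ = ⊥-elim (unb (λ j → sym (sumFinℕ-tight (λ j → ≤-trans (≮⇒≥ ≮) (mn j)) (sym (sumQ-total σ)) j)))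

    AllPairs : ℕ → Vec (Fin k) n → Set
    AllPairs T σ = ∀ j' j'' d → 1 ≤ d → d ≤ L → T ≤ pairs L d j' j'' σ

    AllPairs-update : ∀ {T} (σ : Vec (Fin k) n) p i → AllPairs (2 + T) σ → AllPairs T (σ [ p ]≔ i)
    AllPairs-update {T} σ p i all j' j'' d 1≤d d≤L = +-cancelʳ-≤ 2 T _
      (≤-trans (≤-reflexive (+-comm T 2))
        (≤-trans (all j' j'' d 1≤d d≤L) (pairs-update L d j' j'' σ p i)))

    pair-at-distance : ∀ {T} σ j' j'' d → AllPairs (suc T) σ → 1 ≤ d → d ≤ L → d ≤ Δ k α n σ j' j'' →
      ∃ λ p' → ∃ λ p'' → ValidPair k α n σ j' j'' p' p'' × val p' ∸ val p'' ≡ d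
    pair-at-distance σ j' j'' d all 1≤d d≤L d≤Δ
      with rsum-positive L (≤-trans (s≤s z≤n) (all j' j'' d 1≤d d≤L))
    ... | m , m<L , pos
      with hit-position j'' σ m (m*n>0⇒m>0 (hit j'' σ m) pos)
         | hit-position j' σ (m + d) (m*n>0⇒m>0 (hit j' σ (m + d)) (subst (0 <_) (*-comm (hit j'' σ m) _) pos))
      where
      m*n>0⇒m>0 : ∀ a {b} → 0 < a * b → 0 < a
      m*n>0⇒m>0 (suc a) _ = s≤s z≤n
    ... | p'' , at'' , v'' | p' , at' , v' =
      p' , p'' , (at' , at'' , subst₂ _<_ (sym v'') (sym v') (s≤s (m<m+n m 1≤d)) , subst (_≤ _) (sym diff) d≤Δ) , diff
      where
      diff : val p' ∸ val p'' ≡ d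
      diff = trans (cong₂ _∸_ v' v'') (m+n∸m≡n m d)

    dev : ℕ → ℕ
    dev S = ∣ S - t₀ ∣

    pen : ℕ → ℕ
    pen S with S ≟ t₀
    ... | yes _ = 0
    ... | no _ = 2 * L

    pen-≡ : ∀ {S} → S ≡ t₀ → pen S ≡ 0
    pen-≡ {S} S≡ with S ≟ t₀
    ... | yes _ = refl
    ... | no S≢ = contradiction S≡ S≢

    pen-≢ : ∀ {S} → S ≢ t₀ → pen S ≡ 2 * L
    pen-≢ {S} S≢ with S ≟ t₀
    ... | yes S≡ = contradiction S≡ S≢
    ... | no _ = refl

    pen≤ : ∀ S → pen S ≤ 2 * L
    pen≤ S with S ≟ t₀
    ... | yes _ = z≤n
    ... | no _ = ≤-refl

    pot : ℕ → ℕ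
    pot S = dev S + pen S

    Ψ φ : Vec (Fin k) n → ℕ
    Ψ σ = sumFinℕ (λ j → dev (sumQ σ j))
    φ σ = sumFinℕ (λ j → pot (sumQ σ j))

    φ≤Ψ : ∀ σ → φ σ ≤ Ψ σ + 2 * L * k
    φ≤Ψ σ = begin
      φ σ ≤⟨ sumFinℕ-mono (λ j → +-monoʳ-≤ (dev (sumQ σ j)) (pen≤ (sumQ σ j))) ⟩
      sumFinℕ (λ j → dev (sumQ σ j) + 2 * L) ≡⟨ sumFinℕ-+ (λ j → dev (sumQ σ j)) (λ _ → 2 * L) ⟩
      Ψ σ + sumFinℕ {k} (λ _ → 2 * L) ≡⟨ cong (Ψ σ +_) (trans (sumFinℕ-const k (2 * L)) (*-comm k (2 * L))) ⟩
      Ψ σ + 2 * L * k ∎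
      where open ≤-Reasoning

    -- As S already pays the full penalty, whatever S' pays is no increase.
    pot-step : ∀ S S' {δ} → S ≢ t₀ → dev S' + δ ≡ dev S → pot S' + δ ≤ pot S
    pot-step S S' {δ} S≢ eq = begin
      dev S' + pen S' + δ ≤⟨ +-monoˡ-≤ δ (+-monoʳ-≤ (dev S') (pen≤ S')) ⟩
      dev S' + 2 * L + δ ≡⟨ rotate (dev S') (2 * L) δ ⟩
      dev S' + δ + 2 * L ≡⟨ cong₂ _+_ eq (sym (pen-≢ S≢)) ⟩
      pot S ∎
      where
      open ≤-Reasoning
      rotate : ∀ a b c → a + b + c ≡ a + c + b
      rotate = solve-∀

    pot-hit : ∀ S S' {δ} → S ≢ t₀ → S' ≡ t₀ → dev S' + δ ≡ dev S → pot S' + (δ + 2 * L) ≤ pot S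
    pot-hit S S' {δ} S≢ S'≡ eq = ≤-reflexive (begin
      dev S' + pen S' + (δ + 2 * L) ≡⟨ cong (λ z → dev S' + z + (δ + 2 * L)) (pen-≡ S'≡) ⟩
      dev S' + 0 + (δ + 2 * L) ≡⟨ rotate (dev S') (2 * L) δ ⟩
      dev S' + δ + 2 * L ≡⟨ cong₂ _+_ eq (sym (pen-≢ S≢)) ⟩
      pot S ∎)
      where
      open ≡-Reasoning
      rotate : ∀ a b c → a + 0 + (c + b) ≡ a + c + b
      rotate = solve-∀

    sumFinℕ-two-drops : ∀ {f g : Fin k → ℕ} {j' j''} D' D'' → j' ≢ j'' →
      f j' + D' ≤ g j' → f j'' + D'' ≤ g j'' → (∀ j → j' ≢ j → j'' ≢ j → f j ≤ g j) →
      sumFinℕ f + (D' + D'') ≤ sumFinℕ g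
    sumFinℕ-two-drops {f} {g} {j'} {j''} D' D'' j'≢j'' le' le'' rest = begin
      sumFinℕ f + (D' + D'')
        ≡⟨ cong (sumFinℕ f +_) (cong₂ _+_ (sym (sumFinℕ-δ j' D')) (sym (sumFinℕ-δ j'' D''))) ⟩
      sumFinℕ f + (sumFinℕ (λ j → δ j' j D') + sumFinℕ (λ j → δ j'' j D''))
        ≡⟨ cong (sumFinℕ f +_) (sym (sumFinℕ-+ (λ j → δ j' j D') (λ j → δ j'' j D''))) ⟩
      sumFinℕ f + sumFinℕ (λ j → δ j' j D' + δ j'' j D'')
        ≡⟨ sym (sumFinℕ-+ f (λ j → δ j' j D' + δ j'' j D'')) ⟩
      sumFinℕ (λ j → f j + (δ j' j D' + δ j'' j D'')) ≤⟨ sumFinℕ-mono pointwise ⟩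
      sumFinℕ g ∎
      where
      open ≤-Reasoning
      pointwise : ∀ j → f j + (δ j' j D' + δ j'' j D'') ≤ g j
      pointwise j with j' Fin.≟ j | j'' Fin.≟ j
      ... | yes refl | yes refl = contradiction refl j'≢j''
      ... | yes refl | no _ rewrite +-identityʳ D' = le'
      ... | no _ | yes refl = le''
      ... | no ≢' | no ≢'' rewrite +-identityʳ (f j) = rest j ≢' ≢''

    dev-down : ∀ S d → t₀ ≤ S → dev S + d ≡ dev (S + d)
    dev-down S d t≤S = begin
      dev S + d ≡⟨ cong (_+ d) (m≤n⇒∣n-m∣≡n∸m t≤S) ⟩
      (S ∸ t₀) + d ≡⟨ sym (+-∸-comm d t≤S) ⟩
      (S + d) ∸ t₀ ≡⟨ sym (m≤n⇒∣n-m∣≡n∸m (≤-trans t≤S (m≤m+n S d))) ⟩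
      dev (S + d) ∎
      where open ≡-Reasoning

    dev-up : ∀ S d → S + d ≤ t₀ → dev (S + d) + d ≡ dev S
    dev-up S d le = begin
      dev (S + d) + d ≡⟨ cong (_+ d) (m≤n⇒∣m-n∣≡n∸m le) ⟩
      (t₀ ∸ (S + d)) + d ≡⟨ cong (_+ d) (sym (∸-+-assoc t₀ S d)) ⟩
      (t₀ ∸ S ∸ d) + d ≡⟨ m∸n+n≡m (m+n≤o⇒m≤o∸n d (≤-trans (≤-reflexive (+-comm d S)) le)) ⟩
      t₀ ∸ S ≡⟨ sym (m≤n⇒∣m-n∣≡n∸m (m+n≤o⇒m≤o S le)) ⟩
      dev S ∎
      where open ≡-Reasoning

    module Swap {σ : Vec (Fin k) n} {j' j'' p' p''}
      (unb : ¬ Balanced k α n σ) (mx : IsMaxSum k α n σ j') (mn : IsMinSum k α n σ j'')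
      (valid : ValidPair k α n σ j' j'' p' p'') where

      σ₁ σ₂ : Vec (Fin k) n
      σ₁ = σ [ p' ]≔ j''
      σ₂ = σ₁ [ p'' ]≔ j'

      S S₂ : Fin k → ℕ
      S = sumQ σ
      S₂ = sumQ σ₂

      d : ℕ
      d = val p' ∸ val p''

      j'≢j'' : j' ≢ j''
      j'≢j'' refl = <-asym (max>s σ j' unb mx) (min<s σ j'' unb mn)

      lookup₁ : lookup σ₁ p'' ≡ j''
      lookup₁ = trans (lookup∘update′ p''≢p' σ j'') (proj₁ (proj₂ valid))
        where
        p''≢p' : p'' ≢ p'
        p''≢p' refl = <-irrefl refl (proj₁ (proj₂ (proj₂ valid)))

      val-split : val p' ≡ val p'' + d
      val-split = sym (m+[n∸m]≡n (<⇒≤ (proj₁ (proj₂ (proj₂ valid)))))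

      -- Two applications of `weight-update` for all sets at once; the three lemmas that follow
      -- specialise j to the giving set, the receiving set and any other set.
      sum-balance : ∀ j → S₂ j + δ j'' j (val p'') + δ j' j (val p') ≡
                          S j + δ j'' j (val p') + δ j' j (val p'')
      sum-balance j = begin
        S₂ j + δ j'' j v'' + δ j' j v'
          ≡⟨ cong (λ i → S₂ j + δ i j v'' + δ j' j v') (sym lookup₁) ⟩
        S₂ j + δ (lookup σ₁ p'') j v'' + δ j' j v'
          ≡⟨ cong (_+ δ j' j v') (weight-update val σ₁ p'' j' j) ⟩
        sumQ σ₁ j + δ j' j v'' + δ j' j v' ≡⟨ rotate (sumQ σ₁ j) (δ j' j v'') (δ j' j v') ⟩
        sumQ σ₁ j + δ j' j v' + δ j' j v''
          ≡⟨ cong (λ i → sumQ σ₁ j + δ i j v' + δ j' j v'') (sym (proj₁ valid)) ⟩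
        sumQ σ₁ j + δ (lookup σ p') j v' + δ j' j v''
          ≡⟨ cong (_+ δ j' j v'') (weight-update val σ p' j'' j) ⟩
        S j + δ j'' j v' + δ j' j v'' ∎
        where
        open ≡-Reasoning
        v' = val p'
        v'' = val p''
        rotate : ∀ a b c → a + b + c ≡ a + c + b
        rotate = solve-∀

      sum-j' : S j' ≡ S₂ j' + d
      sum-j' = +-cancelʳ-≡ (val p'') _ _ (begin
        S j' + v'' ≡⟨ cong (_+ v'') (sym (+-identityʳ (S j'))) ⟩
        S j' + 0 + v'' ≡⟨ cong₂ (λ a b → S j' + a + b) (sym (δ-≢ (≢-sym j'≢j'') v')) (sym (δ-refl j' v'')) ⟩
        S j' + δ j'' j' v' + δ j' j' v'' ≡⟨ sym (sum-balance j') ⟩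
        S₂ j' + δ j'' j' v'' + δ j' j' v' ≡⟨ cong₂ (λ a b → S₂ j' + a + b) (δ-≢ (≢-sym j'≢j'') v'') (δ-refl j' v') ⟩
        S₂ j' + 0 + v' ≡⟨ cong (S₂ j' + 0 +_) val-split ⟩
        S₂ j' + 0 + (v'' + d) ≡⟨ rotate (S₂ j') v'' d ⟩
        S₂ j' + d + v'' ∎)
        where
        open ≡-Reasoning
        v' = val p'
        v'' = val p''
        rotate : ∀ a b c → a + 0 + (b + c) ≡ a + c + b
        rotate = solve-∀

      sum-j'' : S₂ j'' ≡ S j'' + d
      sum-j'' = +-cancelʳ-≡ (val p'') _ _ (begin
        S₂ j'' + v'' ≡⟨ sym (+-identityʳ _) ⟩
        S₂ j'' + v'' + 0 ≡⟨ cong₂ (λ a b → S₂ j'' + a + b) (sym (δ-refl j'' v'')) (sym (δ-≢ j'≢j'' v')) ⟩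
        S₂ j'' + δ j'' j'' v'' + δ j' j'' v' ≡⟨ sum-balance j'' ⟩
        S j'' + δ j'' j'' v' + δ j' j'' v'' ≡⟨ cong₂ (λ a b → S j'' + a + b) (δ-refl j'' v') (δ-≢ j'≢j'' v'') ⟩
        S j'' + v' + 0 ≡⟨ cong (λ z → S j'' + z + 0) val-split ⟩
        S j'' + (v'' + d) + 0 ≡⟨ rotate (S j'') v'' d ⟩
        S j'' + d + v'' ∎)
        where
        open ≡-Reasoning
        v' = val p'
        v'' = val p''
        rotate : ∀ a b c → a + (b + c) + 0 ≡ a + c + b
        rotate = solve-∀

      sum-other : ∀ j → j' ≢ j → j'' ≢ j → S₂ j ≡ S j
      sum-other j ≢' ≢'' = begin
        S₂ j ≡⟨ sym (pad (S₂ j)) ⟩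
        S₂ j + 0 + 0 ≡⟨ cong₂ (λ a b → S₂ j + a + b) (sym (δ-≢ ≢'' v'')) (sym (δ-≢ ≢' v')) ⟩
        S₂ j + δ j'' j v'' + δ j' j v' ≡⟨ sum-balance j ⟩
        S j + δ j'' j v' + δ j' j v'' ≡⟨ cong₂ (λ a b → S j + a + b) (δ-≢ ≢'' v') (δ-≢ ≢' v'') ⟩
        S j + 0 + 0 ≡⟨ pad (S j) ⟩
        S j ∎
        where
        open ≡-Reasoning
        v' = val p'
        v'' = val p''
        pad : ∀ a → a + 0 + 0 ≡ a
        pad = solve-∀

      d≤over : d ≤ S j' ∸ t₀
      d≤over = ≤-trans (proj₂ (proj₂ (proj₂ valid))) (m⊓n≤m _ (t₀ ∸ S j''))

      d≤under : d ≤ t₀ ∸ S j''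
      d≤under = ≤-trans (proj₂ (proj₂ (proj₂ valid))) (m⊓n≤n (S j' ∸ t₀) _)

      dev-j' : dev (S₂ j') + d ≡ dev (S j')
      dev-j' = trans (dev-down (S₂ j') d t≤) (cong dev (sym sum-j'))
        where
        t≤ : t₀ ≤ S₂ j'
        t≤ = +-cancelʳ-≤ d _ _ (≤-trans (≤-trans (+-monoʳ-≤ t₀ d≤over)
          (≤-reflexive (m+[n∸m]≡n (<⇒≤ (max>s σ j' unb mx))))) (≤-reflexive sum-j'))

      dev-j'' : dev (S₂ j'') + d ≡ dev (S j'')
      dev-j'' = trans (cong (λ z → dev z + d) sum-j'') (dev-up (S j'') d
        (≤-trans (+-monoʳ-≤ (S j'') d≤under) (≤-reflexive (m+[n∸m]≡n (<⇒≤ (min<s σ j'' unb mn))))))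

      S-j'≢ : S j' ≢ t₀
      S-j'≢ eq = <-irrefl (sym eq) (max>s σ j' unb mx)

      S-j''≢ : S j'' ≢ t₀
      S-j''≢ eq = <-irrefl eq (min<s σ j'' unb mn)

      -- No penalty can appear: by `max>s` and `min<s` both changed sets pay it before the swap, and
      -- the other sums stay. A long swap lowers two deviations by d each; a swap of length Δ makes
      -- the set that attains the minimum exact and removes its penalty.
      φ-drop : L ≤ d ⊎ d ≡ Δ k α n σ j' j'' → φ σ₂ + 2 * L ≤ φ σ
      φ-drop (inj₁ L≤d) = ≤-trans (+-monoʳ-≤ (φ σ₂) (≤-trans (≤-reflexive (double L)) (+-mono-≤ L≤d L≤d)))
        (sumFinℕ-two-drops d d j'≢j'' (pot-step (S j') (S₂ j') S-j'≢ dev-j') (pot-step (S j'') (S₂ j'') S-j''≢ dev-j'')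
          (λ j ≢' ≢'' → ≤-reflexive (cong pot (sum-other j ≢' ≢''))))
        where
        double : ∀ a → 2 * a ≡ a + a
        double = solve-∀
      φ-drop (inj₂ d≡Δ) with ⊓-sel (S j' ∸ t₀) (t₀ ∸ S j'')
      ... | inj₁ eq = ≤-trans (+-monoʳ-≤ (φ σ₂) (≤-trans (m≤n+m (2 * L) d) (m≤m+n (d + 2 * L) d)))
        (sumFinℕ-two-drops (d + 2 * L) d j'≢j'' (pot-hit (S j') (S₂ j') S-j'≢ exact dev-j') (pot-step (S j'') (S₂ j'') S-j''≢ dev-j'')
          (λ j ≢' ≢'' → ≤-reflexive (cong pot (sum-other j ≢' ≢''))))
        where
        exact : S₂ j' ≡ t₀
        exact = +-cancelʳ-≡ d _ _ (trans (sym sum-j')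
          (trans (sym (m+[n∸m]≡n (<⇒≤ (max>s σ j' unb mx)))) (cong (t₀ +_) (sym (trans d≡Δ eq)))))
      ... | inj₂ eq = ≤-trans (+-monoʳ-≤ (φ σ₂) (≤-trans (m≤n+m (2 * L) d) (m≤n+m (d + 2 * L) d)))
        (sumFinℕ-two-drops d (d + 2 * L) j'≢j'' (pot-step (S j') (S₂ j') S-j'≢ dev-j') (pot-hit (S j'') (S₂ j'') S-j''≢ exact dev-j'')
          (λ j ≢' ≢'' → ≤-reflexive (cong pot (sum-other j ≢' ≢''))))
        where
        exact : S₂ j'' ≡ t₀
        exact = trans sum-j'' (trans (cong (S j'' +_) (trans d≡Δ eq)) (m+[n∸m]≡n (<⇒≤ (min<s σ j'' unb mn))))

    -- Serves twice: it excludes the return of Failure, and as a competitor to the maximal pair it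
    -- bounds the distance of the actual swap from below.
    target-distance : ∀ {T} σ j' j'' → ¬ Balanced k α n σ → IsMaxSum k α n σ j' → IsMinSum k α n σ j'' →
      AllPairs (suc T) σ →
      ∃ λ p' → ∃ λ p'' → ValidPair k α n σ j' j'' p' p'' × val p' ∸ val p'' ≡ Δ k α n σ j' j'' ⊓ L
    target-distance σ j' j'' unb mx mn all =
      pair-at-distance σ j' j'' (Δ k α n σ j' j'' ⊓ L) all
        (⊓-glb (⊓-glb (m<n⇒0<n∸m (max>s σ j' unb mx)) (m<n⇒0<n∸m (min<s σ j'' unb mn))) 1≤L)
        (m⊓n≤n _ L) (m⊓n≤m _ L)

    -- Here t bounds the number of swaps to come. A swap reassigns two elements and destroys at most
    -- four pairs per distance; the extra 1 leaves a pair until the end.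
    ¬Fails4 : ∀ t {σ} → φ σ ≤ 2 * L * t → AllPairs (suc (4 * t)) σ → ¬ Fails4 k α n σ
    ¬Fails4 t {σ} pot≤ all (fail j' j'' unb mx mn none) with target-distance σ j' j'' unb mx mn all
    ... | p' , p'' , valid , _ = none p' p'' valid
    ¬Fails4 t {σ} pot≤ all (swap j' j'' p' p'' unb mx mn valid best rest)
      with target-distance σ j' j'' unb mx mn all
    ... | q' , q'' , qvalid , q≡ = go t pot≤ all
      where
      open Swap {σ} {j'} {j''} {p'} {p''} unb mx mn valid
      far : Δ k α n σ j' j'' ⊓ L ≤ d
      far = ≤-trans (≤-reflexive (sym q≡)) (best q' q'' qvalid)
      progress : L ≤ d ⊎ d ≡ Δ k α n σ j' j''
      progress with ⊓-sel (Δ k α n σ j' j'') L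
      ... | inj₁ eq = inj₂ (≤-antisym (proj₂ (proj₂ (proj₂ valid))) (subst (_≤ d) eq far))
      ... | inj₂ eq = inj₁ (subst (_≤ d) eq far)
      go : ∀ t → φ σ ≤ 2 * L * t → AllPairs (suc (4 * t)) σ → ⊥
      go zero pot≤ all = <⇒≱ (≤-trans (*-monoʳ-≤ 2 1≤L) (m≤n+m (2 * L) (φ σ₂)))
        (≤-trans (φ-drop progress) (≤-trans (≤-trans pot≤ (≤-reflexive (*-zeroʳ (2 * L)))) (z≤n {1})))
      go (suc t) pot≤ all = ¬Fails4 t
        (+-cancelʳ-≤ (2 * L) _ _ (≤-trans (φ-drop progress) (≤-trans pot≤
          (≤-reflexive (trans (*-suc (2 * L) t) (+-comm (2 * L) (2 * L * t)))))))
        (AllPairs-update σ₁ p'' j' (AllPairs-update σ p' j''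
          (subst (λ z → AllPairs z σ) (four t) all)))
        rest
        where
        four : ∀ t → suc (4 * suc t) ≡ 2 + (2 + suc (4 * t))
        four = solve-∀

    -- The number of elements that lie in oversized sets beyond the prescribed sizes; it bounds the
    -- number of moves.
    excess : Vec (Fin k) n → ℕ
    excess σ = sumFinℕ (λ j → size σ j ∸ targetSize α n j)

    excess-move : ∀ (σ : Vec (Fin k) n) j' j'' p → targetSize α n j' < size σ j' →
      size σ j'' < targetSize α n j'' → lookup σ p ≡ j' → excess (σ [ p ]≔ j'') + 1 ≤ excess σ
    excess-move σ j' j'' p over under at =
      -- The receiving set was below its target, so its truncated excess is 0 before and after the
      -- move: its drop is 0.
      sumFinℕ-two-drops 1 0 j'≢j'' le' le'' rest
      where
      σ₁ = σ [ p ]≔ j''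
      j'≢j'' : j' ≢ j''
      j'≢j'' refl = <-asym over under
      balance : ∀ j → size σ₁ j + δ j' j 1 ≡ size σ j + δ j'' j 1
      balance j = trans (cong (λ i → size σ₁ j + δ i j 1) (sym at)) (weight-update (λ _ → 1) σ p j'' j)
      size-j' : size σ₁ j' + 1 ≡ size σ j'
      size-j' = trans (cong (size σ₁ j' +_) (sym (δ-refl j' 1)))
        (trans (balance j') (trans (cong (size σ j' +_) (δ-≢ (≢-sym j'≢j'') 1)) (+-identityʳ _)))
      size-j'' : size σ₁ j'' ≡ size σ j'' + 1
      size-j'' = trans (sym (+-identityʳ _)) (trans (cong (size σ₁ j'' +_) (sym (δ-≢ j'≢j'' 1)))
        (trans (balance j'') (cong (size σ j'' +_) (δ-refl j'' 1))))
      le' : size σ₁ j' ∸ targetSize α n j' + 1 ≤ size σ j' ∸ targetSize α n j'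
      le' = ≤-reflexive (trans (sym (+-∸-comm 1
        (+-cancelʳ-≤ 1 _ _ (≤-trans (≤-reflexive (+-comm _ 1)) (≤-trans over (≤-reflexive (sym size-j')))))))
        (cong (_∸ targetSize α n j') size-j'))
      le'' : size σ₁ j'' ∸ targetSize α n j'' + 0 ≤ size σ j'' ∸ targetSize α n j''
      le'' = ≤-trans (≤-reflexive (trans (+-identityʳ _) (m≤n⇒m∸n≡0
        (≤-trans (≤-reflexive (trans size-j'' (+-comm _ 1))) under)))) z≤n
      rest : ∀ j → j' ≢ j → j'' ≢ j → size σ₁ j ∸ targetSize α n j ≤ size σ j ∸ targetSize α n j
      rest j ≢' ≢'' = ≤-reflexive (cong (_∸ targetSize α n j)
        (trans (sym (+-identityʳ _)) (trans (cong (size σ₁ j +_) (sym (δ-≢ ≢' 1)))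
          (trans (balance j) (trans (cong (size σ j +_) (δ-≢ ≢'' 1)) (+-identityʳ _))))))

    dev-lipschitz : ∀ S₁ S a b → S₁ + a ≡ S + b → dev S₁ ≤ dev S + (a + b)
    dev-lipschitz S₁ S a b eq = begin
      ∣ S₁ - t₀ ∣ ≤⟨ ∣-∣-triangle S₁ S t₀ ⟩
      ∣ S₁ - S ∣ + dev S ≡⟨ +-comm _ (dev S) ⟩
      dev S + ∣ S₁ - S ∣ ≡⟨ cong (dev S +_) (sym (∣m+n-m+o∣≡∣n-o∣ a S₁ S)) ⟩
      dev S + ∣ a + S₁ - a + S ∣ ≡⟨ cong₂ (λ x y → dev S + ∣ x - y ∣) (trans (+-comm a S₁) eq) (+-comm a S) ⟩
      dev S + ∣ S + b - S + a ∣ ≡⟨ cong (dev S +_) (∣m+n-m+o∣≡∣n-o∣ S b a) ⟩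
      dev S + ∣ b - a ∣ ≤⟨ +-monoʳ-≤ (dev S) (≤-trans (∣m-n∣≤m⊔n b a) (m⊔n≤m+n b a)) ⟩
      dev S + (b + a) ≡⟨ cong (dev S +_) (+-comm b a) ⟩
      dev S + (a + b) ∎
      where open ≤-Reasoning

    val≤n : ∀ (p : Fin n) → val p ≤ n
    val≤n p = m∸n≤m n (Fin.toℕ p)

    -- An element of value at most n leaves one sum and enters one sum.
    Ψ-move : ∀ (σ : Vec (Fin k) n) p i → Ψ (σ [ p ]≔ i) ≤ Ψ σ + 2 * n
    Ψ-move σ p i = begin
      Ψ (σ [ p ]≔ i) ≤⟨ sumFinℕ-mono (λ j → dev-lipschitz (sumQ (σ [ p ]≔ i) j) (sumQ σ j)
             (δ (lookup σ p) j (val p)) (δ i j (val p)) (weight-update val σ p i j)) ⟩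
      sumFinℕ (λ j → dev (sumQ σ j) + (δ (lookup σ p) j v + δ i j v)) ≡⟨ sumFinℕ-+ (λ j → dev (sumQ σ j)) _ ⟩
      Ψ σ + sumFinℕ (λ j → δ (lookup σ p) j v + δ i j v)
        ≡⟨ cong (Ψ σ +_) (trans (sumFinℕ-+ (λ j → δ (lookup σ p) j v) (λ j → δ i j v))
             (cong₂ _+_ (sumFinℕ-δ (lookup σ p) v) (sumFinℕ-δ i v))) ⟩
      Ψ σ + (v + v) ≤⟨ +-monoʳ-≤ (Ψ σ) (+-mono-≤ (val≤n p) (val≤n p)) ⟩
      Ψ σ + (n + n) ≡⟨ cong (Ψ σ +_) (double n) ⟩
      Ψ σ + 2 * n ∎
      where
      open ≤-Reasoning
      v = val p
      double : ∀ a → a + a ≡ 2 * a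
      double = solve-∀

    -- The hypotheses prepay everything: each of at most e moves costs 2n of deviation and two
    -- pairs, and 2Lk covers the penalties when step (4) starts.
    ¬Fails3 : ∀ e t {σ} → excess σ ≤ e → Ψ σ + (2 * n * e + 2 * L * k) ≤ 2 * L * t →
      AllPairs (suc (2 * e + 4 * t)) σ → ¬ Fails3 k α n σ
    ¬Fails3 e t {σ} ex≤ Ψ≤ all (done _ fails) = ¬Fails4 t
      (≤-trans (φ≤Ψ σ) (≤-trans (+-monoʳ-≤ (Ψ σ) (m≤n+m _ (2 * n * e))) Ψ≤))
      (λ j' j'' d 1≤d d≤L → ≤-trans (s≤s (m≤n+m (4 * t) (2 * e))) (all j' j'' d 1≤d d≤L)) fails
    ¬Fails3 zero t {σ} ex≤ Ψ≤ all (move j' j'' p over under at fails) =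
      <⇒≱ (≤-trans (m≤n+m 1 (excess (σ [ p ]≔ j''))) (excess-move σ j' j'' p over under at)) ex≤
    ¬Fails3 (suc e) t {σ} ex≤ Ψ≤ all (move j' j'' p over under at fails) = ¬Fails3 e t
      (+-cancelʳ-≤ 1 _ _ (≤-trans (excess-move σ j' j'' p over under at) (≤-trans ex≤ (≤-reflexive (+-comm 1 e)))))
      (≤-trans (+-monoˡ-≤ _ (Ψ-move σ p j''))
        (≤-trans (≤-reflexive (regroup (Ψ σ) n e (2 * L * k))) Ψ≤))
      (AllPairs-update σ p j'' (subst (λ z → AllPairs z σ) (two e (4 * t)) all))
      fails
      where
      regroup : ∀ a n e b → a + 2 * n + (2 * n * e + b) ≡ a + (2 * n * suc e + b)
      regroup = solve-∀
      two : ∀ e c → suc (2 * suc e + c) ≡ 2 + suc (2 * e + c)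
      two = solve-∀

  -- Arithmetic of the move and swap budgets

  double-total : ∀ n → 2 * sumFinℕ {n} val ≡ n * suc n
  double-total zero = refl
  double-total (suc n) = trans (distrib (suc n) (sumFinℕ {n} val))
    (trans (cong (2 * suc n +_) (double-total n)) (step n))
    where
    distrib : ∀ a b → 2 * (a + b) ≡ 2 * a + 2 * b
    distrib = solve-∀
    step : ∀ n → 2 * suc n + n * suc n ≡ suc n * suc (suc n)
    step = solve-∀

  scaled-sum≤ : ∀ {m} E B (f : Fin m → ℕ) → (∀ j → E * f j ≤ B) → E * sumFinℕ f ≤ m * B
  scaled-sum≤ {zero} E B f le = ≤-reflexive (*-zeroʳ E)
  scaled-sum≤ {suc m} E B f le = ≤-trans (≤-reflexive (*-distribˡ-+ E (f Fin.zero) _))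
    (+-mono-≤ (le Fin.zero) (scaled-sum≤ E B (λ j → f (Fin.suc j)) (λ j → le (Fin.suc j))))

  module Budget (k n L w Q G E e Ψ g : ℕ) (1≤k : 1 ≤ k) (1≤w : 1 ≤ w) (1≤Q : 1 ≤ Q)
    (G≡ : G ≡ 32 * Q) (E≡ : E ≡ 3 * (k * (w * w)) * G) (n≤ : n ≤ w * L)
    (Ee≤ : E * e ≤ k * n) (EΨ≤ : E * Ψ ≤ k * (n * n))
    (Gg≤L : G * g ≤ L) (L≤Gg : L ≤ G * suc g) (L-large : 4 * (Q * (5 + 4 * k)) ≤ L) where

    t : ℕ
    t = k + suc g

    private
      positive : ∀ {a b} → 1 ≤ a → 1 ≤ b → NonZero (a * b)
      positive {suc a} {suc b} _ _ = _
      instance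
        kww≢0 : NonZero (3 * (k * (w * w)))
        kww≢0 = positive {3} (s≤s z≤n) (*-mono-≤ 1≤k (*-mono-≤ 1≤w 1≤w))
        kw≢0 : NonZero (k * w)
        kw≢0 = positive 1≤k 1≤w
        G≢0 : NonZero G
        G≢0 = subst NonZero (sym G≡) (positive {32} (s≤s z≤n) 1≤Q)
        16Q≢0 : NonZero (16 * Q)
        16Q≢0 = positive {16} (s≤s z≤n) 1≤Q

    Ge≤L : G * e ≤ L
    Ge≤L = ≤-trans (≤-trans (≤-reflexive (sym (*-identityˡ (G * e))))
      (*-monoˡ-≤ (G * e) (*-mono-≤ {1} {3} (s≤s z≤n) 1≤w)))
      (*-cancelˡ-≤ (k * w) (begin
        k * w * (3 * w * (G * e)) ≡⟨ eq k w G e ⟩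
        3 * (k * (w * w)) * G * e ≡⟨ cong (_* e) (sym E≡) ⟩
        E * e ≤⟨ Ee≤ ⟩
        k * n ≤⟨ *-monoʳ-≤ k n≤ ⟩
        k * (w * L) ≡⟨ sym (*-assoc k w L) ⟩
        k * w * L ∎))
      where
      open ≤-Reasoning
      eq : ∀ k w G e → k * w * (3 * w * (G * e)) ≡ 3 * (k * (w * w)) * G * e
      eq = solve-∀

    -- The 3 in E arises here: Ψ contributes kn²/E and the moves contribute 2kn²/E, together at most
    -- L²/G ≤ L (g + 1). The summand k of t covers the penalties.
    potential-bound : Ψ + (2 * n * e + 2 * L * k) ≤ 2 * L * t
    potential-bound = begin
      Ψ + (2 * n * e + 2 * L * k) ≡⟨ sym (+-assoc Ψ _ _) ⟩
      Ψ + 2 * n * e + 2 * L * k ≤⟨ +-monoˡ-≤ (2 * L * k) (≤-trans (*-cancelˡ-≤ G G-bound) (m≤n*m (L * suc g) 2)) ⟩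
      2 * (L * suc g) + 2 * L * k ≡⟨ eq L g k ⟩
      2 * L * t ∎
      where
      open ≤-Reasoning
      eq : ∀ L g k → 2 * (L * suc g) + 2 * L * k ≡ 2 * L * (k + suc g)
      eq = solve-∀
      eq₁ : ∀ E n e Ψ → E * (Ψ + 2 * n * e) ≡ E * Ψ + 2 * n * (E * e)
      eq₁ = solve-∀
      eq₂ : ∀ k n → k * (n * n) + 2 * n * (k * n) ≡ 3 * (k * (n * n))
      eq₂ = solve-∀
      eq₃ : ∀ k w L → 3 * (k * (w * L * (w * L))) ≡ 3 * (k * (w * w)) * (L * L)
      eq₃ = solve-∀
      eq₄ : ∀ L G g → L * (G * g) ≡ G * (L * g)
      eq₄ = solve-∀
      scaled : 3 * (k * (w * w)) * (G * (Ψ + 2 * n * e)) ≤ 3 * (k * (w * w)) * (L * L)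
      scaled = begin
        3 * (k * (w * w)) * (G * (Ψ + 2 * n * e)) ≡⟨ sym (*-assoc (3 * (k * (w * w))) G _) ⟩
        3 * (k * (w * w)) * G * (Ψ + 2 * n * e) ≡⟨ cong (_* (Ψ + 2 * n * e)) (sym E≡) ⟩
        E * (Ψ + 2 * n * e) ≡⟨ eq₁ E n e Ψ ⟩
        E * Ψ + 2 * n * (E * e) ≤⟨ +-mono-≤ EΨ≤ (*-monoʳ-≤ (2 * n) Ee≤) ⟩
        k * (n * n) + 2 * n * (k * n) ≡⟨ eq₂ k n ⟩
        3 * (k * (n * n)) ≤⟨ *-monoʳ-≤ 3 (*-monoʳ-≤ k (*-mono-≤ n≤ n≤)) ⟩
        3 * (k * (w * L * (w * L))) ≡⟨ eq₃ k w L ⟩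
        3 * (k * (w * w)) * (L * L) ∎
      G-bound : G * (Ψ + 2 * n * e) ≤ G * (L * suc g)
      G-bound = ≤-trans (*-cancelˡ-≤ (3 * (k * (w * w))) scaled)
        (≤-trans (*-monoʳ-≤ L L≤Gg) (≤-reflexive (eq₄ L G (suc g))))

    -- Multiplied by 16Q, the moves cost Ge ≤ L, the term g of the swaps costs 2Gg ≤ 2L and the
    -- constants cost at most 4L. The total 7L is less than 8L < 16QP.
    pairs-bound : ∀ P → L < 2 * (Q * P) → suc (2 * e + 4 * t) ≤ P
    pairs-bound P L<2QP = <⇒≤ (*-cancelˡ-< (16 * Q) _ _ (begin-strict
      16 * Q * suc (2 * e + 4 * t) ≡⟨ eq₁ Q e k g ⟩
      32 * Q * e + 2 * (32 * Q * g) + 4 * (4 * (Q * (5 + 4 * k)))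
        ≡⟨ cong (λ z → z * e + 2 * (z * g) + 4 * (4 * (Q * (5 + 4 * k)))) (sym G≡) ⟩
      G * e + 2 * (G * g) + 4 * (4 * (Q * (5 + 4 * k)))
        ≤⟨ +-mono-≤ (+-mono-≤ Ge≤L (*-monoʳ-≤ 2 Gg≤L)) (*-monoʳ-≤ 4 L-large) ⟩
      L + 2 * L + 4 * L ≤⟨ m≤m+n _ L ⟩
      L + 2 * L + 4 * L + L ≡⟨ eq₂ L ⟩
      8 * L <⟨ *-monoʳ-< 8 L<2QP ⟩
      8 * (2 * (Q * P)) ≡⟨ eq₃ Q P ⟩
      16 * Q * P ∎))
      where
      open ≤-Reasoning
      eq₁ : ∀ Q e k g → 16 * Q * suc (2 * e + 4 * (k + suc g)) ≡
        32 * Q * e + 2 * (32 * Q * g) + 4 * (4 * (Q * (5 + 4 * k)))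
      eq₁ = solve-∀
      eq₂ : ∀ L → L + 2 * L + 4 * L + L ≡ 8 * L
      eq₂ = solve-∀
      eq₃ : ∀ Q P → 8 * (2 * (Q * P)) ≡ 16 * Q * P
      eq₃ = solve-∀

  budget-constant : ∀ k w Q → 1 ≤ k → 1 ≤ w → 4 * (Q * w) ≤ 3 * (k * (w * w)) * (32 * Q)
  budget-constant k w Q 1≤k 1≤w = ≤-trans (m≤m*n (4 * (Q * w)) (24 * (k * w)) {{>-nonZero (*-mono-≤ {1} {24} (s≤s z≤n) (*-mono-≤ 1≤k 1≤w))}})
    (≤-reflexive (eq k w Q))
    where
    eq : ∀ k w Q → 4 * (Q * w) * (24 * (k * w)) ≡ 3 * (k * (w * w)) * (32 * Q)
    eq = solve-∀

  m<n*suc[m/n] : ∀ m n .{{_ : NonZero n}} → m < n * suc (m / n)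
  m<n*suc[m/n] m n = begin-strict
    m ≡⟨ m≡m%n+[m/n]*n m n ⟩
    m % n + m / n * n <⟨ +-monoˡ-< (m / n * n) (m%n<n m n) ⟩
    n + m / n * n ≡⟨ cong (n +_) (*-comm (m / n) n) ⟩
    n + n * (m / n) ≡⟨ sym (*-suc n (m / n)) ⟩
    n * suc (m / n) ∎
    where open ≤-Reasoning

  -- Once L ≥ 1, rounding down loses at most a factor 2, which turns 4q into the 8q used as w.
  window : ∀ n q → .{{_ : NonZero (4 * q)}} → 1 ≤ q → let L = n / (4 * q) in
    1 ≤ L → n ≤ 8 * q * L × L + L ≤ n
  window n q 1≤q 1≤L = ≤-trans (<⇒≤ (m<n*suc[m/n] n (4 * q))) (≤-trans (*-monoʳ-≤ (4 * q) (+-monoˡ-≤ L 1≤L)) (≤-reflexive (eq₁ q L))) ,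
    ≤-trans (≤-trans (≤-reflexive (eq₂ L)) (*-monoʳ-≤ L (≤-trans (s≤s (s≤s z≤n)) (*-monoʳ-≤ 4 1≤q)))) (m/n*n≤m n (4 * q))
    where
    L = n / (4 * q)
    eq₁ : ∀ q L → 4 * q * (L + L) ≡ 8 * q * L
    eq₁ = solve-∀
    eq₂ : ∀ L → L + L ≡ L * 2
    eq₂ = solve-∀

import Data.List.Relation.Unary.All.Properties as AllP
open import Data.Bool using (Bool; true; false; _∨_; if_then_else_)
open import Data.Fin as Fin using (Fin; toℕ)
open import Data.Fin.Properties as FinP using ()
open import Data.Integer as ℤ using (+_)
open import Data.Integer.DivMod as ℤDivMod using ()
open import Data.Integer.Properties as ℤP using ()
open import Data.List as List using (List; []; _∷_; _++_; map; foldr; length)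
open import Data.List.Properties as ListP using ()
open import Data.List.Relation.Unary.All using (All; []; _∷_)
open import Data.Nat as ℕ using (ℕ; zero; suc; NonZero; z≤n; s≤s) renaming (_≤_ to _≤ℕ_)
open import Data.Nat.Coprimality as Coprimality using ()
open import Data.Nat.DivMod as DivMod using ()
open import Data.Nat.Properties as ℕP using ()
open import Data.Product using (Σ; ∃; _×_; _,_; proj₁; proj₂)
open import Data.Rational as ℚ using (ℚ; 0ℚ; 1ℚ; ½; _+_; _*_; _-_; -_; _<_; _≤_)
open import Data.Rational.Properties as ℚP using (≤-trans; ≤-refl; ≤-reflexive; <⇒≤; module ≤-Reasoning)
open import Data.Rational.Unnormalised as ℚᵘ using ()
open import Data.Rational.Unnormalised.Properties as ℚᵘP using ()
open import Data.Sum using (_⊎_; inj₁; inj₂)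
open import Data.Vec as Vec using (Vec; lookup)
open import Level using (0ℓ)
open import Relation.Binary.Definitions using (tri<; tri≈; tri>)
open import Relation.Binary.PropositionalEquality hiding ([_])
open import Relation.Nullary using (¬_; Dec; yes; no; does; contradiction)
open import Relation.Nullary.Decidable using (dec⇒maybe)
open import Tactic.RingSolver using (solve-∀)
open import Tactic.RingSolver.Core.AlmostCommutativeRing using (AlmostCommutativeRing; fromCommutativeRing)

-- Ordered-field toolkit for ℚ

ring : AlmostCommutativeRing 0ℓ 0ℓ
ring = fromCommutativeRing ℚP.+-*-commutativeRing λ x → dec⇒maybe (0ℚ ℚP.≟ x)

2ℚ : ℚ
2ℚ = 1ℚ + 1ℚ

4ℚ : ℚ
4ℚ = 2ℚ + 2ℚ

0≤1 : 0ℚ ≤ 1ℚ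
0≤1 = ℚP.nonNegative⁻¹ 1ℚ

0≤½ : 0ℚ ≤ ½
0≤½ = ℚP.nonNegative⁻¹ ½

0≤2 : 0ℚ ≤ 2ℚ
0≤2 = ℚP.nonNegative⁻¹ 2ℚ

0≤-+ : ∀ {p q} → 0ℚ ≤ p → 0ℚ ≤ q → 0ℚ ≤ p + q
0≤-+ 0≤p 0≤q = ℚP.+-mono-≤ 0≤p 0≤q

0≤-* : ∀ {p q} → 0ℚ ≤ p → 0ℚ ≤ q → 0ℚ ≤ p * q
0≤-* {p} {q} 0≤p 0≤q =
  ℚP.nonNegative⁻¹ (p * q) {{ℚP.nonNeg*nonNeg⇒nonNeg p {{ℚ.nonNegative 0≤p}} q {{ℚ.nonNegative 0≤q}}}}

0<-* : ∀ {p q} → 0ℚ < p → 0ℚ < q → 0ℚ < p * q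
0<-* {p} {q} 0<p 0<q =
  ℚP.positive⁻¹ (p * q) {{ℚP.pos*pos⇒pos p {{ℚ.positive 0<p}} q {{ℚ.positive 0<q}}}}

≤-by : ∀ {p q} e → 0ℚ ≤ e → p + e ≡ q → p ≤ q
≤-by {p} e 0≤e refl = ≤-trans (≤-reflexive (sym (ℚP.+-identityʳ p))) (ℚP.+-monoʳ-≤ p 0≤e)

<-by : ∀ {p q} e → 0ℚ < e → p + e ≡ q → p < q
<-by {p} e 0<e refl = ℚP.≤-<-trans (≤-reflexive (sym (ℚP.+-identityʳ p))) (ℚP.+-monoʳ-< p 0<e)

0≤-diff : ∀ {p q} → p ≤ q → 0ℚ ≤ q - p
0≤-diff {p} {q} p≤q = subst (_≤ q - p) (ℚP.+-inverseʳ p) (ℚP.+-monoˡ-≤ (- p) p≤q)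

0<-diff : ∀ {p q} → p < q → 0ℚ < q - p
0<-diff {p} {q} p<q = subst (_< q - p) (ℚP.+-inverseʳ p) (ℚP.+-monoˡ-< (- p) p<q)

≤∧≢⇒< : ∀ {p q} → p ≤ q → p ≢ q → p < q
≤∧≢⇒< {p} {q} p≤q p≢q with ℚP.<-cmp p q
... | tri< p<q _ _ = p<q
... | tri≈ _ p≡q _ = contradiction p≡q p≢q
... | tri> _ _ q<p = contradiction (ℚP.<-≤-trans q<p p≤q) (ℚP.<-irrefl refl)

*-monoʳ : ∀ {r p q} → 0ℚ ≤ r → p ≤ q → r * p ≤ r * q
*-monoʳ {r} 0≤r = ℚP.*-monoˡ-≤-nonNeg r {{ℚ.nonNegative 0≤r}}

*-monoˡ : ∀ {r p q} → 0ℚ ≤ r → p ≤ q → p * r ≤ q * r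
*-monoˡ {r} 0≤r = ℚP.*-monoʳ-≤-nonNeg r {{ℚ.nonNegative 0≤r}}

*-mono : ∀ {p q r t} → 0ℚ ≤ p → 0ℚ ≤ t → p ≤ q → r ≤ t → p * r ≤ q * t
*-mono 0≤p 0≤t p≤q r≤t = ≤-trans (*-monoʳ 0≤p r≤t) (*-monoˡ 0≤t p≤q)

*-cancelʳ : ∀ {p q r} → 0ℚ < r → p * r ≤ q * r → p ≤ q
*-cancelʳ {r = r} 0<r = ℚP.*-cancelʳ-≤-pos r {{ℚ.positive 0<r}}

0≤-cancelʳ : ∀ {p r} → 0ℚ < r → 0ℚ ≤ p * r → 0ℚ ≤ p
0≤-cancelʳ {p} {r} 0<r 0≤pr = *-cancelʳ 0<r (subst (_≤ p * r) (sym (ℚP.*-zeroˡ r)) 0≤pr)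

0<-cancelʳ : ∀ {p r} → 0ℚ ≤ r → 0ℚ < p * r → 0ℚ < p
0<-cancelʳ {p} {r} 0≤r 0<pr =
  ℚP.*-cancelʳ-<-nonNeg r {{ℚ.nonNegative 0≤r}} (subst (_< p * r) (sym (ℚP.*-zeroˡ r)) 0<pr)

0≤-square : ∀ p → 0ℚ ≤ p * p
0≤-square p with ℚP.≤-total 0ℚ p
... | inj₁ 0≤p = 0≤-* 0≤p 0≤p
... | inj₂ p≤0 = subst (0ℚ ≤_) (eq p) (0≤-* 0≤-p 0≤-p)
  where
  0≤-p : 0ℚ ≤ - p
  0≤-p = subst (0ℚ ≤_) (ℚP.+-identityˡ (- p)) (0≤-diff p≤0)
  eq : ∀ p → - p * - p ≡ p * p
  eq = solve-∀ ring

inverse : ∀ q → 0ℚ < q → ∃ λ r → 0ℚ < r × r * q ≡ 1ℚ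
inverse q 0<q = (ℚ.1/ q) {{nz}} , ℚP.positive⁻¹ _ {{ℚP.1/pos⇒pos q {{ℚ.positive 0<q}}}} , ℚP.*-inverseˡ q {{nz}}
  where
  nz : ℚ.NonZero q
  nz = ℚP.pos⇒nonZero q {{ℚ.positive 0<q}}

÷'-* : ∀ p q → q ≢ 0ℚ → (p ÷' q) * q ≡ p
÷'-* p q q≢0 with q ℚP.≟ 0ℚ
... | yes q≡0 = contradiction q≡0 q≢0
... | no ≢0 = begin
  p * (ℚ.1/ q) {{nz}} * q ≡⟨ ℚP.*-assoc p _ q ⟩
  p * ((ℚ.1/ q) {{nz}} * q) ≡⟨ cong (p *_) (ℚP.*-inverseˡ q {{nz}}) ⟩
  p * 1ℚ ≡⟨ ℚP.*-identityʳ p ⟩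
  p ∎
  where
  open ≡-Reasoning
  nz : ℚ.NonZero q
  nz = ℚ.≢-nonZero ≢0

-- Naturals inside ℚ

toℚᵘ-ℕ→ℚ : ∀ m → ℚ.toℚᵘ (ℕ→ℚ m) ℚᵘ.≃ ℚᵘ.mkℚᵘ (+ m) 0
toℚᵘ-ℕ→ℚ m = ℚP.toℚᵘ-fromℚᵘ (ℚᵘ.mkℚᵘ (+ m) 0)

ℕ→ℚ-+ : ∀ m n → ℕ→ℚ (m ℕ.+ n) ≡ ℕ→ℚ m + ℕ→ℚ n
ℕ→ℚ-+ m n = ℚP.toℚᵘ-injective (ℚᵘP.≃-trans (toℚᵘ-ℕ→ℚ (m ℕ.+ n))
  (ℚᵘP.≃-sym (ℚᵘP.≃-trans (ℚP.toℚᵘ-homo-+ (ℕ→ℚ m) (ℕ→ℚ n))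
    (ℚᵘP.≃-trans (ℚᵘP.+-cong (toℚᵘ-ℕ→ℚ m) (toℚᵘ-ℕ→ℚ n))
      (ℚᵘ.*≡* (cong (ℤ._* + 1) (cong₂ ℤ._+_ (ℤP.*-identityʳ (+ m)) (ℤP.*-identityʳ (+ n)))))))))

ℕ→ℚ-* : ∀ m n → ℕ→ℚ (m ℕ.* n) ≡ ℕ→ℚ m * ℕ→ℚ n
ℕ→ℚ-* m n = ℚP.toℚᵘ-injective (ℚᵘP.≃-trans (toℚᵘ-ℕ→ℚ (m ℕ.* n))
  (ℚᵘP.≃-sym (ℚᵘP.≃-trans (ℚP.toℚᵘ-homo-* (ℕ→ℚ m) (ℕ→ℚ n))
    (ℚᵘP.≃-trans (ℚᵘP.*-cong (toℚᵘ-ℕ→ℚ m) (toℚᵘ-ℕ→ℚ n))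
      (ℚᵘ.*≡* (cong (ℤ._* + 1) (sym (ℤP.pos-* m n))))))))

ℕ→ℚ-suc : ∀ m → ℕ→ℚ (suc m) ≡ ℕ→ℚ m + 1ℚ
ℕ→ℚ-suc m = trans (ℕ→ℚ-+ 1 m) (ℚP.+-comm 1ℚ (ℕ→ℚ m))

0≤ℕ→ℚ : ∀ m → 0ℚ ≤ ℕ→ℚ m
0≤ℕ→ℚ m = ℚP.nonNegative⁻¹ (ℕ→ℚ m) {{ℚP.normalize-nonNeg m 1}}

ℕ→ℚ-mono : ∀ {m n} → m ≤ℕ n → ℕ→ℚ m ≤ ℕ→ℚ n
ℕ→ℚ-mono {m} {n} m≤n = ≤-by (ℕ→ℚ (n ℕ.∸ m)) (0≤ℕ→ℚ (n ℕ.∸ m))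
  (trans (sym (ℕ→ℚ-+ m (n ℕ.∸ m))) (cong ℕ→ℚ (ℕP.m+[n∸m]≡n m≤n)))

ℕ→ℚ-mono-< : ∀ {m n} → m ℕ.< n → ℕ→ℚ m < ℕ→ℚ n
ℕ→ℚ-mono-< {m} {n} m<n =
  ℚP.<-≤-trans (<-by 1ℚ (ℚP.positive⁻¹ 1ℚ) (sym (ℕ→ℚ-suc m))) (ℕ→ℚ-mono m<n)

ℕ→ℚ-cancel-< : ∀ {m n} → ℕ→ℚ m < ℕ→ℚ n → m ℕ.< n
ℕ→ℚ-cancel-< {m} {n} lt with m ℕP.<? n
... | yes m<n = m<n
... | no m≮n = contradiction (ℚP.<-≤-trans lt (ℕ→ℚ-mono (ℕP.≮⇒≥ m≮n))) (ℚP.<-irrefl refl)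

archimedean : ∀ p → ∃ λ m → 1 ≤ℕ m × p ≤ ℕ→ℚ m
archimedean p@record{} = suc ℤ.∣ ℚ.↥ p ∣ , s≤s z≤n , ℚP.toℚᵘ-cancel-≤
  (ℚᵘP.≤-respʳ-≃ (ℚᵘP.≃-sym (toℚᵘ-ℕ→ℚ (suc ℤ.∣ ℚ.↥ p ∣))) bound)
  where
  i≤∣i∣ : ∀ i → i ℤ.≤ + ℤ.∣ i ∣
  i≤∣i∣ (+ _) = ℤP.≤-refl
  i≤∣i∣ ℤ.-[1+ _ ] = ℤ.-≤+
  bound : ℚ.toℚᵘ p ℚᵘ.≤ ℚᵘ.mkℚᵘ (+ suc ℤ.∣ ℚ.↥ p ∣) 0
  bound = ℚᵘ.*≤* (subst₂ ℤ._≤_ (sym (ℤP.*-identityʳ (ℚ.↥ p))) (ℤP.pos-* (suc ℤ.∣ ℚ.↥ p ∣) (ℚ.↧ₙ p))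
    (ℤP.≤-trans (i≤∣i∣ (ℚ.↥ p)) (ℤ.+≤+ (ℕP.≤-trans (ℕP.n≤1+n _)
      (ℕP.m≤m*n (suc ℤ.∣ ℚ.↥ p ∣) (ℚ.↧ₙ p))))))

reciprocal-bound : ∀ p → 0ℚ < p → ∃ λ m → 1 ≤ℕ m × 1ℚ ≤ p * ℕ→ℚ m
reciprocal-bound p 0<p with inverse p 0<p
... | r , 0<r , rp≡1 with archimedean r
...   | m , 1≤m , r≤m = m , 1≤m ,
  subst (_≤ p * ℕ→ℚ m) (trans (ℚP.*-comm p r) rp≡1) (*-monoʳ (<⇒≤ 0<p) r≤m)

-- Finite sums

sumFinℚ-cong : ∀ {m} {f g : Fin m → ℚ} → (∀ i → f i ≡ g i) → sumFinℚ f ≡ sumFinℚ g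
sumFinℚ-cong {zero} eq = refl
sumFinℚ-cong {suc m} eq = cong₂ _+_ (eq Fin.zero) (sumFinℚ-cong (λ i → eq (Fin.suc i)))

sumFinℚ-+ : ∀ {m} (f g : Fin m → ℚ) → sumFinℚ (λ i → f i + g i) ≡ sumFinℚ f + sumFinℚ g
sumFinℚ-+ {zero} f g = refl
sumFinℚ-+ {suc m} f g rewrite sumFinℚ-+ (λ i → f (Fin.suc i)) (λ i → g (Fin.suc i)) =
  eq (f Fin.zero) (g Fin.zero) _ _
  where
  eq : ∀ a b c d → (a + b) + (c + d) ≡ (a + c) + (b + d)
  eq = solve-∀ ring

sumFinℚ-* : ∀ {m} c (f : Fin m → ℚ) → sumFinℚ (λ i → c * f i) ≡ c * sumFinℚ f
sumFinℚ-* {zero} c f = sym (ℚP.*-zeroʳ c)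
sumFinℚ-* {suc m} c f rewrite sumFinℚ-* c (λ i → f (Fin.suc i)) = sym (ℚP.*-distribˡ-+ c _ _)

sumFinℚ-const : ∀ m c → sumFinℚ {m} (λ _ → c) ≡ ℕ→ℚ m * c
sumFinℚ-const zero c = sym (ℚP.*-zeroˡ c)
sumFinℚ-const (suc m) c = trans (cong (_+_ c) (sumFinℚ-const m c))
  (trans (eq c (ℕ→ℚ m)) (cong (_* c) (sym (ℕ→ℚ-suc m))))
  where
  eq : ∀ c m → c + m * c ≡ (m + 1ℚ) * c
  eq = solve-∀ ring

0≤-sumFinℚ : ∀ {m} {f : Fin m → ℚ} → (∀ i → 0ℚ ≤ f i) → 0ℚ ≤ sumFinℚ f
0≤-sumFinℚ {zero} le = ≤-refl
0≤-sumFinℚ {suc m} le = 0≤-+ (le Fin.zero) (0≤-sumFinℚ (λ i → le (Fin.suc i)))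

0≤-^ : ∀ {q} n → 0ℚ ≤ q → 0ℚ ≤ q ^ℚ n
0≤-^ zero 0≤q = 0≤1
0≤-^ (suc n) 0≤q = 0≤-* 0≤q (0≤-^ n 0≤q)

0<-^ : ∀ {q} n → 0ℚ < q → 0ℚ < q ^ℚ n
0<-^ zero 0<q = ℚP.positive⁻¹ 1ℚ
0<-^ (suc n) 0<q = 0<-* 0<q (0<-^ n 0<q)

-- Concentration

-- Homogeneous Bernoulli inequality: B^(n+1) lies above its tangent at A. The error of the induction
-- step is A^n (n+1) (B - A)².
bernoulli : ∀ n A B → 0ℚ ≤ A → 0ℚ ≤ B →
  (A ^ℚ n) * ((ℕ→ℚ n + 1ℚ) * B - ℕ→ℚ n * A) ≤ B ^ℚ suc n
bernoulli zero A B 0≤A 0≤B = ≤-reflexive (eq A B)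
  where
  eq : ∀ A B → 1ℚ * ((0ℚ + 1ℚ) * B - 0ℚ * A) ≡ B * 1ℚ
  eq = solve-∀ ring
bernoulli (suc n) A B 0≤A 0≤B = ≤-trans
  (≤-by (A ^ℚ n * ((ℕ→ℚ n + 1ℚ) * ((B - A) * (B - A))))
    (0≤-* (0≤-^ n 0≤A) (0≤-* (0≤-+ (0≤ℕ→ℚ n) 0≤1) (0≤-square (B - A))))
    (trans (cong (λ z → A * A ^ℚ n * ((z + 1ℚ) * B - z * A) + A ^ℚ n * ((ℕ→ℚ n + 1ℚ) * ((B - A) * (B - A))))
      (ℕ→ℚ-suc n)) (eq (A ^ℚ n) (ℕ→ℚ n) A B)))
  (*-monoʳ 0≤B (bernoulli n A B 0≤A 0≤B))
  where
  eq : ∀ P n A B → A * P * ((n + 1ℚ + 1ℚ) * B - (n + 1ℚ) * A) + P * ((n + 1ℚ) * ((B - A) * (B - A)))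
       ≡ B * (P * ((n + 1ℚ) * B - n * A))
  eq = solve-∀ ring

-- Elements are revealed from the smallest up: the step for the element m + 1 sees its set i and the
-- sets X of the elements m, …, 1.
Process : ℕ → Set
Process k = (m : ℕ) → Fin k → Vec (Fin k) m → ℚ

private variable
  k n : ℕ

total : Process k → Vec (Fin k) n → ℚ
total Y Vec.[] = 0ℚ
total {n = suc n} Y (i Vec.∷ X) = Y n i X + total Y X

product : Process k → Vec (Fin k) n → ℚ
product Y Vec.[] = 1ℚ
product {n = suc n} Y (i Vec.∷ X) = Y n i X * product Y X

0≤-total : ∀ {Y : Process k} (X : Vec (Fin k) n) →
  (∀ m → m ℕ.< n → ∀ i X → 0ℚ ≤ Y m i X) → 0ℚ ≤ total Y X
0≤-total Vec.[] nn = ≤-refl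
0≤-total (i Vec.∷ X) nn = 0≤-+ (nn _ ℕP.≤-refl i X) (0≤-total X (λ m m<n → nn m (ℕP.m<n⇒m<1+n m<n)))

0≤-product : ∀ {Y : Process k} (X : Vec (Fin k) n) →
  (∀ m → m ℕ.< n → ∀ i X → 0ℚ ≤ Y m i X) → 0ℚ ≤ product Y X
0≤-product Vec.[] nn = 0≤1
0≤-product (i Vec.∷ X) nn = 0≤-* (nn _ ℕP.≤-refl i X) (0≤-product X (λ m m<n → nn m (ℕP.m<n⇒m<1+n m<n)))

product-* : ∀ (F G : Process k) (X : Vec (Fin k) n) →
  product F X * product G X ≡ product (λ m i X → F m i X * G m i X) X
product-* F G Vec.[] = refl
product-* F G (i Vec.∷ X) = trans (eq (F _ i X) (product F X) (G _ i X) (product G X))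
  (cong (F _ i X * G _ i X *_) (product-* F G X))
  where
  eq : ∀ a b c d → (a * b) * (c * d) ≡ (a * c) * (b * d)
  eq = solve-∀ ring

1≤-product : ∀ {Y : Process k} (X : Vec (Fin k) n) →
  (∀ m → m ℕ.< n → ∀ i X → 1ℚ ≤ Y m i X) → 1ℚ ≤ product Y X
1≤-product Vec.[] ge = ≤-refl
1≤-product (i Vec.∷ X) ge =
  *-mono 0≤1 (≤-trans 0≤1 tail) (ge _ ℕP.≤-refl i X) tail
  where
  tail = 1≤-product X (λ m m<n → ge m (ℕP.m<n⇒m<1+n m<n))

-- By induction, the tail product is at most a power of the tail mean A. The head is at most what
-- the total leaves over, and `bernoulli` bounds the product of the two.
am-gm : ∀ {G : Process k} (X : Vec (Fin k) n) B → (∀ m → m ℕ.< n → ∀ i X → 0ℚ ≤ G m i X) →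
  0ℚ ≤ B → total G X ≤ ℕ→ℚ n * B → product G X ≤ B ^ℚ n
am-gm Vec.[] B nn 0≤B le = ≤-refl
-- A single factor is treated apart because the mean of an empty tail does not exist.
am-gm {n = suc zero} {G} (i Vec.∷ Vec.[]) B nn 0≤B le =
  *-monoˡ 0≤1 (subst₂ _≤_ (ℚP.+-identityʳ (G 0 i Vec.[])) (ℚP.*-identityˡ B) le)
am-gm {n = suc (suc m)} {G} (i Vec.∷ X) B nn 0≤B le
  with inverse (ℕ→ℚ (suc m)) (ℕ→ℚ-mono-< {0} {suc m} (s≤s z≤n))
... | r , 0<r , rm≡1 = begin
  g * product G X ≤⟨ *-monoʳ (nn _ ℕP.≤-refl i X) (am-gm X A nn' 0≤A (≤-reflexive (sym mA))) ⟩
  g * A ^ℚ suc m ≤⟨ *-monoˡ (0≤-^ (suc m) 0≤A) g≤ ⟩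
  ((ℕ→ℚ (suc m) + 1ℚ) * B - ℕ→ℚ (suc m) * A) * A ^ℚ suc m ≡⟨ ℚP.*-comm _ (A ^ℚ suc m) ⟩
  A ^ℚ suc m * ((ℕ→ℚ (suc m) + 1ℚ) * B - ℕ→ℚ (suc m) * A) ≤⟨ bernoulli (suc m) A B 0≤A 0≤B ⟩
  B ^ℚ suc (suc m) ∎
  where
  open ≤-Reasoning
  g = G (suc m) i X
  A = r * total G X
  nn' : ∀ j → j ℕ.< suc m → ∀ i X → 0ℚ ≤ G j i X
  nn' j j<m = nn j (ℕP.m<n⇒m<1+n j<m)
  0≤A : 0ℚ ≤ A
  0≤A = 0≤-* (<⇒≤ 0<r) (0≤-total X nn')
  mA : ℕ→ℚ (suc m) * A ≡ total G X
  mA = trans (eq (ℕ→ℚ (suc m)) r (total G X)) (trans (cong (_* total G X) rm≡1) (ℚP.*-identityˡ _))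
    where
    eq : ∀ a r t → a * (r * t) ≡ (r * a) * t
    eq = solve-∀ ring
  g≤ : g ≤ (ℕ→ℚ (suc m) + 1ℚ) * B - ℕ→ℚ (suc m) * A
  g≤ = ≤-by _ (0≤-diff le) (trans
    (cong (λ z → g + (z * B - (g + total G X))) (ℕ→ℚ-suc (suc m)))
    (trans (eq g (total G X) ((ℕ→ℚ (suc m) + 1ℚ) * B)) (cong (λ z → (ℕ→ℚ (suc m) + 1ℚ) * B - z) (sym mA))))
    where
    eq : ∀ g t c → g + (c - (g + t)) ≡ c - t
    eq = solve-∀ ring

sumℚ : List ℚ → ℚ
sumℚ = foldr _+_ 0ℚ

sumℚ-++ : ∀ xs ys → sumℚ (xs ++ ys) ≡ sumℚ xs + sumℚ ys
sumℚ-++ [] ys = sym (ℚP.+-identityˡ _)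
sumℚ-++ (x ∷ xs) ys = trans (cong (_+_ x) (sumℚ-++ xs ys)) (sym (ℚP.+-assoc x _ _))

weightOf : (ℕ → Fin k → ℚ) → Vec (Fin k) n → ℚ
weightOf y = product (λ m i _ → y m i)

𝔼 : (ℕ → Fin k → ℚ) → (n : ℕ) → (Vec (Fin k) n → ℚ) → ℚ
𝔼 {k} y n F = sumℚ (map (λ X → F X * weightOf y X) (allOutcomes k n))

sumℚ-tabulate : ∀ {m} (f : Fin m → ℚ) → sumℚ (List.tabulate f) ≡ sumFinℚ f
sumℚ-tabulate {zero} f = refl
sumℚ-tabulate {suc m} f = cong (_+_ (f Fin.zero)) (sumℚ-tabulate (λ i → f (Fin.suc i)))

-- The tower property: the head of the vector is the largest element, so the inner sum is the
-- conditional mean given all smaller elements.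
𝔼-suc : ∀ (y : ℕ → Fin k → ℚ) n F →
  𝔼 y (suc n) F ≡ 𝔼 y n (λ X → sumFinℚ (λ j → y n j * F (j Vec.∷ X)))
𝔼-suc {k} y n F = go (allOutcomes k n)
  where
  w : Vec (Fin k) (suc n) → ℚ
  w X = F X * weightOf y X
  block : ∀ X → sumℚ (map w (map (Vec._∷ X) (List.allFin k))) ≡
                sumFinℚ (λ j → y n j * F (j Vec.∷ X)) * weightOf y X
  block X = begin
    sumℚ (map w (map (Vec._∷ X) (List.allFin k)))
      ≡⟨ cong sumℚ (trans (sym (ListP.map-∘ (List.allFin k))) (ListP.map-tabulate (λ j → j) (λ j → w (j Vec.∷ X)))) ⟩
    sumℚ (List.tabulate (λ j → w (j Vec.∷ X))) ≡⟨ sumℚ-tabulate (λ j → w (j Vec.∷ X)) ⟩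
    sumFinℚ (λ j → F (j Vec.∷ X) * (y n j * weightOf y X))
      ≡⟨ sumFinℚ-cong (λ j → eq (F (j Vec.∷ X)) (y n j) (weightOf y X)) ⟩
    sumFinℚ (λ j → weightOf y X * (y n j * F (j Vec.∷ X))) ≡⟨ sumFinℚ-* (weightOf y X) (λ j → y n j * F (j Vec.∷ X)) ⟩
    weightOf y X * sumFinℚ (λ j → y n j * F (j Vec.∷ X)) ≡⟨ ℚP.*-comm (weightOf y X) _ ⟩
    sumFinℚ (λ j → y n j * F (j Vec.∷ X)) * weightOf y X ∎
    where
    open ≡-Reasoning
    eq : ∀ a b c → a * (b * c) ≡ c * (b * a)
    eq = solve-∀ ring
  go : ∀ Xs → sumℚ (map w (List.concatMap (λ X → map (Vec._∷ X) (List.allFin k)) Xs)) ≡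
              sumℚ (map (λ X → sumFinℚ (λ j → y n j * F (j Vec.∷ X)) * weightOf y X) Xs)
  go [] = refl
  go (X ∷ Xs) = trans (cong sumℚ (ListP.map-++ w (map (Vec._∷ X) (List.allFin k)) _))
    (trans (sumℚ-++ (map w (map (Vec._∷ X) (List.allFin k))) _) (cong₂ _+_ (block X) (go Xs)))

record Distribution (y : ℕ → Fin k → ℚ) : Set where
  field
    nonneg : ∀ m j → 0ℚ ≤ y m j
    unit : ∀ m → sumFinℚ (y m) ≡ 1ℚ

module Expectation {k} {y : ℕ → Fin k → ℚ} (dist : Distribution y) where
  open Distribution dist

  0≤-weight : (X : Vec (Fin k) n) → 0ℚ ≤ weightOf y X
  0≤-weight X = 0≤-product X (λ m _ i _ → nonneg m i)

  𝔼-mono : ∀ n {F G : Vec (Fin k) n → ℚ} → (∀ X → F X ≤ G X) → 𝔼 y n F ≤ 𝔼 y n G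
  𝔼-mono n {F} {G} le = go (allOutcomes k n)
    where
    go : ∀ Xs → sumℚ (map (λ X → F X * weightOf y X) Xs) ≤ sumℚ (map (λ X → G X * weightOf y X) Xs)
    go [] = ≤-refl
    go (X ∷ Xs) = ℚP.+-mono-≤ (*-monoˡ (0≤-weight X) (le X)) (go Xs)

  𝔼-+ : ∀ n (F G : Vec (Fin k) n → ℚ) → 𝔼 y n (λ X → F X + G X) ≡ 𝔼 y n F + 𝔼 y n G
  𝔼-+ n F G = go (allOutcomes k n)
    where
    eq : ∀ f g w a b → (f + g) * w + (a + b) ≡ (f * w + a) + (g * w + b)
    eq = solve-∀ ring
    go : ∀ Xs → sumℚ (map (λ X → (F X + G X) * weightOf y X) Xs) ≡
      sumℚ (map (λ X → F X * weightOf y X) Xs) + sumℚ (map (λ X → G X * weightOf y X) Xs)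
    go [] = refl
    go (X ∷ Xs) rewrite go Xs = eq (F X) (G X) (weightOf y X) _ _

  𝔼-* : ∀ n c (F : Vec (Fin k) n → ℚ) → 𝔼 y n (λ X → c * F X) ≡ c * 𝔼 y n F
  𝔼-* n c F = go (allOutcomes k n)
    where
    eq : ∀ c f w a → c * f * w + c * a ≡ c * (f * w + a)
    eq = solve-∀ ring
    go : ∀ Xs → sumℚ (map (λ X → (c * F X) * weightOf y X) Xs) ≡ c * sumℚ (map (λ X → F X * weightOf y X) Xs)
    go [] = sym (ℚP.*-zeroʳ c)
    go (X ∷ Xs) rewrite go Xs = eq c (F X) (weightOf y X) _

  -- Supermartingale differences bounded by 1.
  record Centered (n : ℕ) (Y : Process k) : Set where
    field
      ≤1 : ∀ m → m ℕ.< n → ∀ i X → Y m i X ≤ 1ℚ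
      ≥-1 : ∀ m → m ℕ.< n → ∀ i X → - 1ℚ ≤ Y m i X
      drift : ∀ m → m ℕ.< n → ∀ X → sumFinℚ (λ j → y m j * Y m j X) ≤ 0ℚ

  module _ {Y : Process k} {h : ℚ} (0≤h : 0ℚ ≤ h) (h≤½ : h ≤ ½) where

    up down : Process k
    up m i X = 1ℚ + h * Y m i X
    down m i X = 1ℚ - h * Y m i X + 2ℚ * (h * h)

    private
      h≤1 : h ≤ 1ℚ
      h≤1 = ≤-trans h≤½ (≤-by ½ 0≤½ refl)

    0≤up : Centered n Y → ∀ m → m ℕ.< n → ∀ i X → 0ℚ ≤ up m i X
    0≤up c m m<n i X = ≤-trans (0≤-diff h≤1) (≤-by (h * (Y m i X - - 1ℚ))
      (0≤-* 0≤h (0≤-diff (Centered.≥-1 c m m<n i X))) (eq h (Y m i X)))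
      where
      eq : ∀ h Y → 1ℚ - h + h * (Y - - 1ℚ) ≡ 1ℚ + h * Y
      eq = solve-∀ ring

    0≤down : Centered n Y → ∀ m → m ℕ.< n → ∀ i X → 0ℚ ≤ down m i X
    0≤down c m m<n i X = ≤-trans (0≤-diff h≤1) (≤-by (h * (1ℚ - Y m i X) + 2ℚ * (h * h))
      (0≤-+ (0≤-* 0≤h (0≤-diff (Centered.≤1 c m m<n i X))) (0≤-* 0≤2 (0≤-square h))) (eq h (Y m i X)))
      where
      eq : ∀ h Y → 1ℚ - h + (h * (1ℚ - Y) + 2ℚ * (h * h)) ≡ 1ℚ - h * Y + 2ℚ * (h * h)
      eq = solve-∀ ring

    -- The product exceeds 1 by h² (2 - Y² + 2hY), and |Y| ≤ 1 together with h ≤ ½ makes the bracket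
    -- nonnegative; this is what the correction 2h² in `down` is for.
    1≤up*down : Centered n Y → ∀ m → m ℕ.< n → ∀ i X → 1ℚ ≤ up m i X * down m i X
    1≤up*down c m m<n i X = ≤-by
      ((h * h) * ((1ℚ - Y m i X) * (Y m i X - - 1ℚ) + (1ℚ - 2ℚ * h) + 2ℚ * h * (Y m i X - - 1ℚ)))
      (0≤-* (0≤-square h) (0≤-+ (0≤-+ (0≤-* 0≤1-Y 0≤Y+1) 0≤1-2h) (0≤-* (0≤-* 0≤2 0≤h) 0≤Y+1)))
      (eq h (Y m i X))
      where
      0≤1-Y = 0≤-diff (Centered.≤1 c m m<n i X)
      0≤Y+1 = 0≤-diff (Centered.≥-1 c m m<n i X)
      0≤1-2h : 0ℚ ≤ 1ℚ - 2ℚ * h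
      0≤1-2h = 0≤-diff (*-monoʳ 0≤2 h≤½)
      eq : ∀ h Y → 1ℚ + (h * h) * ((1ℚ - Y) * (Y - - 1ℚ) + (1ℚ - 2ℚ * h) + 2ℚ * h * (Y - - 1ℚ)) ≡
        (1ℚ + h * Y) * (1ℚ - h * Y + 2ℚ * (h * h))
      eq = solve-∀ ring

    -- Given the smaller elements, the last factor has mean 1 + h · drift ≤ 1, so the product is a
    -- supermartingale.
    𝔼-up≤1 : ∀ n → Centered n Y → 𝔼 y n (product up) ≤ 1ℚ
    𝔼-up≤1 zero c = ≤-refl
    𝔼-up≤1 (suc n) c = begin
      𝔼 y (suc n) (product up) ≡⟨ 𝔼-suc y n (product up) ⟩
      𝔼 y n (λ X → sumFinℚ (λ j → y n j * (up n j X * product up X))) ≤⟨ 𝔼-mono n step ⟩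
      𝔼 y n (product up) ≤⟨ 𝔼-up≤1 n c' ⟩
      1ℚ ∎
      where
      open ≤-Reasoning
      c' : Centered n Y
      c' = record
        { ≤1 = λ m m<n → Centered.≤1 c m (ℕP.m<n⇒m<1+n m<n)
        ; ≥-1 = λ m m<n → Centered.≥-1 c m (ℕP.m<n⇒m<1+n m<n)
        ; drift = λ m m<n → Centered.drift c m (ℕP.m<n⇒m<1+n m<n) }
      step : ∀ X → sumFinℚ (λ j → y n j * (up n j X * product up X)) ≤ product up X
      step X = begin
        sumFinℚ (λ j → y n j * (up n j X * Π)) ≡⟨ sumFinℚ-cong (λ j → eq₁ (y n j) h (Y n j X) Π) ⟩
        sumFinℚ (λ j → Π * (y n j + h * (y n j * Y n j X))) ≡⟨ sumFinℚ-* Π (λ j → y n j + h * (y n j * Y n j X)) ⟩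
        Π * sumFinℚ (λ j → y n j + h * (y n j * Y n j X)) ≡⟨ cong (Π *_) (sumFinℚ-+ (y n) (λ j → h * (y n j * Y n j X))) ⟩
        Π * (sumFinℚ (y n) + sumFinℚ (λ j → h * (y n j * Y n j X)))
          ≡⟨ cong (Π *_) (cong₂ _+_ (unit n) (sumFinℚ-* h (λ j → y n j * Y n j X))) ⟩
        Π * (1ℚ + h * sumFinℚ (λ j → y n j * Y n j X))
          ≤⟨ *-monoʳ (0≤-product X (0≤up c')) (ℚP.+-monoʳ-≤ 1ℚ (*-monoʳ 0≤h (Centered.drift c n ℕP.≤-refl X))) ⟩
        Π * (1ℚ + h * 0ℚ) ≡⟨ eq₂ Π h ⟩
        Π ∎
        where
        Π = product up X
        eq₁ : ∀ y h Y P → y * ((1ℚ + h * Y) * P) ≡ P * (y + h * (y * Y))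
        eq₁ = solve-∀ ring
        eq₂ : ∀ P h → P * (1ℚ + h * 0ℚ) ≡ P
        eq₂ = solve-∀ ring

    total-down : ∀ (X : Vec (Fin k) n) → total down X ≡ ℕ→ℚ n * (1ℚ + 2ℚ * (h * h)) - h * total Y X
    total-down Vec.[] = eq h
      where
      eq : ∀ h → 0ℚ ≡ 0ℚ * (1ℚ + 2ℚ * (h * h)) - h * 0ℚ
      eq = solve-∀ ring
    total-down {suc n} (i Vec.∷ X) rewrite total-down X | ℕ→ℚ-suc n = eq h (Y n i X) (ℕ→ℚ n) (total Y X)
      where
      eq : ∀ h Y n t → (1ℚ - h * Y + 2ℚ * (h * h)) + (n * (1ℚ + 2ℚ * (h * h)) - h * t) ≡
        (n + 1ℚ) * (1ℚ + 2ℚ * (h * h)) - h * (Y + t)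
      eq = solve-∀ ring

    -- up * down ≥ 1 replaces exp (hY) * exp (- hY) = 1. Since the total is at least 4h per step, the
    -- factors of down average at most 1 - 2h², and AM-GM bounds their product.
    1≤-up : Centered n Y → (X : Vec (Fin k) n) → 4ℚ * h * ℕ→ℚ n ≤ total Y X →
      1ℚ ≤ (1ℚ - 2ℚ * (h * h)) ^ℚ n * product up X
    1≤-up {n} c X large = begin
      1ℚ ≤⟨ 1≤-product X (1≤up*down c) ⟩
      product (λ m i X → up m i X * down m i X) X ≡⟨ sym (product-* up down X) ⟩
      product up X * product down X
        ≤⟨ *-monoʳ (0≤-product X (0≤up c)) (am-gm X (1ℚ - 2ℚ * (h * h)) (0≤down c) 0≤ρ avg) ⟩
      product up X * (1ℚ - 2ℚ * (h * h)) ^ℚ n ≡⟨ ℚP.*-comm (product up X) _ ⟩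
      (1ℚ - 2ℚ * (h * h)) ^ℚ n * product up X ∎
      where
      open ≤-Reasoning
      0≤ρ : 0ℚ ≤ 1ℚ - 2ℚ * (h * h)
      0≤ρ = ≤-trans (0≤-diff (*-monoʳ 0≤2 h≤½)) (≤-by (2ℚ * (h * (1ℚ - h)))
        (0≤-* 0≤2 (0≤-* 0≤h (0≤-diff h≤1))) (eq h))
        where
        eq : ∀ h → 1ℚ - 2ℚ * h + 2ℚ * (h * (1ℚ - h)) ≡ 1ℚ - 2ℚ * (h * h)
        eq = solve-∀ ring
      avg : total down X ≤ ℕ→ℚ n * (1ℚ - 2ℚ * (h * h))
      avg = ≤-by (h * (total Y X - 4ℚ * h * ℕ→ℚ n)) (0≤-* 0≤h (0≤-diff large))
        (trans (cong (_+ h * (total Y X - 4ℚ * h * ℕ→ℚ n)) (total-down X)) (eq h (ℕ→ℚ n) (total Y X)))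
        where
        eq : ∀ h n t → n * (1ℚ + 2ℚ * (h * h)) - h * t + h * (t - 4ℚ * h * n) ≡ n * (1ℚ - 2ℚ * (h * h))
        eq = solve-∀ ring

  ind : Bool → ℚ
  ind b = if b then 1ℚ else 0ℚ

  atMost : ℚ → ℚ → Bool
  atMost p q with p ℚP.≤? q
  ... | yes _ = true
  ... | no _ = false

  exceeds : ℚ → (n : ℕ) → List (Process k) → Vec (Fin k) n → Bool
  exceeds h n [] X = false
  exceeds h n (Y ∷ Ys) X = atMost (4ℚ * h * ℕ→ℚ n) (total Y X) ∨ exceeds h n Ys X

  exceeds-false : ∀ {h} Ys (X : Vec (Fin k) n) → exceeds h n Ys X ≡ false →
    All (λ Y → total Y X < 4ℚ * h * ℕ→ℚ n) Ys
  exceeds-false [] X eq = []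
  exceeds-false {n} {h} (Y ∷ Ys) X eq with 4ℚ * h * ℕ→ℚ n ℚP.≤? total Y X
  ... | no ≰ = ℚP.≰⇒> ≰ ∷ exceeds-false Ys X eq

  -- Markov's inequality for `product up`: by `1≤-up` the indicator of a large total is at most ρⁿ
  -- times this product, whose mean is at most 1.
  union-bound : ∀ {h} → 0ℚ ≤ h → h ≤ ½ → ∀ n Ys → All (Centered n) Ys →
    𝔼 y n (λ X → ind (exceeds h n Ys X)) ≤ ℕ→ℚ (length Ys) * (1ℚ - 2ℚ * (h * h)) ^ℚ n
  union-bound {h} 0≤h h≤½ n [] [] = ≤-reflexive (trans (𝔼-* n 0ℚ (λ _ → 0ℚ))
    (trans (ℚP.*-zeroˡ (𝔼 y n (λ _ → 0ℚ))) (sym (ℚP.*-zeroˡ ((1ℚ - 2ℚ * (h * h)) ^ℚ n)))))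
  union-bound {h} 0≤h h≤½ n (Y ∷ Ys) (c ∷ cs) = begin
    𝔼 y n (λ X → ind (atMost τ (total Y X) ∨ exceeds h n Ys X)) ≤⟨ 𝔼-mono n pointwise ⟩
    𝔼 y n (λ X → ρⁿ * Π X + ind (exceeds h n Ys X)) ≡⟨ 𝔼-+ n (λ X → ρⁿ * Π X) (λ X → ind (exceeds h n Ys X)) ⟩
    𝔼 y n (λ X → ρⁿ * Π X) + 𝔼 y n (λ X → ind (exceeds h n Ys X))
      ≤⟨ ℚP.+-mono-≤ (≤-trans (≤-reflexive (𝔼-* n ρⁿ Π)) (*-monoʳ 0≤ρⁿ (𝔼-up≤1 {Y} 0≤h h≤½ n c)))
           (union-bound 0≤h h≤½ n Ys cs) ⟩
    ρⁿ * 1ℚ + ℕ→ℚ (length Ys) * ρⁿ ≡⟨ eq ρⁿ (ℕ→ℚ (length Ys)) ⟩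
    (ℕ→ℚ (length Ys) + 1ℚ) * ρⁿ ≡⟨ cong (_* ρⁿ) (sym (ℕ→ℚ-suc (length Ys))) ⟩
    ℕ→ℚ (suc (length Ys)) * ρⁿ ∎
    where
    open ≤-Reasoning
    ρⁿ = (1ℚ - 2ℚ * (h * h)) ^ℚ n
    τ = 4ℚ * h * ℕ→ℚ n
    Π : Vec (Fin k) n → ℚ
    Π = product (up {Y} 0≤h h≤½)
    0≤ρⁿ : 0ℚ ≤ ρⁿ
    0≤ρⁿ = 0≤-^ n (≤-trans (0≤-diff (*-mono 0≤h 0≤½ h≤½ h≤½)) (≤-by (½ * ½ * 2ℚ + (½ * ½ - h * h))
      (0≤-+ (ℚP.nonNegative⁻¹ (½ * ½ * 2ℚ)) (0≤-diff (*-mono 0≤h 0≤½ h≤½ h≤½))) (eq' h)))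
      where
      eq' : ∀ h → (½ * ½ - h * h) + (½ * ½ * 2ℚ + (½ * ½ - h * h)) ≡ 1ℚ - 2ℚ * (h * h)
      eq' = solve-∀ ring
    eq : ∀ r l → r * 1ℚ + l * r ≡ (l + 1ℚ) * r
    eq = solve-∀ ring
    0≤ind : ∀ b → 0ℚ ≤ ind b
    0≤ind true = 0≤1
    0≤ind false = ≤-refl
    pointwise : ∀ X → ind (atMost τ (total Y X) ∨ exceeds h n Ys X) ≤
      ρⁿ * Π X + ind (exceeds h n Ys X)
    pointwise X with τ ℚP.≤? total Y X
    ... | yes large = ≤-by _ (0≤-+ (0≤-diff (1≤-up {Y} 0≤h h≤½ c X large)) (0≤ind (exceeds h n Ys X))) (shift (ρⁿ * Π X) (ind (exceeds h n Ys X)))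
      where
      shift : ∀ a b → 1ℚ + (a - 1ℚ + b) ≡ a + b
      shift = solve-∀ ring
    ... | no _ = ≤-by _ (0≤-* 0≤ρⁿ (0≤-product X (0≤up {Y} 0≤h h≤½ c))) (ℚP.+-comm (ind (exceeds h n Ys X)) (ρⁿ * Π X))

-- The fractional procedure

-- Abstract, because otherwise case distinctions on u ≟ 0ℚ also abstract the ones inside _÷'_.
abstract
  run : ℕ → List (ℚ × ℚ) → List (ℚ × ℚ) → List (List ℚ)
  run = frac

  run-def : ∀ f ss ts → run f ss ts ≡ frac f ss ts
  run-def f ss ts = refl

  pourFraction : (a u b₁ v₁ b₂ v₂ : ℚ) → ℚ
  pourFraction a u b₁ v₁ b₂ v₂ =
    (1ℚ ℚ.⊓ (v₁ ÷' u)) ℚ.⊓ ((b₁ * v₂ - v₁ * b₂) ÷' (a * v₂ - u * b₂))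

  pourFraction-def : ∀ a u b₁ v₁ b₂ v₂ → pourFraction a u b₁ v₁ b₂ v₂ ≡
    (1ℚ ℚ.⊓ (v₁ ÷' u)) ℚ.⊓ ((b₁ * v₂ - v₁ * b₂) ÷' (a * v₂ - u * b₂))
  pourFraction-def a u b₁ v₁ b₂ v₂ = refl

frac-pour : ∀ f {a u} ss {b₁ v₁ b₂ v₂} ts → u ≢ 0ℚ → v₁ ≢ 0ℚ → b₁ * v₂ ≢ b₂ * v₁ →
  let lam = pourFraction a u b₁ v₁ b₂ v₂ in
  frac (suc f) ((a , u) ∷ ss) ((b₁ , v₁) ∷ (b₂ , v₂) ∷ ts) ≡
  pourRow lam (frac f ((a - lam * a , u - lam * u) ∷ ss)
                      ((b₁ - lam * a , v₁ - lam * u) ∷ (b₂ , v₂) ∷ ts))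
frac-pour f {a} {u} ss {b₁} {v₁} {b₂} {v₂} ts u≢0 v₁≢0 neq with u ℚP.≟ 0ℚ
... | yes u≡0 = contradiction u≡0 u≢0
... | no _ with v₁ ℚP.≟ 0ℚ
...   | yes v₁≡0 = contradiction v₁≡0 v₁≢0
...   | no _ with b₁ * v₂ ℚP.≟ b₂ * v₁
...     | yes eq = contradiction eq neq
...     | no _ = cong (λ l → pourRow l (frac f ((a - l * a , u - l * u) ∷ ss)
                   ((b₁ - l * a , v₁ - l * u) ∷ (b₂ , v₂) ∷ ts))) (sym (pourFraction-def a u b₁ v₁ b₂ v₂))

abstract
  run-single : ∀ f ss t → run (suc f) ss (t ∷ []) ≡ map (λ _ → 1ℚ ∷ []) ss
  run-single f ss t = refl

  run-drop : ∀ f {a u} ss b₁ v₁ b₂ v₂ ts → u ≡ 0ℚ →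
    run (suc f) ((a , u) ∷ ss) ((b₁ , v₁) ∷ (b₂ , v₂) ∷ ts) ≡
    (1ℚ ∷ List.replicate (suc (length ts)) 0ℚ) ∷ run f ss ((b₁ , v₁) ∷ (b₂ , v₂) ∷ ts)
  run-drop f {u = u} ss b₁ v₁ b₂ v₂ ts u≡0 with u ℚP.≟ 0ℚ
  ... | yes _ = refl
  ... | no u≢0 = contradiction u≡0 u≢0

  run-merge : ∀ f {a u} ss {b₁ v₁ b₂ v₂} ts → u ≢ 0ℚ → v₁ ≢ 0ℚ → b₁ * v₂ ≡ b₂ * v₁ →
    run (suc f) ((a , u) ∷ ss) ((b₁ , v₁) ∷ (b₂ , v₂) ∷ ts) ≡
    map (splitCol (v₁ ÷' (v₁ + v₂))) (run f ((a , u) ∷ ss) ((b₁ + b₂ , v₁ + v₂) ∷ ts))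
  run-merge f {u = u} ss {b₁} {v₁} {b₂} {v₂} ts u≢0 v₁≢0 eq with u ℚP.≟ 0ℚ
  ... | yes u≡0 = contradiction u≡0 u≢0
  ... | no _ with v₁ ℚP.≟ 0ℚ
  ...   | yes v₁≡0 = contradiction v₁≡0 v₁≢0
  ...   | no _ with b₁ * v₂ ℚP.≟ b₂ * v₁
  ...     | yes _ = refl
  ...     | no ≢ = contradiction eq ≢

  run-pour : ∀ f {a u} ss {b₁ v₁ b₂ v₂} ts → u ≢ 0ℚ → v₁ ≢ 0ℚ → b₁ * v₂ ≢ b₂ * v₁ →
    let lam = pourFraction a u b₁ v₁ b₂ v₂ in
    run (suc f) ((a , u) ∷ ss) ((b₁ , v₁) ∷ (b₂ , v₂) ∷ ts) ≡
    pourRow lam (run f ((a - lam * a , u - lam * u) ∷ ss)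
                        ((b₁ - lam * a , v₁ - lam * u) ∷ (b₂ , v₂) ∷ ts))
  run-pour = frac-pour

entry-split₀ : ∀ γ R i → entry (map (splitCol γ) R) i 0 ≡ γ * entry R i 0
entry-split₀ γ [] i = sym (ℚP.*-zeroʳ γ)
entry-split₀ γ (r ∷ R) (suc i) = entry-split₀ γ R i
entry-split₀ γ ([] ∷ R) zero = sym (ℚP.*-zeroʳ γ)
entry-split₀ γ ((h ∷ r) ∷ R) zero = refl

entry-split₁ : ∀ γ R i → entry (map (splitCol γ) R) i 1 ≡ (1ℚ - γ) * entry R i 0
entry-split₁ γ [] i = sym (ℚP.*-zeroʳ (1ℚ - γ))
entry-split₁ γ (r ∷ R) (suc i) = entry-split₁ γ R i
entry-split₁ γ ([] ∷ R) zero = sym (ℚP.*-zeroʳ (1ℚ - γ))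
entry-split₁ γ ((h ∷ r) ∷ R) zero = refl

entry-row-irrelevant : ∀ r R R' j → entry (r ∷ R) 0 j ≡ entry (r ∷ R') 0 j
entry-row-irrelevant [] R R' j = refl
entry-row-irrelevant (h ∷ r) R R' zero = refl
entry-row-irrelevant (h ∷ r) R R' (suc j) = entry-row-irrelevant r R R' j

entry-split₂ : ∀ γ R i j → entry (map (splitCol γ) R) i (suc (suc j)) ≡ entry R i (suc j)
entry-split₂ γ [] i j = refl
entry-split₂ γ (r ∷ R) (suc i) j = entry-split₂ γ R i j
entry-split₂ γ ([] ∷ R) zero j = refl
entry-split₂ γ ((h ∷ r) ∷ R) zero j = entry-row-irrelevant r _ R j

entry-map : ∀ c r R R' j → entry (map (λ y → c * y) r ∷ R) 0 j ≡ c * entry (r ∷ R') 0 j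
entry-map c [] R R' j = sym (ℚP.*-zeroʳ c)
entry-map c (h ∷ r) R R' zero = refl
entry-map c (h ∷ r) R R' (suc j) = entry-map c r R R' j

Inhabited : List (List ℚ) → Set
Inhabited R = ∃ λ h → ∃ λ r → ∃ λ rs → R ≡ (h ∷ r) ∷ rs

entry-pour₀ : ∀ l {R} → Inhabited R → entry (pourRow l R) 0 0 ≡ l + (1ℚ - l) * entry R 0 0
entry-pour₀ l (h , r , rs , refl) = refl

entry-pour₁ : ∀ l {R} → Inhabited R → ∀ j → entry (pourRow l R) 0 (suc j) ≡ (1ℚ - l) * entry R 0 (suc j)
entry-pour₁ l (h , r , rs , refl) j = entry-map (1ℚ - l) r rs rs j

entry-pour-rest : ∀ l {R} → Inhabited R → ∀ i j → entry (pourRow l R) (suc i) j ≡ entry R (suc i) j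
entry-pour-rest l (h , r , rs , refl) i j = refl

entry-zeros : ∀ c R j → entry (List.replicate c 0ℚ ∷ R) 0 j ≡ 0ℚ
entry-zeros zero R j = refl
entry-zeros (suc c) R zero = refl
entry-zeros (suc c) R (suc j) = entry-zeros c R j

-- The first source has its own coefficient since it alone may be partly poured. The coefficients
-- are volumes or amounts, so a column sum is what a target receives.
column : ∀ {e} → ℚ → (Fin e → ℚ) → List (List ℚ) → ℕ → ℚ
column c₀ c R j = c₀ * entry R 0 j + sumFinℚ (λ i → c i * entry R (suc (toℕ i)) j)

column-scale : ∀ {e} c₀ (c : Fin e → ℚ) R R' j j' γ → (∀ i → entry R' i j' ≡ γ * entry R i j) →
  column c₀ c R' j' ≡ γ * column c₀ c R j
column-scale c₀ c R R' j j' γ eq = begin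
  c₀ * entry R' 0 j' + sumFinℚ (λ i → c i * entry R' (suc (toℕ i)) j')
    ≡⟨ cong₂ _+_ (trans (cong (c₀ *_) (eq 0)) (commute c₀ γ (entry R 0 j)))
         (sumFinℚ-cong (λ i → trans (cong (c i *_) (eq (suc (toℕ i)))) (commute (c i) γ (entry R (suc (toℕ i)) j)))) ⟩
  γ * (c₀ * entry R 0 j) + sumFinℚ (λ i → γ * (c i * entry R (suc (toℕ i)) j))
    ≡⟨ cong (_+_ (γ * (c₀ * entry R 0 j))) (sumFinℚ-* γ (λ i → c i * entry R (suc (toℕ i)) j)) ⟩
  γ * (c₀ * entry R 0 j) + γ * sumFinℚ (λ i → c i * entry R (suc (toℕ i)) j)
    ≡⟨ sym (ℚP.*-distribˡ-+ γ _ _) ⟩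
  γ * column c₀ c R j ∎
  where
  open ≡-Reasoning
  commute : ∀ a g x → a * (g * x) ≡ g * (a * x)
  commute = solve-∀ ring

-- The recursive rows describe a first source that has already been reduced to c₀ - l c₀; the poured
-- part l c₀ goes to the first target.
column-pour₀ : ∀ {e} c₀ (c : Fin e → ℚ) l {R} → Inhabited R →
  column c₀ c (pourRow l R) 0 ≡ l * c₀ + column (c₀ - l * c₀) c R 0
column-pour₀ c₀ c l {R} inh = begin
  c₀ * entry (pourRow l R) 0 0 + sumFinℚ (λ i → c i * entry (pourRow l R) (suc (toℕ i)) 0)
    ≡⟨ cong₂ (λ x y → c₀ * x + y) (entry-pour₀ l inh)
         (sumFinℚ-cong (λ i → cong (c i *_) (entry-pour-rest l inh (toℕ i) 0))) ⟩
  c₀ * (l + (1ℚ - l) * entry R 0 0) + rest ≡⟨ eq c₀ l (entry R 0 0) rest ⟩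
  l * c₀ + ((c₀ - l * c₀) * entry R 0 0 + rest) ∎
  where
  open ≡-Reasoning
  rest = sumFinℚ (λ i → c i * entry R (suc (toℕ i)) 0)
  eq : ∀ c l x r → c * (l + (1ℚ - l) * x) + r ≡ l * c + ((c - l * c) * x + r)
  eq = solve-∀ ring

column-pour₁ : ∀ {e} c₀ (c : Fin e → ℚ) l {R} → Inhabited R → ∀ j →
  column c₀ c (pourRow l R) (suc j) ≡ column (c₀ - l * c₀) c R (suc j)
column-pour₁ c₀ c l {R} inh j = cong₂ _+_
  (trans (cong (c₀ *_) (entry-pour₁ l inh j)) (eq c₀ l (entry R 0 (suc j))))
  (sumFinℚ-cong (λ i → cong (c i *_) (entry-pour-rest l inh (toℕ i) (suc j))))
  where
  eq : ∀ c l x → c * ((1ℚ - l) * x) ≡ (c - l * c) * x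
  eq = solve-∀ ring

column-drop : ∀ {e} (c : Fin (suc e) → ℚ) r R j →
  column 0ℚ c (r ∷ R) j ≡ column (c Fin.zero) (λ i → c (Fin.suc i)) R j
column-drop c r R j = trans (cong (_+ column (c Fin.zero) (λ i → c (Fin.suc i)) R j) (ℚP.*-zeroˡ (entry (r ∷ R) 0 j))) (ℚP.+-identityˡ _)

ones : ∀ e → Fin e → ℚ
ones e _ = 1ℚ

triangle : ℕ → ℚ
triangle e = ½ * (ℕ→ℚ e * (ℕ→ℚ e + 1ℚ))

triangle-suc : ∀ e → triangle (suc e) ≡ ℕ→ℚ (suc e) + triangle e
triangle-suc e rewrite ℕ→ℚ-suc e = eq (ℕ→ℚ e)
  where
  eq : ∀ e → ½ * ((e + 1ℚ) * (e + 1ℚ + 1ℚ)) ≡ (e + 1ℚ) + ½ * (e * (e + 1ℚ))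
  eq = solve-∀ ring

descending : ∀ e → Fin e → ℚ
descending e i = ℕ→ℚ (e ℕ.∸ toℕ i)

sum-descending : ∀ e → sumFinℚ (descending e) ≡ triangle e
sum-descending zero = refl
sum-descending (suc e) = trans (cong (_+_ (ℕ→ℚ (suc e))) (sum-descending e)) (sym (triangle-suc e))

unitSources : ℕ → List (ℚ × ℚ)
unitSources e = List.applyUpTo (λ p → (ℕ→ℚ (e ℕ.∸ p) , 1ℚ)) e

entry-ones : ∀ {A : Set} (xs : List A) i → i ℕ.< length xs → entry (map (λ _ → 1ℚ ∷ []) xs) i 0 ≡ 1ℚ
entry-ones (x ∷ xs) zero lt = refl
entry-ones (x ∷ xs) (suc i) (s≤s lt) = entry-ones xs i lt

entry-ones-nonneg : ∀ {A : Set} (xs : List A) i j → 0ℚ ≤ entry (map (λ _ → 1ℚ ∷ []) xs) i j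
entry-ones-nonneg [] i j = ≤-refl
entry-ones-nonneg (x ∷ xs) zero zero = 0≤1
entry-ones-nonneg (x ∷ xs) zero (suc j) = ≤-refl
entry-ones-nonneg (x ∷ xs) (suc i) j = entry-ones-nonneg xs i j

-- A state of the procedure is determined by e, u, b, v, w: the first remaining source has volume u
-- and density e + 1, the others are the full sources e, …, 1; the first target is (b , v), possibly
-- merged, the others are the original (s , w j). The constant M is the slack in terms of amounts:
-- what the last targets need beyond the sum of as many smallest elements. Elements of size at most
-- C are poured only after all targets are merged.
module Fractional (s M C κ : ℚ) (n : ℕ) (0<s : 0ℚ < s) (0<M : 0ℚ < M) (0≤C : 0ℚ ≤ C) (C*n≡M : C * ℕ→ℚ n ≡ M)
  (0≤κ : 0ℚ ≤ κ) (κ≤1 : κ ≤ 1ℚ) (κn≤C : κ * ℕ→ℚ n ≤ C) where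

  targets : ∀ {m} → (Fin m → ℚ) → List (ℚ × ℚ)
  targets w = List.tabulate (λ j → (s , w j))

  -- The slack condition for every suffix of the targets, inductive because a merge removes the
  -- head. The total volume W is a natural number for the sake of the integrality argument in
  -- `density-gap`; the bound κ n ≤ w₀ keeps the proportions of later splits away from 0.
  data Spacious : ∀ {m} → (Fin m → ℚ) → Set where
    none : ∀ {w : Fin 0 → ℚ} → Spacious w
    some : ∀ {m} {w : Fin (suc m) → ℚ} W → 0ℚ < w Fin.zero → κ * ℕ→ℚ n ≤ w Fin.zero →
      (∀ j → w Fin.zero ≤ w j) → sumFinℚ w ≡ ℕ→ℚ W → triangle W + M ≤ ℕ→ℚ (suc m) * s →
      Spacious (λ j → w (Fin.suc j)) → Spacious w

  -- The density order s / w j ≤ b / v, cross-multiplied.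
  Sorted : ∀ {m} → ℚ → ℚ → (Fin m → ℚ) → Set
  Sorted b v w = ∀ j → s * v ≤ b * w j

  record Balance {m} (e : ℕ) (u b v : ℚ) (w : Fin m → ℚ) : Set where
    constructor balance
    field
      volume : v + sumFinℚ w ≡ u + ℕ→ℚ e
      amount : b + ℕ→ℚ m * s ≡ u * ℕ→ℚ (suc e) + triangle e

  -- Row i belongs to the element suc e ∸ i. In `spread` the exponent m is the number of merges to
  -- come, each costing at most one factor κ.
  record Solution {m} (e : ℕ) (u b v : ℚ) (w : Fin m → ℚ) (R : List (List ℚ)) : Set where
    field
      inhabited : Inhabited R
      nonneg : ∀ i j → 0ℚ ≤ entry R i j
      unit : ∀ i → i ≤ℕ e → sumFinℚ {suc m} (λ j → entry R i (toℕ j)) ≡ 1ℚ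
      volume₀ : column u (ones e) R 0 ≡ v
      volume₁ : ∀ j → column u (ones e) R (suc (toℕ j)) ≡ w j
      amount₀ : column (u * ℕ→ℚ (suc e)) (descending e) R 0 ≡ b
      amount₁ : ∀ (j : Fin m) → column (u * ℕ→ℚ (suc e)) (descending e) R (suc (toℕ j)) ≡ s
      spread : ∀ i → i ≤ℕ e → ℕ→ℚ (suc e ℕ.∸ i) ≤ C → ∀ (j : Fin (suc m)) → κ ^ℚ m ≤ entry R i (toℕ j)

  solution-single : ∀ e a u b v (w : Fin 0 → ℚ) → Balance e u b v w →
    Solution e u b v w (map (λ _ → 1ℚ ∷ []) ((a , u) ∷ unitSources e))
  solution-single e a u b v w (balance vol amt) = record
    { inhabited = 1ℚ , [] , _ , refl
    ; nonneg = entry-ones-nonneg ((a , u) ∷ unitSources e)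
    ; unit = λ i i≤e → trans (ℚP.+-identityʳ (entry R i 0)) (one i i≤e)
    ; volume₀ = trans (col u (ones e)) (trans (cong (_+_ u) (trans (sumFinℚ-const e 1ℚ) (ℚP.*-identityʳ (ℕ→ℚ e))))
        (trans (sym vol) (ℚP.+-identityʳ v)))
    ; volume₁ = λ ()
    ; amount₀ = trans (col (u * ℕ→ℚ (suc e)) (descending e)) (trans (cong (_+_ (u * ℕ→ℚ (suc e))) (sum-descending e))
        (trans (sym amt) (trans (cong (_+_ b) (ℚP.*-zeroˡ s)) (ℚP.+-identityʳ b))))
    ; amount₁ = λ ()
    ; spread = λ { i i≤e _ Fin.zero → ≤-reflexive (sym (one i i≤e)) } }
    where
    R = map (λ _ → 1ℚ ∷ []) ((a , u) ∷ unitSources e)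
    one : ∀ i → i ≤ℕ e → entry R i 0 ≡ 1ℚ
    one i i≤e = entry-ones ((a , u) ∷ unitSources e) i
      (s≤s (ℕP.≤-trans i≤e (ℕP.≤-reflexive (sym (ListP.length-applyUpTo (λ p → (ℕ→ℚ (e ℕ.∸ p) , 1ℚ)) e)))))
    col : ∀ c₀ (c : Fin e → ℚ) → column c₀ c R 0 ≡ c₀ + sumFinℚ c
    col c₀ c = cong₂ _+_ (ℚP.*-identityʳ c₀)
      (sumFinℚ-cong (λ i → trans (cong (c i *_) (one (suc (toℕ i)) (FinP.toℕ<n i))) (ℚP.*-identityʳ (c i))))

  -- As the densities agree, dividing the merged volume in the ratio v : w₀ also divides the merged
  -- amount into b and s. Both proportions are at least κ.
  solution-split : ∀ {m} e u b v (w : Fin (suc m) → ℚ) R → let w₀ = w Fin.zero; V = v + w₀ in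
    0ℚ < V → b * w₀ ≡ s * v → 0ℚ ≤ v → 0ℚ ≤ w₀ → κ * V ≤ v → κ * V ≤ w₀ →
    Solution e u (b + s) V (λ j → w (Fin.suc j)) R →
    Solution e u b v w (map (splitCol (v ÷' V)) R)
  solution-split {m} e u b v w R 0<V eqd 0≤v 0≤w₀ κ≤v κ≤w₀ sol = record
    { inhabited = inh S.inhabited
    ; nonneg = nn
    ; unit = λ i i≤e → trans (cong₂ _+_ (entry-split₀ γ R i) (cong₂ _+_ (entry-split₁ γ R i)
        (sumFinℚ-cong {m} (λ j → entry-split₂ γ R i (toℕ j))))) (trans (merge γ (entry R i 0) _) (S.unit i i≤e))
    ; volume₀ = trans (scale₀ u (ones e)) (trans (cong (γ *_) S.volume₀) γV≡v)
    ; volume₁ = λ { Fin.zero → trans (scale₁ u (ones e)) (trans (cong ((1ℚ - γ) *_) S.volume₀) γ'V≡w₀)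
                  ; (Fin.suc j) → trans (keep u (ones e) j) (S.volume₁ j) }
    ; amount₀ = trans (scale₀ D (descending e)) (trans (cong (γ *_) S.amount₀) γb≡b)
    ; amount₁ = λ { Fin.zero → trans (scale₁ D (descending e)) (trans (cong ((1ℚ - γ) *_) S.amount₀) γ'b≡s)
                  ; (Fin.suc j) → trans (keep D (descending e) j) (S.amount₁ j) }
    ; spread = sp }
    where
    module S = Solution sol
    w₀ = w Fin.zero
    V = v + w₀
    γ = v ÷' V
    D = u * ℕ→ℚ (suc e)
    γV≡v : γ * V ≡ v
    γV≡v = ÷'-* v V (λ V≡0 → ℚP.<-irrefl (sym V≡0) 0<V)
    merge : ∀ g x r → g * x + ((1ℚ - g) * x + r) ≡ x + r
    merge = solve-∀ ring
    compl : ∀ g V → (1ℚ - g) * V ≡ V - g * V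
    compl = solve-∀ ring
    cancel : ∀ v w → v + w - v ≡ w
    cancel = solve-∀ ring
    γ'V≡w₀ : (1ℚ - γ) * V ≡ w₀
    γ'V≡w₀ = trans (compl γ V) (trans (cong (_-_ V) γV≡v) (cancel v w₀))
    γb≡b : γ * (b + s) ≡ b
    γb≡b = ℚP.≤-antisym (*-cancelʳ 0<V (≤-reflexive eq)) (*-cancelʳ 0<V (≤-reflexive (sym eq)))
      where
      reorder : ∀ g c V → g * c * V ≡ g * V * c
      reorder = solve-∀ ring
      expand : ∀ v b s → v * (b + s) ≡ b * v + s * v
      expand = solve-∀ ring
      eq : γ * (b + s) * V ≡ b * V
      eq = trans (reorder γ (b + s) V) (trans (cong (_* (b + s)) γV≡v)
        (trans (expand v b s) (trans (cong (_+_ (b * v)) (sym eqd)) (sym (ℚP.*-distribˡ-+ b v w₀)))))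
    γ'b≡s : (1ℚ - γ) * (b + s) ≡ s
    γ'b≡s = trans (compl γ (b + s)) (trans (cong (_-_ (b + s)) γb≡b) (cancel b s))
    0≤γ : 0ℚ ≤ γ
    0≤γ = 0≤-cancelʳ 0<V (subst (0ℚ ≤_) (sym γV≡v) 0≤v)
    0≤γ' : 0ℚ ≤ 1ℚ - γ
    0≤γ' = 0≤-cancelʳ 0<V (subst (0ℚ ≤_) (sym γ'V≡w₀) 0≤w₀)
    κ≤γ : κ ≤ γ
    κ≤γ = *-cancelʳ 0<V (≤-trans κ≤v (≤-reflexive (sym γV≡v)))
    κ≤γ' : κ ≤ 1ℚ - γ
    κ≤γ' = *-cancelʳ 0<V (≤-trans κ≤w₀ (≤-reflexive (sym γ'V≡w₀)))
    inh : ∀ {R} → Inhabited R → Inhabited (map (splitCol γ) R)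
    inh (h , r , rs , refl) = _ , _ , _ , refl
    nn : ∀ i j → 0ℚ ≤ entry (map (splitCol γ) R) i j
    nn i zero = ≤-trans (0≤-* 0≤γ (S.nonneg i 0)) (≤-reflexive (sym (entry-split₀ γ R i)))
    nn i (suc zero) = ≤-trans (0≤-* 0≤γ' (S.nonneg i 0)) (≤-reflexive (sym (entry-split₁ γ R i)))
    nn i (suc (suc j)) = ≤-trans (S.nonneg i (suc j)) (≤-reflexive (sym (entry-split₂ γ R i j)))
    scale₀ : ∀ c₀ (c : Fin e → ℚ) → column c₀ c (map (splitCol γ) R) 0 ≡ γ * column c₀ c R 0
    scale₀ c₀ c = column-scale c₀ c R (map (splitCol γ) R) 0 0 γ (entry-split₀ γ R)
    scale₁ : ∀ c₀ (c : Fin e → ℚ) → column c₀ c (map (splitCol γ) R) 1 ≡ (1ℚ - γ) * column c₀ c R 0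
    scale₁ c₀ c = column-scale c₀ c R (map (splitCol γ) R) 0 1 (1ℚ - γ) (entry-split₁ γ R)
    keep : ∀ c₀ (c : Fin e → ℚ) (j : Fin m) →
      column c₀ c (map (splitCol γ) R) (suc (suc (toℕ j))) ≡ column c₀ c R (suc (toℕ j))
    keep c₀ c j = trans (column-scale c₀ c R (map (splitCol γ) R) (suc (toℕ j)) (suc (suc (toℕ j))) 1ℚ
      (λ i → trans (entry-split₂ γ R i (toℕ j)) (sym (ℚP.*-identityˡ (entry R i (suc (toℕ j)))))))
      (ℚP.*-identityˡ (column c₀ c R (suc (toℕ j))))
    sp : ∀ i → i ≤ℕ e → ℕ→ℚ (suc e ℕ.∸ i) ≤ C → ∀ (j : Fin (suc (suc m))) →
      κ ^ℚ suc m ≤ entry (map (splitCol γ) R) i (toℕ j)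
    sp i i≤e small Fin.zero = ≤-trans (*-mono 0≤κ (S.nonneg i 0) κ≤γ (S.spread i i≤e small Fin.zero))
      (≤-reflexive (sym (entry-split₀ γ R i)))
    sp i i≤e small (Fin.suc Fin.zero) = ≤-trans (*-mono 0≤κ (S.nonneg i 0) κ≤γ' (S.spread i i≤e small Fin.zero))
      (≤-reflexive (sym (entry-split₁ γ R i)))
    sp i i≤e small (Fin.suc (Fin.suc j)) = ≤-trans
      (≤-trans (*-mono 0≤κ (S.nonneg i (suc (toℕ j))) κ≤1 (S.spread i i≤e small (Fin.suc j)))
        (≤-reflexive (ℚP.*-identityˡ (entry R i (suc (toℕ j))))))
      (≤-reflexive (sym (entry-split₂ γ R i (toℕ j))))

  -- Pouring shrinks the other entries of the first row, possibly to 0. This is harmless for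
  -- `spread`, because the element of this row exceeds C.
  solution-pour : ∀ {m} e u b v (w : Fin m → ℚ) l R → 0ℚ ≤ l → l ≤ 1ℚ → C < ℕ→ℚ (suc e) →
    Solution e (u - l * u) (b - l * (u * ℕ→ℚ (suc e))) (v - l * u) w R →
    Solution e u b v w (pourRow l R)
  solution-pour {m} e u b v w l R 0≤l l≤1 C<D sol = record
    { inhabited = inh S.inhabited
    ; nonneg = nn
    ; unit = un
    ; volume₀ = trans (column-pour₀ u (ones e) l S.inhabited)
        (trans (cong (_+_ (l * u)) S.volume₀) (restore (l * u) v))
    ; volume₁ = λ j → trans (column-pour₁ u (ones e) l S.inhabited (toℕ j)) (S.volume₁ j)
    ; amount₀ = trans (column-pour₀ (u * D) (descending e) l S.inhabited)
        (trans (cong (_+_ (l * (u * D))) (trans (cong (λ c → column c (descending e) R 0) (factor u l D)) S.amount₀))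
          (restore (l * (u * D)) b))
    ; amount₁ = λ j → trans (column-pour₁ (u * D) (descending e) l S.inhabited (toℕ j))
        (trans (cong (λ c → column c (descending e) R (suc (toℕ j))) (factor u l D)) (S.amount₁ j))
    ; spread = sp }
    where
    module S = Solution sol
    D = ℕ→ℚ (suc e)
    restore : ∀ l v → l + (v - l) ≡ v
    restore = solve-∀ ring
    factor : ∀ u l D → u * D - l * (u * D) ≡ (u - l * u) * D
    factor = solve-∀ ring
    inh : ∀ {R} → Inhabited R → Inhabited (pourRow l R)
    inh (h , r , rs , refl) = _ , _ , _ , refl
    nn : ∀ i j → 0ℚ ≤ entry (pourRow l R) i j
    nn zero zero = ≤-trans (0≤-+ 0≤l (0≤-* (0≤-diff l≤1) (S.nonneg 0 0))) (≤-reflexive (sym (entry-pour₀ l S.inhabited)))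
    nn zero (suc j) = ≤-trans (0≤-* (0≤-diff l≤1) (S.nonneg 0 (suc j))) (≤-reflexive (sym (entry-pour₁ l S.inhabited j)))
    nn (suc i) j = ≤-trans (S.nonneg (suc i) j) (≤-reflexive (sym (entry-pour-rest l S.inhabited i j)))
    un : ∀ i → i ≤ℕ e → sumFinℚ {suc m} (λ j → entry (pourRow l R) i (toℕ j)) ≡ 1ℚ
    un zero i≤e = begin
      entry (pourRow l R) 0 0 + sumFinℚ {m} (λ j → entry (pourRow l R) 0 (suc (toℕ j)))
        ≡⟨ cong₂ _+_ (entry-pour₀ l S.inhabited)
             (trans (sumFinℚ-cong {m} (λ j → entry-pour₁ l S.inhabited (toℕ j))) (sumFinℚ-* {m} (1ℚ - l) (λ j → entry R 0 (suc (toℕ j))))) ⟩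
      l + (1ℚ - l) * entry R 0 0 + (1ℚ - l) * rest ≡⟨ eq l (entry R 0 0) rest ⟩
      l + (1ℚ - l) * (entry R 0 0 + rest) ≡⟨ cong (λ z → l + (1ℚ - l) * z) (S.unit 0 i≤e) ⟩
      l + (1ℚ - l) * 1ℚ ≡⟨ one l ⟩
      1ℚ ∎
      where
      open ≡-Reasoning
      rest = sumFinℚ {m} (λ j → entry R 0 (suc (toℕ j)))
      eq : ∀ l x r → l + (1ℚ - l) * x + (1ℚ - l) * r ≡ l + (1ℚ - l) * (x + r)
      eq = solve-∀ ring
      one : ∀ l → l + (1ℚ - l) * 1ℚ ≡ 1ℚ
      one = solve-∀ ring
    un (suc i) i≤e = trans (sumFinℚ-cong {suc m} (λ j → entry-pour-rest l S.inhabited i (toℕ j))) (S.unit (suc i) i≤e)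
    sp : ∀ i → i ≤ℕ e → ℕ→ℚ (suc e ℕ.∸ i) ≤ C → ∀ (j : Fin (suc m)) → κ ^ℚ m ≤ entry (pourRow l R) i (toℕ j)
    sp zero i≤e small j = contradiction (ℚP.<-≤-trans C<D small) (ℚP.<-irrefl refl)
    sp (suc i) i≤e small j = ≤-trans (S.spread (suc i) i≤e small j) (≤-reflexive (sym (entry-pour-rest l S.inhabited i (toℕ j))))

  solution-drop : ∀ {m} e b v (w : Fin m → ℚ) R c → C < ℕ→ℚ (suc (suc e)) →
    Solution e 1ℚ b v w R → Solution (suc e) 0ℚ b v w ((1ℚ ∷ List.replicate c 0ℚ) ∷ R)
  solution-drop {m} e b v w R c C<D sol = record
    { inhabited = _ , _ , _ , refl
    ; nonneg = λ { zero zero → 0≤1 ; zero (suc j) → ≤-reflexive (sym (entry-zeros c R j)) ; (suc i) j → S.nonneg i j }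
    ; unit = λ { zero _ → trans (cong (_+_ 1ℚ) (trans (sumFinℚ-cong {m} (λ j → entry-zeros c R (toℕ j)))
                   (trans (sumFinℚ-const m 0ℚ) (ℚP.*-zeroʳ (ℕ→ℚ m))))) (ℚP.+-identityʳ 1ℚ)
               ; (suc i) (s≤s i≤e) → S.unit i i≤e }
    ; volume₀ = trans (column-drop (ones (suc e)) row R 0) S.volume₀
    ; volume₁ = λ j → trans (column-drop (ones (suc e)) row R (suc (toℕ j))) (S.volume₁ j)
    ; amount₀ = trans (amt 0) S.amount₀
    ; amount₁ = λ j → trans (amt (suc (toℕ j))) (S.amount₁ j)
    ; spread = λ { zero _ small j → contradiction (ℚP.<-≤-trans C<D small) (ℚP.<-irrefl refl)
                 ; (suc i) (s≤s i≤e) small j → S.spread i i≤e small j } }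
    where
    module S = Solution sol
    row = 1ℚ ∷ List.replicate c 0ℚ
    amt : ∀ j → column (0ℚ * ℕ→ℚ (suc (suc e))) (descending (suc e)) (row ∷ R) j ≡
                column (1ℚ * ℕ→ℚ (suc e)) (descending e) R j
    amt j = trans (cong (λ z → column z (descending (suc e)) (row ∷ R) j) (ℚP.*-zeroˡ (ℕ→ℚ (suc (suc e)))))
      (trans (column-drop (descending (suc e)) row R j)
        (cong (λ z → column z (descending e) R j) (sym (ℚP.*-identityˡ (ℕ→ℚ (suc e))))))

  -- A product of two consecutive integers.
  0≤-consecutive : ∀ W e → 0ℚ ≤ (ℕ→ℚ W - ℕ→ℚ e) * (ℕ→ℚ W - ℕ→ℚ e - 1ℚ)
  0≤-consecutive W e with ℕP.<-≤-connex e W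
  ... | inj₁ e<W = 0≤-* (0≤-diff (ℕ→ℚ-mono (ℕP.<⇒≤ e<W)))
        (subst (0ℚ ≤_) (trans (cong (_-_ (ℕ→ℚ W)) (ℕ→ℚ-suc e)) (eq (ℕ→ℚ W) (ℕ→ℚ e))) (0≤-diff (ℕ→ℚ-mono e<W)))
    where
    eq : ∀ W e → W - (e + 1ℚ) ≡ W - e - 1ℚ
    eq = solve-∀ ring
  ... | inj₂ W≤e = subst (0ℚ ≤_) (eq (ℕ→ℚ W) (ℕ→ℚ e))
        (0≤-* (0≤-diff (ℕ→ℚ-mono W≤e)) (0≤-+ (0≤-diff (ℕ→ℚ-mono W≤e)) 0≤1))
    where
    eq : ∀ W e → (e - W) * (e - W + 1ℚ) ≡ (W - e) * (W - e - 1ℚ)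
    eq = solve-∀ ring

  -- Solving `Balance` for v and b cancels u and leaves (m+1) s - W(W+1)/2 + (W-e)(W-e-1)/2, whose
  -- first two terms give M. So filling the first target entirely at density e + 1 would overshoot
  -- its amount by at least M.
  density-gap : ∀ {m} e u b v (w : Fin (suc m) → ℚ) → Balance e u b v w → Spacious w →
    M ≤ v * ℕ→ℚ (suc e) - b
  density-gap {m} e u b v w (balance vol amt) (some W _ _ _ ΣW room _) = ≤-by
    (rest - (triangle W + M) + ½ * ((ℕ→ℚ W - E) * (ℕ→ℚ W - E - 1ℚ)))
    (0≤-+ (0≤-diff room) (0≤-* 0≤½ (0≤-consecutive W e)))
    (trans (identity M rest (ℕ→ℚ W) E u)
      (cong₂ (λ x y → x - y) (cong₂ _*_ (sym v≡) (sym (ℕ→ℚ-suc e))) (sym b≡)))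
    where
    E = ℕ→ℚ e
    rest = ℕ→ℚ (suc m) * s
    isolate : ∀ {x y z} → x + y ≡ z → x ≡ z - y
    isolate {x} {y} refl = eq x y
      where
      eq : ∀ x y → x ≡ x + y - y
      eq = solve-∀ ring
    v≡ : v ≡ u + E - ℕ→ℚ W
    v≡ = isolate (trans (cong (_+_ v) (sym ΣW)) vol)
    b≡ : b ≡ u * (E + 1ℚ) + ½ * (E * (E + 1ℚ)) - rest
    b≡ = isolate (trans amt (cong (λ d → u * d + triangle e) (ℕ→ℚ-suc e)))
    identity : ∀ M r W E u → M + (r - (½ * (W * (W + 1ℚ)) + M) + ½ * ((W - E) * (W - E - 1ℚ))) ≡
      (u + E - W) * (E + 1ℚ) - (u * (E + 1ℚ) + ½ * (E * (E + 1ℚ)) - r)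
    identity = solve-∀ ring

  0<suc : ∀ e → 0ℚ < ℕ→ℚ (suc e)
  0<suc e = ℕ→ℚ-mono-< {0} {suc e} (s≤s z≤n)

  0<-volume : ∀ e b v → 0ℚ ≤ b → M ≤ v * ℕ→ℚ (suc e) - b → 0ℚ < v
  0<-volume e b v 0≤b gap = 0<-cancelʳ (0≤ℕ→ℚ (suc e))
    (ℚP.<-≤-trans 0<M (≤-trans gap (≤-by b 0≤b (eq (v * ℕ→ℚ (suc e)) b))))
    where
    eq : ∀ p b → p - b + b ≡ p
    eq = solve-∀ ring

  -- The gap gives v (e + 1) ≥ M = C n, and e + 1 ≤ n.
  C≤volume : ∀ e b v → 0ℚ ≤ b → suc e ≤ℕ n → M ≤ v * ℕ→ℚ (suc e) - b → C ≤ v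
  C≤volume e b v 0≤b e<n gap = *-cancelʳ (0<suc e)
    (≤-trans (*-monoʳ 0≤C (ℕ→ℚ-mono e<n))
      (≤-trans (≤-reflexive C*n≡M) (≤-trans gap (≤-by b 0≤b (eq (v * ℕ→ℚ (suc e)) b)))))
    where
    eq : ∀ p b → p - b + b ≡ p
    eq = solve-∀ ring

  0≤-spacious : ∀ {m} {w : Fin m → ℚ} → Spacious w → 0ℚ ≤ sumFinℚ w
  0≤-spacious none = ≤-refl
  0≤-spacious (some W _ _ _ ΣW _ _) = subst (0ℚ ≤_) (sym ΣW) (0≤ℕ→ℚ W)

  record PourFacts (e : ℕ) (u b v w₀ l : ℚ) : Set where
    field
      0<l : 0ℚ < l
      l≤1 : l ≤ 1ℚ
      0<v' : 0ℚ < v - l * u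
      sorted : s * (v - l * u) ≤ (b - l * (u * ℕ→ℚ (suc e))) * w₀
      stop : l ≡ 1ℚ ⊎ (b - l * (u * ℕ→ℚ (suc e))) * w₀ ≡ s * (v - l * u)

  -- Pouring stops at l = 1 or when the densities of the first two targets agree, never because the
  -- first target is full: the latter would need l = v / u, which exceeds the third bound.
  pour-facts : ∀ e u b v w₀ → 0ℚ < u → 0ℚ < v → 0ℚ < w₀ → M ≤ v * ℕ→ℚ (suc e) - b →
    s * v < b * w₀ → PourFacts e u b v w₀ (pourFraction (u * ℕ→ℚ (suc e)) u b v s w₀)
  pour-facts e u b v w₀ 0<u 0<v 0<w₀ gap denser =
    subst (PourFacts e u b v w₀) (sym (pourFraction-def (u * D) u b v s w₀)) facts
    where
    D = ℕ→ℚ (suc e)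
    num = b * w₀ - v * s
    den = u * D * w₀ - u * s
    r = v ÷' u
    t = num ÷' den
    l = (1ℚ ℚ.⊓ r) ℚ.⊓ t
    0<num : 0ℚ < num
    0<num = subst (0ℚ <_) (cong (_-_ (b * w₀)) (ℚP.*-comm s v)) (0<-diff denser)
    0<gap : 0ℚ < (v * D - b) * w₀
    0<gap = 0<-* (ℚP.<-≤-trans 0<M gap) 0<w₀
    0<den : 0ℚ < den
    -- The sign of `den` is visible only after multiplication by v, which turns it into u times the
    -- sum of two positive terms.
    0<den = 0<-cancelʳ (<⇒≤ 0<v) (subst (0ℚ <_) (eq v D b w₀ s u) (0<-* 0<u (ℚP.+-mono-< 0<gap 0<num)))
      where
      eq : ∀ v D b w s u → u * ((v * D - b) * w + (b * w - v * s)) ≡ (u * D * w - u * s) * v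
      eq = solve-∀ ring
    ru≡v : r * u ≡ v
    ru≡v = ÷'-* v u (λ u≡0 → ℚP.<-irrefl (sym u≡0) 0<u)
    t*den : t * den ≡ num
    t*den = ÷'-* num den (λ d≡0 → ℚP.<-irrefl (sym d≡0) 0<den)
    t<r : t < r
    t<r = ℚP.*-cancelʳ-<-nonNeg den {{ℚ.nonNegative (<⇒≤ 0<den)}}
      (<-by ((v * D - b) * w₀) 0<gap (trans (cong (_+ (v * D - b) * w₀) t*den)
        (trans (eq₁ v D b w₀ s) (trans (cong (λ z → z * (D * w₀ - s)) (sym ru≡v)) (eq₂ r u D w₀ s)))))
      where
      eq₁ : ∀ v D b w s → b * w - v * s + (v * D - b) * w ≡ v * (D * w - s)
      eq₁ = solve-∀ ring
      eq₂ : ∀ r u D w s → r * u * (D * w - s) ≡ r * (u * D * w - u * s)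
      eq₂ = solve-∀ ring
    0<t : 0ℚ < t
    0<t = 0<-cancelʳ (<⇒≤ 0<den) (subst (0ℚ <_) (sym t*den) 0<num)
    l≤t : l ≤ t
    l≤t = ℚP.p⊓q≤q (1ℚ ℚ.⊓ r) t
    stops : l ≡ 1ℚ ⊎ l ≡ t
    stops with ℚP.⊓-sel (1ℚ ℚ.⊓ r) t
    ... | inj₂ eq = inj₂ eq
    ... | inj₁ eq with ℚP.⊓-sel 1ℚ r
    ...   | inj₁ eq' = inj₁ (trans eq eq')
    ...   | inj₂ eq' = contradiction (ℚP.≤-<-trans (subst (_≤ t) (trans eq eq') l≤t) t<r) (ℚP.<-irrefl refl)
    expand : ∀ b w s v l u D → (b - l * (u * D)) * w - s * (v - l * u) ≡ b * w - v * s - l * (u * D * w - u * s)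
    expand = solve-∀ ring
    facts : PourFacts e u b v w₀ l
    facts = record
      { 0<l = positive stops
      ; l≤1 = ≤-trans (ℚP.p⊓q≤p (1ℚ ℚ.⊓ r) t) (ℚP.p⊓q≤p 1ℚ r)
      ; 0<v' = 0<-diff (subst (l * u <_) ru≡v (ℚP.*-monoˡ-<-pos u {{ℚ.positive 0<u}} (ℚP.≤-<-trans l≤t t<r)))
      ; sorted = ≤-by ((b - l * (u * D)) * w₀ - s * (v - l * u))
          (subst (0ℚ ≤_) (sym (expand b w₀ s v l u D)) (0≤-diff (≤-trans (*-monoˡ (<⇒≤ 0<den) l≤t) (≤-reflexive t*den))))
          (restore (s * (v - l * u)) ((b - l * (u * D)) * w₀))
      ; stop = equal stops }
      where
      restore : ∀ x y → x + (y - x) ≡ y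
      restore = solve-∀ ring
      positive : l ≡ 1ℚ ⊎ l ≡ t → 0ℚ < l
      positive (inj₁ eq) = subst (0ℚ <_) (sym eq) (ℚP.positive⁻¹ 1ℚ)
      positive (inj₂ eq) = subst (0ℚ <_) (sym eq) 0<t
      equal : l ≡ 1ℚ ⊎ l ≡ t → l ≡ 1ℚ ⊎ (b - l * (u * D)) * w₀ ≡ s * (v - l * u)
      equal (inj₁ eq) = inj₁ eq
      equal (inj₂ eq) = inj₂ (difference-zero _ _ (trans (expand b w₀ s v l u D)
        (trans (cong (_-_ num) (trans (cong (_* den) eq) t*den)) (ℚP.+-inverseʳ num))))
        where
        difference-zero : ∀ x y → x - y ≡ 0ℚ → x ≡ y
        difference-zero x y d = trans (sym (shift x y)) (trans (cong (_+ y) d) (ℚP.+-identityˡ y))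
          where
          shift : ∀ x y → x - y + y ≡ x
          shift = solve-∀ ring

  merge-balance : ∀ {m} e u b v (w : Fin (suc m) → ℚ) → Balance e u b v w →
    Balance e u (b + s) (v + w Fin.zero) (λ j → w (Fin.suc j))
  merge-balance {m} e u b v w (balance vol amt) = balance (trans (ℚP.+-assoc v (w Fin.zero) _) vol)
    (trans (eq b s (ℕ→ℚ m)) (trans (cong (λ z → b + z * s) (sym (ℕ→ℚ-suc m))) amt))
    where
    eq : ∀ b s m → b + s + m * s ≡ b + (m + 1ℚ) * s
    eq = solve-∀ ring

  -- The head has the smallest volume among equal amounts, so both merged targets are at least as
  -- dense as every later one, and so is their mediant.
  merge-sorted : ∀ {m} b v (w : Fin (suc m) → ℚ) → Spacious w → Sorted b v w →
    Sorted (b + s) (v + w Fin.zero) (λ j → w (Fin.suc j))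
  merge-sorted b v w (some _ _ _ low _ _ _) sorted j =
    subst₂ _≤_ (sym (ℚP.*-distribˡ-+ s v (w Fin.zero))) (sym (ℚP.*-distribʳ-+ (w (Fin.suc j)) b s))
      (ℚP.+-mono-≤ (sorted (Fin.suc j)) (*-monoʳ (<⇒≤ 0<s) (low (Fin.suc j))))

  -- The merged volume is at most n, while v ≥ C ≥ κ n and w₀ ≥ κ n; hence both proportions are at
  -- least κ.
  merge-step : ∀ {m} e u b v (w : Fin (suc m) → ℚ) R → u ≤ 1ℚ → suc e ≤ℕ n → 0ℚ ≤ b →
    Balance e u b v w → Spacious w → b * w Fin.zero ≡ s * v →
    Solution e u (b + s) (v + w Fin.zero) (λ j → w (Fin.suc j)) R →
    Solution e u b v w (map (splitCol (v ÷' (v + w Fin.zero))) R)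
  merge-step e u b v w R u≤1 e<n 0≤b bal sp@(some W 0<w₀ κn≤w₀ _ _ _ sp') eqd =
    solution-split e u b v w R (ℚP.+-mono-< 0<v 0<w₀) eqd (<⇒≤ 0<v) (<⇒≤ 0<w₀)
      (≤-trans κV≤κn (≤-trans κn≤C (C≤volume e b v 0≤b e<n gap))) (≤-trans κV≤κn κn≤w₀)
    where
    gap = density-gap e u b v w bal sp
    0<v = 0<-volume e b v 0≤b gap
    w₀ = w Fin.zero
    Σ' = sumFinℚ (λ j → w (Fin.suc j))
    V≤n : v + w₀ ≤ ℕ→ℚ n
    V≤n = ≤-trans (≤-by (Σ' + (1ℚ - u)) (0≤-+ (0≤-spacious sp') (0≤-diff u≤1))
      (trans (eq₁ v w₀ Σ' u) (trans (cong (λ z → z + (1ℚ - u)) (Balance.volume bal))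
        (trans (eq₂ u (ℕ→ℚ e)) (sym (ℕ→ℚ-suc e)))))) (ℕ→ℚ-mono e<n)
      where
      eq₁ : ∀ v w S u → v + w + (S + (1ℚ - u)) ≡ v + (w + S) + (1ℚ - u)
      eq₁ = solve-∀ ring
      eq₂ : ∀ u e → u + e + (1ℚ - u) ≡ e + 1ℚ
      eq₂ = solve-∀ ring
    κV≤κn : κ * (v + w₀) ≤ κ * ℕ→ℚ n
    κV≤κn = *-monoʳ 0≤κ V≤n

  -- A pour is treated together with the drop or merge that follows it, so 0 < u holds at every
  -- entry and two units of fuel pay for a decrease of e + m.
  run-solution : ∀ f {m} e u b v (w : Fin m → ℚ) a → a ≡ u * ℕ→ℚ (suc e) → 0ℚ < u → u ≤ 1ℚ →
    suc e ≤ℕ n → 0ℚ ≤ b → Sorted b v w → Balance e u b v w → Spacious w → 2 ℕ.* (e ℕ.+ m) ℕ.< f →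
    Solution e u b v w (run f ((a , u) ∷ unitSources e) ((b , v) ∷ targets w))
  run-solution (suc f) {zero} e u b v w a _ 0<u u≤1 e<n 0≤b sorted bal sp fuel =
    subst (Solution e u b v w) (sym (run-single f ((a , u) ∷ unitSources e) (b , v))) (solution-single e a u b v w bal)
  run-solution (suc zero) {suc m} e u b v w a _ 0<u u≤1 e<n 0≤b sorted bal sp fuel =
    contradiction (ℕP.≤-trans (ℕP.≤-trans (s≤s z≤n) (ℕP.m≤n+m (suc m) e)) (ℕP.m≤n*m (e ℕ.+ suc m) 2))
      (ℕP.<⇒≱ fuel)
  run-solution (suc (suc f)) {suc m} e u b v w a refl 0<u u≤1 e<n 0≤b sorted bal sp@(some W 0<w₀ _ low ΣW _ sp') fuel =
    step (b * w Fin.zero ℚP.≟ s * v)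
    where
    D = ℕ→ℚ (suc e)
    w₀ = w Fin.zero
    w' = λ j → w (Fin.suc j)
    gap = density-gap e u b v w bal sp
    0<v = 0<-volume e b v 0≤b gap
    u≢0 : u ≢ 0ℚ
    u≢0 u≡0 = ℚP.<-irrefl (sym u≡0) 0<u
    v≢0 : v ≢ 0ℚ
    v≢0 v≡0 = ℚP.<-irrefl (sym v≡0) 0<v
    l = pourFraction a u b v s w₀
    fuel-merge : 2 ℕ.* (e ℕ.+ m) ℕ.< f
    fuel-merge = ℕP.+-cancelˡ-< 2 _ _ (subst (ℕ._< suc (suc f)) (trans (cong (2 ℕ.*_) (ℕP.+-suc e m)) (ℕP.*-suc 2 (e ℕ.+ m))) fuel)
    module Pour (facts : PourFacts e u b v w₀ l) where
      open PourFacts facts renaming (sorted to sorted₀)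
      u' = u - l * u
      b' = b - l * (u * D)
      v' = v - l * u
      bal' : Balance e u' b' v' w
      bal' = balance (trans (eq₁ v (l * u) (sumFinℚ w)) (trans (cong (λ z → z - l * u) (Balance.volume bal)) (eq₂ u (l * u) (ℕ→ℚ e))))
        (trans (eq₁ b (l * (u * D)) (ℕ→ℚ (suc m) * s)) (trans (cong (λ z → z - l * (u * D)) (Balance.amount bal)) (eq₃ u l D (triangle e))))
        where
        eq₁ : ∀ v p S → v - p + S ≡ v + S - p
        eq₁ = solve-∀ ring
        eq₂ : ∀ u p e → u + e - p ≡ u - p + e
        eq₂ = solve-∀ ring
        eq₃ : ∀ u l D T → u * D + T - l * (u * D) ≡ (u - l * u) * D + T
        eq₃ = solve-∀ ring
      0≤b' : 0ℚ ≤ b'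
      0≤b' = 0≤-cancelʳ 0<w₀ (≤-trans (0≤-* (<⇒≤ 0<s) (<⇒≤ 0<v')) sorted₀)
      sorted' : Sorted b' v' w
      sorted' j = ≤-trans sorted₀ (*-monoʳ 0≤b' (low j))
      C<D : C < D
      -- The gap persists after the pour, so v' ≥ C, while v' + Σ w = u' + e < e + 1 because
      -- something was poured. Hence the poured element exceeds C.
      C<D = ℚP.≤-<-trans (C≤volume e b' v' 0≤b' e<n (density-gap e u' b' v' w bal' sp))
        (<-by (sumFinℚ w + (1ℚ - u + l * u)) (ℚP.+-mono-≤-< (0≤-spacious sp)
            (ℚP.+-mono-≤-< (0≤-diff u≤1) (0<-* 0<l 0<u)))
          (trans (eq₁ v' (sumFinℚ w) u (l * u)) (trans (cong (λ z → z + (1ℚ - u + l * u)) (Balance.volume bal'))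
            (trans (eq₂ u (l * u) (ℕ→ℚ e)) (sym (ℕ→ℚ-suc e))))))
        where
        eq₁ : ∀ v S u p → v + (S + (1ℚ - u + p)) ≡ v + S + (1ℚ - u + p)
        eq₁ = solve-∀ ring
        eq₂ : ∀ u p e → u - p + e + (1ℚ - u + p) ≡ e + 1ℚ
        eq₂ = solve-∀ ring
      dropped : ∀ e → suc e ≤ℕ n → u' ≡ 0ℚ → Balance e u' b' v' w → C < ℕ→ℚ (suc e) → 2 ℕ.* (e ℕ.+ suc m) ℕ.< suc (suc f) →
        Solution e u' b' v' w (run (suc f) ((a - l * a , u') ∷ unitSources e) ((b' , v') ∷ targets w))
      -- With the last source exhausted no volume remains, contrary to v' > 0.
      dropped zero e<n u'≡0 (balance vol _) C<D fuel = contradiction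
        (ℚP.<-≤-trans (ℚP.+-mono-<-≤ 0<v' (0≤-spacious sp)) (≤-reflexive (trans vol (trans (ℚP.+-identityʳ u') u'≡0))))
        (ℚP.<-irrefl refl)
      dropped (suc e) e<n u'≡0 (balance vol amt) C<D fuel =
        subst₂ (λ z R → Solution (suc e) z b' v' w R) (sym u'≡0)
          (sym (run-drop f (unitSources (suc e)) b' v' s w₀ (targets w') u'≡0))
          (solution-drop e b' v' w _ (suc (length (targets w'))) C<D
            (run-solution f e 1ℚ b' v' w (ℕ→ℚ (suc e)) (sym (ℚP.*-identityˡ (ℕ→ℚ (suc e)))) (ℚP.positive⁻¹ 1ℚ) ≤-refl
              (ℕP.≤-trans (ℕP.n≤1+n (suc e)) e<n) 0≤b' sorted' next sp
              (ℕP.+-cancelˡ-< 2 _ _ (subst (ℕ._< suc (suc f)) (ℕP.*-suc 2 (e ℕ.+ suc m)) fuel))))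
        where
        next : Balance e 1ℚ b' v' w
        next = balance
          (trans vol (trans (cong₂ _+_ u'≡0 (ℕ→ℚ-suc e)) (eq₁ (ℕ→ℚ e))))
          (trans amt (trans (cong₂ (λ x y → x * ℕ→ℚ (suc (suc e)) + y) u'≡0 (triangle-suc e))
            (eq₂ (ℕ→ℚ (suc (suc e))) (ℕ→ℚ (suc e)) (triangle e))))
          where
          eq₁ : ∀ e → 0ℚ + (e + 1ℚ) ≡ 1ℚ + e
          eq₁ = solve-∀ ring
          eq₂ : ∀ x D T → 0ℚ * x + (D + T) ≡ 1ℚ * D + T
          eq₂ = solve-∀ ring
      continue : l ≡ 1ℚ ⊎ b' * w₀ ≡ s * v' →
        Solution e u' b' v' w (run (suc f) ((a - l * a , u') ∷ unitSources e) ((b' , v') ∷ targets w))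
      continue (inj₁ l≡1) = dropped e e<n (trans (cong (λ z → u - z * u) l≡1) (eq u)) bal' C<D fuel
        where
        eq : ∀ u → u - 1ℚ * u ≡ 0ℚ
        eq = solve-∀ ring
      -- Densities may become equal exactly when the source runs out; the procedure tests for an
      -- empty source first.
      continue (inj₂ eqd) = split (u' ℚP.≟ 0ℚ)
        where
        split : Dec (u' ≡ 0ℚ) → Solution e u' b' v' w (run (suc f) ((a - l * a , u') ∷ unitSources e) ((b' , v') ∷ targets w))
        split (yes u'≡0) = dropped e e<n u'≡0 bal' C<D fuel
        split (no u'≢0) = subst (Solution e u' b' v' w)
            (sym (run-merge f (unitSources e) (targets w') u'≢0 (λ v'≡0 → ℚP.<-irrefl (sym v'≡0) 0<v') eqd))
            (merge-step e u' b' v' w _ u'≤1 e<n 0≤b' bal' sp eqd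
              (run-solution f e u' (b' + s) (v' + w₀) w' (a - l * a) (factor u l D) 0<u' u'≤1 e<n (0≤-+ 0≤b' (<⇒≤ 0<s))
                (merge-sorted b' v' w sp sorted') (merge-balance e u' b' v' w bal') sp' fuel-merge))
          where
          factor : ∀ u l D → u * D - l * (u * D) ≡ (u - l * u) * D
          factor = solve-∀ ring
          u'≤1 : u' ≤ 1ℚ
          u'≤1 = ≤-trans (≤-by (l * u) (0≤-* (<⇒≤ 0<l) (<⇒≤ 0<u)) (eq u (l * u))) u≤1
            where
            eq : ∀ u p → u - p + p ≡ u
            eq = solve-∀ ring
          0<u' : 0ℚ < u'
          0<u' = ≤∧≢⇒< (subst (0ℚ ≤_) (eq u l) (0≤-* (<⇒≤ 0<u) (0≤-diff l≤1))) (λ eq → u'≢0 (sym eq))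
            where
            eq : ∀ u l → u * (1ℚ - l) ≡ u - l * u
            eq = solve-∀ ring
    step : Dec (b * w₀ ≡ s * v) → Solution e u b v w (run (suc (suc f)) ((a , u) ∷ unitSources e) ((b , v) ∷ targets w))
    step (yes eqd) = subst (Solution e u b v w)
      (sym (run-merge (suc f) (unitSources e) (targets w') u≢0 v≢0 eqd))
      (merge-step e u b v w _ u≤1 e<n 0≤b bal sp eqd
        (run-solution (suc f) e u (b + s) (v + w₀) w' a refl 0<u u≤1 e<n (0≤-+ 0≤b (<⇒≤ 0<s))
          (merge-sorted b v w sp sorted) (merge-balance e u b v w bal) sp'
          (ℕP.≤-trans fuel-merge (ℕP.n≤1+n f))))
    step (no neq) = subst (Solution e u b v w)
      (sym (run-pour (suc f) (unitSources e) (targets w') u≢0 v≢0 neq))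
      (solution-pour e u b v w l _ (<⇒≤ 0<l) l≤1 C<D (continue stop))
      where
      facts = pour-facts e u b v w₀ 0<u 0<v 0<w₀ gap (≤∧≢⇒< (sorted Fin.zero) (λ eq → neq (sym eq)))
      open PourFacts facts using (0<l; l≤1; stop)
      open Pour facts

-- The instances of a linear partition family

/-*-cancel : ∀ j d .{{_ : NonZero d}} → (+ j ℚ./ d) * ℕ→ℚ d ≡ ℕ→ℚ j
/-*-cancel j (suc d) = ℚP.toℚᵘ-injective
  (ℚᵘP.≃-trans (ℚP.toℚᵘ-homo-* (+ j ℚ./ suc d) (ℕ→ℚ (suc d)))
    (ℚᵘP.≃-trans (ℚᵘP.*-cong (ℚP.toℚᵘ-fromℚᵘ (ℚᵘ.mkℚᵘ (+ j) d)) (toℚᵘ-ℕ→ℚ (suc d)))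
      (ℚᵘP.≃-sym (ℚᵘP.≃-trans (toℚᵘ-ℕ→ℚ j) (ℚᵘ.*≡* (trans
        (cong (λ z → (+ j) ℤ.* + suc z) (ℕP.*-identityʳ d)) (sym (ℤP.*-identityʳ (+ j ℤ.* + suc d)))))))))

-- Passing to `whole`, whose denominator is literally 1, lets the floor reduce to a division by 1.
floor-ℕ→ℚ : ∀ m → ℤ.∣ ℚ.floor (ℕ→ℚ m) ∣ ≡ m
floor-ℕ→ℚ m = trans (cong (λ p → ℤ.∣ ℚ.floor p ∣) (ℚP.↥p/↧p≡p whole))
  (trans (cong ℤ.∣_∣ (ℤDivMod.div-pos-is-/ℕ (+ m) 1)) (DivMod.n/1≡n m))
  where
  whole : ℚ
  whole = ℚ.mkℚ (+ m) 0 (Coprimality.sym (Coprimality.1-coprimeTo m))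

prefixSum-zero : ∀ {m} (β : Fin m → ℚ) → prefixSum β 0 ≡ 0ℚ
prefixSum-zero {m} β = trans (sumFinℚ-const m 0ℚ) (ℚP.*-zeroʳ (ℕ→ℚ m))

sumFinℚ-ℕ→ℚ : ∀ {m} (f : Fin m → ℕ) → sumFinℚ (λ i → ℕ→ℚ (f i)) ≡ ℕ→ℚ (sumFinℕ f)
sumFinℚ-ℕ→ℚ {zero} f = refl
sumFinℚ-ℕ→ℚ {suc m} f = trans (cong (_+_ (ℕ→ℚ (f Fin.zero))) (sumFinℚ-ℕ→ℚ (λ i → f (Fin.suc i))))
  (sym (ℕ→ℚ-+ (f Fin.zero) _))

-- Adding up reciprocal bounds replaces taking the minimum of f.
uniform-reciprocal : ∀ K (f : ℕ → ℚ) → (∀ j → j ℕ.< K → 0ℚ < f j) →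
  ∃ λ q → 1 ≤ℕ q × (∀ j → j ℕ.< K → 1ℚ ≤ f j * ℕ→ℚ q)
uniform-reciprocal zero f pos = 1 , s≤s z≤n , λ j ()
uniform-reciprocal (suc K) f pos
  with uniform-reciprocal K f (λ j j<K → pos j (ℕP.m<n⇒m<1+n j<K)) | reciprocal-bound (f K) (pos K ℕP.≤-refl)
... | q , 1≤q , bound | r , _ , rbound = q ℕ.+ r , ℕP.≤-trans 1≤q (ℕP.m≤m+n q r) , both
  where
  both : ∀ j → j ℕ.< suc K → 1ℚ ≤ f j * ℕ→ℚ (q ℕ.+ r)
  both j (s≤s j≤K) with ℕP.m≤n⇒m<n∨m≡n j≤K
  ... | inj₁ j<K = ≤-trans (bound j j<K) (*-monoʳ (<⇒≤ (pos j (s≤s j≤K))) (ℕ→ℚ-mono (ℕP.m≤m+n q r)))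
  ... | inj₂ refl = ≤-trans rbound (*-monoʳ (<⇒≤ (pos j (s≤s j≤K))) (ℕ→ℚ-mono (ℕP.m≤n+m r q)))

total-position : ∀ (f : ℕ → ℚ) (X : Vec (Fin k) n) →
  total (λ m _ _ → f m) X ≡ sumFinℚ {n} (λ p → f (n ℕ.∸ suc (toℕ p)))
total-position f Vec.[] = refl
total-position {n = suc n} f (i Vec.∷ X) = cong (_+_ (f n)) (total-position f X)

weightOf-position : ∀ (y : ℕ → Fin k → ℚ) (X : Vec (Fin k) n) →
  weightOf y X ≡ prodFinℚ {n} (λ p → y (n ℕ.∸ suc (toℕ p)) (lookup X p))
weightOf-position y Vec.[] = refl
weightOf-position {n = suc n} y (i Vec.∷ X) = cong (y n i *_) (weightOf-position y X)

prodFinℚ-cong : ∀ {m} {f g : Fin m → ℚ} → (∀ i → f i ≡ g i) → prodFinℚ f ≡ prodFinℚ g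
prodFinℚ-cong {zero} eq = refl
prodFinℚ-cong {suc m} eq = cong₂ _*_ (eq Fin.zero) (prodFinℚ-cong (λ i → eq (Fin.suc i)))

-- y m j is the probability that the element m + 1 is put into Q_j.
record Fluid (k : ℕ) .{{_ : NonZero k}} (α : Fin k → ℚ) (n : ℕ) (C c : ℚ) (y : ℕ → Fin k → ℚ) : Set where
  field
    distribution : Distribution y
    weight-prob : ∀ X → weightOf y X ≡ prob k α n X
    mean-size : ∀ j (X : Outcome k n) → total (λ m _ _ → y m j) X ≡ α j * ℕ→ℚ n
    mean-sum : ∀ j (X : Outcome k n) → total (λ m _ _ → ℕ→ℚ (suc m) * y m j) X ≡ ℕ→ℚ (sTarget n k)
    spread : ∀ m → m ℕ.< n → ℕ→ℚ (suc m) ≤ C → ∀ j → c ≤ y m j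

module Family (k' : ℕ) (α : Fin (suc k') → ℚ) (param : IsLinearFamilyParam (suc k') α)
  (q : ℕ) (1≤q : 1 ≤ℕ q) (ι : ℚ) (0<ι : 0ℚ < ι) (ιq≡1 : ι * ℕ→ℚ q ≡ 1ℚ)
  (slack≥ι : ∀ j → j ℕ.< k' → ι ≤ slack (suc k') α (suc j)) (α₀≥ι : ι ≤ α Fin.zero) where

  private
    K = suc k'

  0<α = proj₁ param
  α-mono = proj₁ (proj₂ param)
  Σα≡1 = proj₁ (proj₂ (proj₂ param))

  α≥ι : ∀ j → ι ≤ α j
  α≥ι j = ≤-trans α₀≥ι (α-mono Fin.zero j z≤n)

  -- Half of the slack bound; the other half pays for the linear term of W(W+1)/2 in `room`.
  κ : ℚ
  κ = ½ * ι

  0<κ : 0ℚ < κ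
  0<κ = 0<-* (ℚP.positive⁻¹ ½) 0<ι

  ι≤1 : ι ≤ 1ℚ
  ι≤1 = ≤-trans (≤-reflexive (sym (ℚP.*-identityʳ ι)))
    (≤-trans (*-monoʳ (<⇒≤ 0<ι) (ℕ→ℚ-mono {1} {q} 1≤q)) (≤-reflexive ιq≡1))

  κ≤ι : κ ≤ ι
  κ≤ι = ≤-trans (*-monoˡ {ι} {½} {1ℚ} (<⇒≤ 0<ι) (≤-by ½ 0≤½ refl)) (≤-reflexive (ℚP.*-identityˡ ι))

  module Instance (e : ℕ) (q≤n : q ≤ℕ suc e) (inFamily : InFamily K α (suc e)) where

    ν : ℕ
    ν = suc e

    N S h M C : ℚ
    N = ℕ→ℚ ν
    S = ℕ→ℚ (sTarget ν K)
    h = + 1 ℚ./ (2 ℕ.* K)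
    M = κ * N * N
    C = κ * N

    1≤n : 1 ≤ℕ ν
    1≤n = ℕP.≤-trans 1≤q q≤n

    0<N : 0ℚ < N
    0<N = ℕ→ℚ-mono-< {0} {ν} 1≤n

    1≤ιN : 1ℚ ≤ ι * N
    1≤ιN = ≤-trans (≤-reflexive (sym ιq≡1)) (*-monoʳ (<⇒≤ 0<ι) (ℕ→ℚ-mono q≤n))

    part : Fin K → ℕ
    part j = proj₁ (proj₁ (proj₂ inFamily) j)

    part-def : ∀ j → α j * N ≡ ℕ→ℚ (part j)
    part-def j = proj₂ (proj₁ (proj₂ inFamily) j)

    targetSize-part : ∀ j → targetSize α ν j ≡ part j
    targetSize-part j = trans (cong (λ p → ℤ.∣ ℚ.floor p ∣) (part-def j)) (floor-ℕ→ℚ (part j))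

    sTarget-2k : sTarget ν K ℕ.* (2 ℕ.* K) ≡ ν ℕ.* suc ν
    sTarget-2k = DivMod.m/n*n≡m (proj₂ (proj₂ inFamily))

    2k : ℚ
    2k = ℕ→ℚ (2 ℕ.* K)

    0<2k : 0ℚ < 2k
    0<2k = ℕ→ℚ-mono-< {0} {2 ℕ.* K} (s≤s z≤n)

    h2k≡1 : h * 2k ≡ 1ℚ
    h2k≡1 = /-*-cancel 1 (2 ℕ.* K)

    0≤h : 0ℚ ≤ h
    0≤h = 0≤-cancelʳ 0<2k (≤-trans 0≤1 (≤-reflexive (sym h2k≡1)))

    cancel-2k : ∀ {x y} → x * 2k ≡ y → x ≡ y * h
    cancel-2k {x} refl = trans (sym (ℚP.*-identityʳ x)) (trans (cong (x *_) (sym h2k≡1)) (eq x h 2k))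
      where
      eq : ∀ x h d → x * (h * d) ≡ x * d * h
      eq = solve-∀ ring

    S≡ : S ≡ N * (N + 1ℚ) * h
    S≡ = cancel-2k (trans (sym (ℕ→ℚ-* (sTarget ν K) (2 ℕ.* K)))
      (trans (cong ℕ→ℚ sTarget-2k) (trans (ℕ→ℚ-* ν (suc ν)) (cong (N *_) (ℕ→ℚ-suc ν)))))

    0<S : 0ℚ < S
    0<S = 0<-cancelʳ (<⇒≤ 0<2k) (subst (0ℚ <_) (trans (cong ℕ→ℚ (sym sTarget-2k)) (ℕ→ℚ-* (sTarget ν K) (2 ℕ.* K)))
      (ℕ→ℚ-mono-< {0} {ν ℕ.* suc ν} (ℕP.*-mono-≤ 1≤n (s≤s z≤n))))

    open Fractional S M C κ ν 0<S (0<-* (0<-* 0<κ 0<N) 0<N) (<⇒≤ (0<-* 0<κ 0<N)) refl (<⇒≤ 0<κ) (≤-trans κ≤ι ι≤1) ≤-refl public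

    scaled : ∀ {m} → (Fin m → ℚ) → Fin m → ℚ
    scaled β i = β i * N

    sum-scaled : ∀ {m} (β : Fin m → ℚ) → sumFinℚ (scaled β) ≡ sumFinℚ β * N
    sum-scaled β = trans (sumFinℚ-cong (λ i → ℚP.*-comm (β i) N)) (trans (sumFinℚ-* N β) (ℚP.*-comm N (sumFinℚ β)))

    slackAt : ℚ → ℕ → ℚ
    slackAt A j = A * (1ℚ - A * ½) - ℕ→ℚ j * h

    slackAt-def : ∀ j → slack K α j ≡ slackAt (prefixSum α j) j
    slackAt-def j = cong (_-_ (prefixSum α j * (1ℚ - prefixSum α j * ½))) (cancel-2k (/-*-cancel j (2 ℕ.* K)))

    -- As (j + m') / (2k) = 1/2, the slack equals m'/(2k) - (1 - A)²/2: in units of n², the need of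
    -- the last m' targets minus the sum of the W = (1 - A) n smallest elements. Of ι N², one half
    -- is M and the other absorbs N/2, since ι N ≥ 1.
    room : ∀ m j A → j ℕ.+ suc m ≡ K → 0ℚ ≤ A → ι ≤ slackAt A j → ∀ B W → A + B ≡ 1ℚ → B * N ≡ ℕ→ℚ W →
      triangle W + M ≤ ℕ→ℚ (suc m) * S
    room m j A j+m 0≤A ι≤slack B W A+B BN = ≤-by
      (N * N * (slackAt A j - ι) + ½ * (N * (ι * N - 1ℚ)) + ½ * (N * A) + N * (h * m'))
      (0≤-+ (0≤-+ (0≤-+ (0≤-* (0≤-* 0≤N 0≤N) (0≤-diff ι≤slack)) (0≤-* 0≤½ (0≤-* 0≤N (0≤-diff 1≤ιN))))
        (0≤-* 0≤½ (0≤-* 0≤N 0≤A))) (0≤-* 0≤N (0≤-* 0≤h (0≤ℕ→ℚ (suc m)))))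
      (begin
        triangle W + M + _ ≡⟨ cong (λ w → ½ * (w * (w + 1ℚ)) + M + rest) (trans (sym BN) (cong (_* N) B≡)) ⟩
        ½ * ((1ℚ - A) * N * ((1ℚ - A) * N + 1ℚ)) + M + rest ≡⟨ eq₁ A N ι h m' (ℕ→ℚ j) ⟩
        m' * (N * (N + 1ℚ) * h) + (N * N) * (½ - (ℕ→ℚ j + m') * h)
          ≡⟨ cong₂ (λ x y → m' * x + (N * N) * (½ - y)) (sym S≡) jm ⟩
        m' * S + (N * N) * (½ - ½) ≡⟨ eq₂ (m' * S) (N * N) ⟩
        m' * S ∎)
      where
      open ≡-Reasoning
      m' = ℕ→ℚ (suc m)
      rest = N * N * (slackAt A j - ι) + ½ * (N * (ι * N - 1ℚ)) + ½ * (N * A) + N * (h * m')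
      0≤N = <⇒≤ 0<N
      B≡ : B ≡ 1ℚ - A
      B≡ = trans (eq A B) (cong (_- A) A+B)
        where
        eq : ∀ A B → B ≡ A + B - A
        eq = solve-∀ ring
      jm : (ℕ→ℚ j + m') * h ≡ ½
      jm = trans (cong (_* h) (trans (sym (ℕ→ℚ-+ j (suc m))) (cong ℕ→ℚ j+m)))
        (trans (eq (ℕ→ℚ K) h) (trans (cong (½ *_) (trans (cong (h *_) (sym (ℕ→ℚ-* 2 K))) h2k≡1)) (ℚP.*-identityʳ ½)))
        where
        eq : ∀ k h → k * h ≡ ½ * (h * (2ℚ * k))
        eq = solve-∀ ring
      eq₁ : ∀ A N ι h m j → ½ * ((1ℚ - A) * N * ((1ℚ - A) * N + 1ℚ)) + ½ * ι * N * N +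
        (N * N * (A * (1ℚ - A * ½) - j * h - ι) + ½ * (N * (ι * N - 1ℚ)) + ½ * (N * A) + N * (h * m)) ≡
        m * (N * (N + 1ℚ) * h) + (N * N) * (½ - (j + m) * h)
      eq₁ = solve-∀ ring
      eq₂ : ∀ x y → x + y * (½ - ½) ≡ x
      eq₂ = solve-∀ ring

    -- Slack is a condition on prefixes and `Spacious` one on suffixes, so the induction carries the
    -- sum A and the length j of the prefix already removed.
    spacious : ∀ m (β : Fin m → ℚ) A j → j ℕ.+ m ≡ K → 0ℚ ≤ A → A + sumFinℚ β ≡ 1ℚ →
      (∀ i → i ℕ.< m → ι ≤ slackAt (A + prefixSum β i) (j ℕ.+ i)) → (∀ i → ι ≤ β i) →
      (∀ i i' → toℕ i ≤ℕ toℕ i' → β i ≤ β i') → (∀ i → ∃ λ w → β i * N ≡ ℕ→ℚ w) → Spacious (scaled β)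
    spacious zero β A j _ _ _ _ _ _ _ = none
    spacious (suc m) β A j j+m 0≤A A+Σ slk β≥ι mono int =
      some W (0<-* 0<β₀ 0<N) (*-monoˡ (<⇒≤ 0<N) (≤-trans κ≤ι (β≥ι Fin.zero)))
        (λ i → *-monoˡ (<⇒≤ 0<N) (mono Fin.zero i z≤n)) ΣW
        (room m j A j+m 0≤A here (sumFinℚ β) W A+Σ (trans (sym (sum-scaled β)) ΣW))
        (spacious m β' (A + β₀) (suc j) (trans (sym (ℕP.+-suc j m)) j+m) (0≤-+ 0≤A (<⇒≤ 0<β₀))
          (trans (ℚP.+-assoc A β₀ _) A+Σ) there (λ i → β≥ι (Fin.suc i))
          (λ i i' i≤i' → mono (Fin.suc i) (Fin.suc i') (s≤s i≤i')) (λ i → int (Fin.suc i)))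
      where
      β₀ = β Fin.zero
      β' = λ i → β (Fin.suc i)
      W = sumFinℕ (λ i → proj₁ (int i))
      0<β₀ : 0ℚ < β₀
      0<β₀ = ℚP.<-≤-trans 0<ι (β≥ι Fin.zero)
      ΣW : sumFinℚ (scaled β) ≡ ℕ→ℚ W
      ΣW = trans (sumFinℚ-cong (λ i → proj₂ (int i))) (sumFinℚ-ℕ→ℚ (λ i → proj₁ (int i)))
      here : ι ≤ slackAt A j
      here = subst₂ (λ B i → ι ≤ slackAt B i) (trans (cong (_+_ A) (prefixSum-zero β)) (ℚP.+-identityʳ A))
        (ℕP.+-identityʳ j) (slk 0 (s≤s z≤n))
      there : ∀ i → i ℕ.< m → ι ≤ slackAt (A + β₀ + prefixSum β' i) (suc j ℕ.+ i)
      there i i<m = subst₂ (λ B i → ι ≤ slackAt B i) (sym (ℚP.+-assoc A β₀ _)) (ℕP.+-suc j i) (slk (suc i) (s≤s i<m))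

    solution : Solution e 1ℚ S (α Fin.zero * N) (scaled (λ i → α (Fin.suc i))) (fracSol K α ν)
    solution = subst (Solution e 1ℚ S (α Fin.zero * N) (scaled α')) fracSol-run
      (run-solution fuel e 1ℚ S (α Fin.zero * N) (scaled α') N (sym (ℚP.*-identityˡ N)) (ℚP.positive⁻¹ 1ℚ) ≤-refl
        ℕP.≤-refl (<⇒≤ 0<S) (λ j → *-monoʳ (<⇒≤ 0<S) (*-monoˡ (<⇒≤ 0<N) (α-mono Fin.zero (Fin.suc j) z≤n)))
        (balance vol amt)
        (spacious k' α' (α Fin.zero) 1 refl (<⇒≤ (0<α Fin.zero)) Σα≡1
          (λ i i<k' → ≤-trans (slack≥ι i i<k') (≤-reflexive (slackAt-def (suc i)))) (λ i → α≥ι (Fin.suc i))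
          (λ i i' i≤i' → α-mono (Fin.suc i) (Fin.suc i') (s≤s i≤i')) (λ i → part (Fin.suc i) , part-def (Fin.suc i)))
        enough)
      where
      α' = λ i → α (Fin.suc i)
      fuel = 2 ℕ.* (ν ℕ.+ K) ℕ.+ 2
      enough : 2 ℕ.* (e ℕ.+ k') ℕ.< fuel
      enough = ℕP.<-≤-trans (s≤s (ℕP.*-monoʳ-≤ 2 (ℕP.+-mono-≤ (ℕP.n≤1+n e) (ℕP.n≤1+n k'))))
        (ℕP.≤-trans (ℕP.≤-reflexive (ℕP.+-comm 1 _)) (ℕP.+-monoʳ-≤ (2 ℕ.* (ν ℕ.+ K)) (s≤s z≤n)))
      fracSol-run : run fuel ((N , 1ℚ) ∷ unitSources e) ((S , α Fin.zero * N) ∷ targets (scaled α')) ≡ fracSol K α ν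
      fracSol-run = trans (run-def fuel _ _) (cong₂ (frac fuel)
        (sym (ListP.map-upTo (λ p → (ℕ→ℚ (ν ℕ.∸ p) , 1ℚ)) ν))
        (sym (ListP.map-tabulate (λ j → j) (λ j → (S , α j * N)))))
      vol : α Fin.zero * N + sumFinℚ (scaled α') ≡ 1ℚ + ℕ→ℚ e
      vol = trans (sum-scaled α) (trans (cong (_* N) Σα≡1) (trans (ℚP.*-identityˡ N) (ℕ→ℚ-+ 1 e)))
      amt : S + ℕ→ℚ k' * S ≡ 1ℚ * ℕ→ℚ (suc e) + triangle e
      amt = trans (factor S (ℕ→ℚ k')) (trans (cong (_* S) (sym (ℕ→ℚ-suc k')))
        (trans (cong (ℕ→ℚ K *_) S≡) (trans (reorder (ℕ→ℚ K) N h) (trans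
          (cong (λ z → ½ * (N * (N + 1ℚ)) * z) (trans (cong (h *_) (sym (ℕ→ℚ-* 2 K))) h2k≡1))
          (trans (ℚP.*-identityʳ (triangle ν)) (trans (triangle-suc e) (cong (_+ triangle e) (sym (ℚP.*-identityˡ N)))))))))
        where
        factor : ∀ S m → S + m * S ≡ (m + 1ℚ) * S
        factor = solve-∀ ring
        reorder : ∀ k N h → k * (N * (N + 1ℚ) * h) ≡ ½ * (N * (N + 1ℚ)) * (h * (2ℚ * k))
        reorder = solve-∀ ring

    module Sol = Solution solution

    -- For m ≥ ν the truncated subtraction points to row 0, so `y m` is a probability distribution
    -- for every m.
    y : ℕ → Fin K → ℚ
    y m j = entry (fracSol K α ν) (ν ℕ.∸ suc m) (toℕ j)

    reflect : ∀ p → p ℕ.< ν → ν ℕ.∸ suc (ν ℕ.∸ suc p) ≡ p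
    reflect p (s≤s p≤e) = ℕP.m∸[m∸n]≡n p≤e

    reflect-suc : ∀ (p : Fin ν) → suc (ν ℕ.∸ suc (toℕ p)) ≡ ν ℕ.∸ toℕ p
    reflect-suc p = sym (ℕP.+-∸-assoc 1 (FinP.toℕ≤pred[n] p))

    fluid : Fluid K α ν C (κ ^ℚ k') y
    fluid = record
      { distribution = record
        { nonneg = λ m j → Sol.nonneg (ν ℕ.∸ suc m) (toℕ j)
        ; unit = λ m → Sol.unit (ν ℕ.∸ suc m) (ℕP.m∸n≤m e m) }
      ; weight-prob = λ X → trans (weightOf-position y X)
          (prodFinℚ-cong (λ p → cong (λ i → entry (fracSol K α ν) i (toℕ (lookup X p))) (reflect (toℕ p) (FinP.toℕ<n p))))
      ; mean-size = λ j X → trans (total-position (λ m → y m j) X)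
          (trans (sumFinℚ-cong (λ p → trans (position j p) (sym (ℚP.*-identityˡ _)))) (volume j))
      ; mean-sum = λ j X → trans (total-position (λ m → ℕ→ℚ (suc m) * y m j) X)
          (trans (sumFinℚ-cong (λ p → cong₂ (λ a b → ℕ→ℚ a * b) (reflect-suc p) (position j p))) (amount j))
      ; spread = λ m m<ν small j → Sol.spread (ν ℕ.∸ suc m) (ℕP.m∸n≤m e m)
          (subst (λ i → ℕ→ℚ i ≤ C) (sym (ℕP.m∸[m∸n]≡n m<ν)) small) j }
      where
      position : ∀ j (p : Fin ν) → y (ν ℕ.∸ suc (toℕ p)) j ≡ entry (fracSol K α ν) (toℕ p) (toℕ j)
      position j p = cong (λ i → entry (fracSol K α ν) i (toℕ j)) (reflect (toℕ p) (FinP.toℕ<n p))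
      volume : ∀ j → sumFinℚ {ν} (λ p → 1ℚ * entry (fracSol K α ν) (toℕ p) (toℕ j)) ≡ α j * N
      volume Fin.zero = Sol.volume₀
      volume (Fin.suc j) = Sol.volume₁ j
      amount : ∀ j → sumFinℚ {ν} (λ p → ℕ→ℚ (ν ℕ.∸ toℕ p) * entry (fracSol K α ν) (toℕ p) (toℕ j)) ≡ S
      amount Fin.zero = trans (cong (λ c → column c (descending e) (fracSol K α ν) 0) (sym (ℚP.*-identityˡ N))) Sol.amount₀
      amount (Fin.suc j) = trans (cong (λ c → column c (descending e) (fracSol K α ν) (suc (toℕ j))) (sym (ℚP.*-identityˡ N))) (Sol.amount₁ j)

-- The bad events

open Repair using (δ; δ≤; rsum; hit; hit≤1; pairs)

sumFinℚ-δ : ∀ {m} (f : Fin m → ℚ) j → sumFinℚ (λ i → f i * ℕ→ℚ (δ i j 1)) ≡ f j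
sumFinℚ-δ {suc m} f Fin.zero = trans (cong₂ _+_ (ℚP.*-identityʳ (f Fin.zero))
  (trans (sumFinℚ-cong {m} (λ i → ℚP.*-zeroʳ (f (Fin.suc i)))) (trans (sumFinℚ-const m 0ℚ) (ℚP.*-zeroʳ (ℕ→ℚ m)))))
  (ℚP.+-identityʳ (f Fin.zero))
sumFinℚ-δ {suc m} f (Fin.suc j) = trans (cong₂ _+_ (ℚP.*-zeroʳ (f Fin.zero)) (sumFinℚ-δ (λ i → f (Fin.suc i)) j))
  (ℚP.+-identityˡ (f (Fin.suc j)))

sumFinℚ-single : ∀ {m} (f : Fin m → ℚ) → (∀ i → 0ℚ ≤ f i) → ∀ j → f j ≤ sumFinℚ f
sumFinℚ-single f nn Fin.zero = ≤-by _ (0≤-sumFinℚ (λ i → nn (Fin.suc i))) refl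
sumFinℚ-single f nn (Fin.suc j) = ≤-trans (sumFinℚ-single (λ i → f (Fin.suc i)) (λ i → nn (Fin.suc i)) j)
  (≤-by (f Fin.zero) (nn Fin.zero) (ℚP.+-comm _ (f Fin.zero)))

product-bounds : ∀ {c x} → - 1ℚ ≤ c → c ≤ 1ℚ → - 1ℚ ≤ x → x ≤ 1ℚ → - 1ℚ ≤ c * x × c * x ≤ 1ℚ
product-bounds {c} {x} -1≤c c≤1 -1≤x x≤1 =
  ≤-by (½ * ((c - - 1ℚ) * (x - - 1ℚ) + (1ℚ - c) * (1ℚ - x)))
    (0≤-* 0≤½ (0≤-+ (0≤-* (0≤-diff -1≤c) (0≤-diff -1≤x)) (0≤-* (0≤-diff c≤1) (0≤-diff x≤1)))) (eq₁ c x) ,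
  ≤-by (½ * ((c - - 1ℚ) * (1ℚ - x) + (1ℚ - c) * (x - - 1ℚ)))
    (0≤-* 0≤½ (0≤-+ (0≤-* (0≤-diff -1≤c) (0≤-diff x≤1)) (0≤-* (0≤-diff c≤1) (0≤-diff -1≤x)))) (eq₂ c x)
  where
  eq₁ : ∀ c x → - 1ℚ + ½ * ((c - - 1ℚ) * (x - - 1ℚ) + (1ℚ - c) * (1ℚ - x)) ≡ c * x
  eq₁ = solve-∀ ring
  eq₂ : ∀ c x → c * x + ½ * ((c - - 1ℚ) * (1ℚ - x) + (1ℚ - c) * (x - - 1ℚ)) ≡ 1ℚ
  eq₂ = solve-∀ ring

total-cong : ∀ {Y Z : Process k} (X : Vec (Fin k) n) → (∀ m i X → Y m i X ≡ Z m i X) → total Y X ≡ total Z X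
total-cong Vec.[] eq = refl
total-cong (i Vec.∷ X) eq = cong₂ _+_ (eq _ i X) (total-cong X eq)

total-linear : ∀ (Y Z : Process k) c (X : Vec (Fin k) n) →
  total (λ m i X → c * (Y m i X - Z m i X)) X ≡ c * (total Y X - total Z X)
total-linear Y Z c Vec.[] = eq c
  where
  eq : ∀ c → 0ℚ ≡ c * (0ℚ - 0ℚ)
  eq = solve-∀ ring
total-linear Y Z c (i Vec.∷ X) = trans (cong (_+_ (c * (Y _ i X - Z _ i X))) (total-linear Y Z c X))
  (eq c (Y _ i X) (Z _ i X) (total Y X) (total Z X))
  where
  eq : ∀ c a b s t → c * (a - b) + c * (s - t) ≡ c * ((a + s) - (b + t))
  eq = solve-∀ ring

total-size : ∀ j (X : Vec (Fin k) n) → total (λ m i _ → ℕ→ℚ (δ i j 1)) X ≡ ℕ→ℚ (size X j)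
total-size j Vec.[] = refl
total-size j (i Vec.∷ X) = trans (cong (_+_ (ℕ→ℚ (δ i j 1))) (total-size j X)) (sym (ℕ→ℚ-+ (δ i j 1) (size X j)))

ℕ→ℚ-δ : ∀ (i j : Fin k) w → ℕ→ℚ w * ℕ→ℚ (δ i j 1) ≡ ℕ→ℚ (δ i j w)
ℕ→ℚ-δ i j w with does (i Fin.≟ j)
... | true = ℚP.*-identityʳ (ℕ→ℚ w)
... | false = ℚP.*-zeroʳ (ℕ→ℚ w)

total-sum : ∀ j (X : Vec (Fin k) n) → total (λ m i _ → ℕ→ℚ (suc m) * ℕ→ℚ (δ i j 1)) X ≡ ℕ→ℚ (sumQ X j)
total-sum j Vec.[] = refl
total-sum {n = suc n} j (i Vec.∷ X) = trans (cong₂ _+_ (ℕ→ℚ-δ i j (suc n)) (total-sum j X))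
  (sym (ℕ→ℚ-+ (δ i j (suc n)) (sumQ X j)))

guard : ℕ → ℕ → (ℕ → ℕ) → ℕ → ℕ
guard d L b m with d ℕP.≤? m | (m ℕ.∸ d) ℕP.<? L
... | yes _ | yes _ = b (m ℕ.∸ d)
... | yes _ | no _ = 0
... | no _ | _ = 0

guard≤1 : ∀ d L b m → (∀ m → b m ≤ℕ 1) → guard d L b m ≤ℕ 1
guard≤1 d L b m b≤1 with d ℕP.≤? m | (m ℕ.∸ d) ℕP.<? L
... | yes _ | yes _ = b≤1 (m ℕ.∸ d)
... | yes _ | no _ = z≤n
... | no _ | _ = z≤n

guard-inside : ∀ d L b m → d ≤ℕ m → m ℕ.∸ d ℕ.< L → guard d L b m ≡ b (m ℕ.∸ d)
guard-inside d L b m d≤m <L with d ℕP.≤? m | (m ℕ.∸ d) ℕP.<? L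
... | yes _ | yes _ = refl
... | yes _ | no ≮L = contradiction <L ≮L
... | no d≰m | _ = contradiction d≤m d≰m

guard-outside : ∀ d L b m → (d ≤ℕ m → ¬ m ℕ.∸ d ℕ.< L) → guard d L b m ≡ 0
guard-outside d L b m out with d ℕP.≤? m | (m ℕ.∸ d) ℕP.<? L
... | yes d≤m | yes <L = contradiction <L (out d≤m)
... | yes _ | no _ = refl
... | no _ | _ = refl

rsum-cong : ∀ L {f g : ℕ → ℕ} → (∀ m → m ℕ.< L → f m ≡ g m) → rsum L f ≡ rsum L g
rsum-cong zero eq = refl
rsum-cong (suc L) eq = cong₂ ℕ._+_ (eq L ℕP.≤-refl) (rsum-cong L (λ m m<L → eq m (ℕP.m<n⇒m<1+n m<L)))

hit-tail : ∀ (j i : Fin k) (X : Vec (Fin k) n) m → m ℕ.< n → hit j (i Vec.∷ X) m ≡ hit j X m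
hit-tail {n = n} j i X m m<n with m ℕP.≟ n
... | yes m≡n = contradiction m≡n (ℕP.<⇒≢ m<n)
... | no _ = refl

hit-head : ∀ (j i : Fin k) (X : Vec (Fin k) n) → hit j (i Vec.∷ X) n ≡ δ i j 1
hit-head {n = n} j i X with n ℕP.≟ n
... | yes _ = refl
... | no n≢n = contradiction refl n≢n

module Events {k : ℕ} .{{_ : NonZero k}} {α : Fin k → ℚ} {n : ℕ} {C c : ℚ} {y : ℕ → Fin k → ℚ}
  (fluid : Fluid k α n C c y) where

  open Fluid fluid
  open Distribution distribution
  open Expectation distribution

  y≤1 : ∀ m j → y m j ≤ 1ℚ
  y≤1 m j = ≤-trans (sumFinℚ-single (y m) (nonneg m) j) (≤-reflexive (unit m))

  -- A martingale difference: the weight depends only on elements revealed earlier, and the other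
  -- factor has mean 0.
  deviation : (∀ m → Vec (Fin k) m → ℚ) → Fin k → Process k
  deviation w j m i X = w m X * (ℕ→ℚ (δ i j 1) - y m j)

  deviation-centered : ∀ {w} j → (∀ m → m ℕ.< n → ∀ X → - 1ℚ ≤ w m X × w m X ≤ 1ℚ) → Centered n (deviation w j)
  deviation-centered {w} j bound = record
    { ≤1 = λ m m<n i X → proj₂ (bounds m m<n i X)
    ; ≥-1 = λ m m<n i X → proj₁ (bounds m m<n i X)
    ; drift = λ m _ X → ≤-reflexive (drift₀ m X) }
    where
    bounds : ∀ m → m ℕ.< n → ∀ i X → - 1ℚ ≤ deviation w j m i X × deviation w j m i X ≤ 1ℚ
    bounds m m<n i X = product-bounds (proj₁ (bound m m<n X)) (proj₂ (bound m m<n X))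
      (≤-by (ℕ→ℚ (δ i j 1) + (1ℚ - y m j)) (0≤-+ (0≤ℕ→ℚ (δ i j 1)) (0≤-diff (y≤1 m j))) (eq₁ (ℕ→ℚ (δ i j 1)) (y m j)))
      (≤-trans (≤-by (y m j) (nonneg m j) (eq₂ (ℕ→ℚ (δ i j 1)) (y m j))) (ℕ→ℚ-mono (δ≤ i j 1)))
      where
      eq₁ : ∀ a y → - 1ℚ + (a + (1ℚ - y)) ≡ a - y
      eq₁ = solve-∀ ring
      eq₂ : ∀ a y → a - y + y ≡ a
      eq₂ = solve-∀ ring
    drift₀ : ∀ m X → sumFinℚ (λ i → y m i * (w m X * (ℕ→ℚ (δ i j 1) - y m j))) ≡ 0ℚ
    drift₀ m X = begin
      sumFinℚ (λ i → y m i * (v * (ℕ→ℚ (δ i j 1) - y m j)))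
        ≡⟨ sumFinℚ-cong (λ i → eq₁ (y m i) v (ℕ→ℚ (δ i j 1)) (y m j)) ⟩
      sumFinℚ (λ i → v * (y m i * ℕ→ℚ (δ i j 1) + - y m j * y m i)) ≡⟨ sumFinℚ-* v (λ i → y m i * ℕ→ℚ (δ i j 1) + - y m j * y m i) ⟩
      v * sumFinℚ (λ i → y m i * ℕ→ℚ (δ i j 1) + - y m j * y m i)
        ≡⟨ cong (v *_) (trans (sumFinℚ-+ (λ i → y m i * ℕ→ℚ (δ i j 1)) (λ i → - y m j * y m i))
             (cong₂ _+_ (sumFinℚ-δ (y m) j) (trans (sumFinℚ-* (- y m j) (y m)) (cong (- y m j *_) (unit m))))) ⟩
      v * (y m j + - y m j * 1ℚ) ≡⟨ eq₂ v (y m j) ⟩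
      0ℚ ∎
      where
      open ≡-Reasoning
      v = w m X
      eq₁ : ∀ a v d b → a * (v * (d - b)) ≡ v * (a * d + - b * a)
      eq₁ = solve-∀ ring
      eq₂ : ∀ v b → v * (b + - b * 1ℚ) ≡ 0ℚ
      eq₂ = solve-∀ ring

  -- Only upper deviations are tested, since `excess` is made of the oversized sets alone.
  oversize : Fin k → Process k
  oversize = deviation (λ _ _ → 1ℚ)

  oversize-centered : ∀ j → Centered n (oversize j)
  oversize-centered j = deviation-centered j (λ _ _ _ → ≤-trans (ℚP.nonPositive⁻¹ (- 1ℚ)) 0≤1 , ≤-refl)

  oversize-total : ∀ j (X : Outcome k n) → total (oversize j) X ≡ ℕ→ℚ (size X j) - α j * ℕ→ℚ n
  oversize-total j X = trans (total-linear (λ m i _ → ℕ→ℚ (δ i j 1)) (λ m _ _ → y m j) 1ℚ X)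
    (trans (ℚP.*-identityˡ _) (cong₂ _-_ (total-size j X) (mean-size j X)))

  module _ (r : ℚ) (0≤r : 0ℚ ≤ r) (rn≡1 : r * ℕ→ℚ n ≡ 1ℚ) where

    -- With r = 1/n the weights lie between -1 and 1. Both signs occur because Ψ adds absolute
    -- values.
    oversum undersum : Fin k → Process k
    oversum = deviation (λ m _ → r * ℕ→ℚ (suc m))
    undersum = deviation (λ m _ → - r * ℕ→ℚ (suc m))

    private
      rm≥0 : ∀ m → 0ℚ ≤ r * ℕ→ℚ (suc m)
      rm≥0 m = 0≤-* 0≤r (0≤ℕ→ℚ (suc m))
      rm≤1 : ∀ m → m ℕ.< n → r * ℕ→ℚ (suc m) ≤ 1ℚ
      rm≤1 m m<n = ≤-trans (*-monoʳ 0≤r (ℕ→ℚ-mono m<n)) (≤-reflexive rn≡1)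

    oversum-centered : ∀ j → Centered n (oversum j)
    oversum-centered j = deviation-centered j (λ m m<n _ →
      ≤-trans (≤-trans (ℚP.nonPositive⁻¹ (- 1ℚ)) ≤-refl) (rm≥0 m) , rm≤1 m m<n)

    undersum-centered : ∀ j → Centered n (undersum j)
    undersum-centered j = deviation-centered j (λ m m<n _ →
      ≤-trans (ℚP.neg-antimono-≤ (rm≤1 m m<n)) (≤-reflexive (ℚP.neg-distribˡ-* r (ℕ→ℚ (suc m)))) ,
      ≤-trans (≤-reflexive (sym (ℚP.neg-distribˡ-* r (ℕ→ℚ (suc m))))) (≤-trans (ℚP.neg-antimono-≤ (rm≥0 m)) 0≤1))

    sum-total : ∀ v j (X : Outcome k n) → total (deviation (λ m _ → v * ℕ→ℚ (suc m)) j) X ≡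
      v * (ℕ→ℚ (sumQ X j) - ℕ→ℚ (sTarget n k))
    sum-total v j X = trans (total-cong X (λ m i _ → eq v (ℕ→ℚ (suc m)) (ℕ→ℚ (δ i j 1)) (y m j)))
      (trans (total-linear (λ m i _ → ℕ→ℚ (suc m) * ℕ→ℚ (δ i j 1)) (λ m _ _ → ℕ→ℚ (suc m) * y m j) v X)
        (cong (v *_) (cong₂ _-_ (total-sum j X) (mean-sum j X))))
      where
      eq : ∀ v m d y → v * m * (d - y) ≡ v * (m * d - m * y)
      eq = solve-∀ ring

  -- Positive when among the elements m + 1 ≤ L marked by B there are fewer with m + d + 1 in Q_j
  -- than expected; B may only inspect elements below m + d + 1, which are revealed earlier.
  shortage : ℕ → ℕ → (∀ {m} → Vec (Fin k) m → ℕ → ℕ) → Fin k → Process k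
  shortage L d B = deviation (λ m X → - ℕ→ℚ (guard d L (B X) m))

  shortage-centered : ∀ L d (B : ∀ {m} → Vec (Fin k) m → ℕ → ℕ) j → (∀ {m} (X : Vec (Fin k) m) i → B X i ≤ℕ 1) →
    Centered n (shortage L d B j)
  shortage-centered L d B j B≤1 = deviation-centered j (λ m _ X →
    ℚP.neg-antimono-≤ (ℕ→ℚ-mono (guard≤1 d L (B X) m (B≤1 X))) ,
    ≤-trans (ℚP.neg-antimono-≤ (0≤ℕ→ℚ (guard d L (B X) m))) 0≤1)

  -- A marked index contributes y minus the indicator of its partner, and y ≥ c. The element m + 1
  -- is the partner of index m - d, so after m elements the decided indices are those below (m ∸ d)
  -- ⊓ L; each new element decides one further index or none.
  shortage-total : ∀ L d (B : ∀ {m} → Vec (Fin k) m → ℕ → ℕ) j →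
    (∀ {m} i (X : Vec (Fin k) m) i' → i' ℕ.+ d ≤ℕ m → B (i Vec.∷ X) i' ≡ B X i') →
    (∀ m → m ℕ.< L ℕ.+ d → c ≤ y m j) → ∀ {m} (X : Vec (Fin k) m) →
    c * ℕ→ℚ (rsum ((m ℕ.∸ d) ℕ.⊓ L) (B X)) - ℕ→ℚ (rsum ((m ℕ.∸ d) ℕ.⊓ L) (λ i → B X i ℕ.* hit j X (i ℕ.+ d)))
      ≤ total (shortage L d B j) X
  shortage-total L d B j stable low {zero} Vec.[] rewrite ℕP.0∸n≡0 d = ≤-reflexive (eq c)
    where
    eq : ∀ c → c * 0ℚ - 0ℚ ≡ 0ℚ
    eq = solve-∀ ring
  shortage-total L d B j stable low {suc m} (i Vec.∷ X) = go
    where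
    IH = shortage-total L d B j stable low {m} X
    marked kept : ℕ → ℕ
    marked r = rsum r (B X)
    kept r = rsum r (λ i' → B X i' ℕ.* hit j X (i' ℕ.+ d))
    marked' kept' : ℕ → ℕ
    marked' r = rsum r (B (i Vec.∷ X))
    kept' r = rsum r (λ i' → B (i Vec.∷ X) i' ℕ.* hit j (i Vec.∷ X) (i' ℕ.+ d))
    below : ∀ {r i'} → r ≤ℕ m ℕ.∸ d → i' ℕ.< r → i' ℕ.+ d ℕ.< m
    below {i' = i'} r≤ i'<r = ℕP.≤-trans (ℕP.+-monoˡ-≤ d i'<m∸d) (ℕP.≤-reflexive (ℕP.m∸n+n≡m (ℕP.<⇒≤ d<m)))
      where
      i'<m∸d = ℕP.≤-trans i'<r r≤
      d<m : d ℕ.< m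
      d<m = ℕP.m∸n≢0⇒n<m (λ eq → contradiction (subst (i' ℕ.<_) eq i'<m∸d) λ ())
    marked≡ : ∀ r → r ≤ℕ m ℕ.∸ d → marked' r ≡ marked r
    marked≡ r r≤ = rsum-cong r (λ i' i'<r → stable i X i' (ℕP.<⇒≤ (below r≤ i'<r)))
    kept≡ : ∀ r → r ≤ℕ m ℕ.∸ d → kept' r ≡ kept r
    kept≡ r r≤ = rsum-cong r (λ i' i'<r → cong₂ ℕ._*_ (stable i X i' (ℕP.<⇒≤ (below r≤ i'<r)))
      (hit-tail j i X (i' ℕ.+ d) (below r≤ i'<r)))
    Goal : ℕ → ℕ → Set
    Goal r g = c * ℕ→ℚ (marked' r) - ℕ→ℚ (kept' r) ≤
      - ℕ→ℚ g * (ℕ→ℚ (δ i j 1) - y m j) + total (shortage L d B j) X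
    unchanged : (m ℕ.∸ d) ℕ.⊓ L ≡ (suc m ℕ.∸ d) ℕ.⊓ L → Goal ((suc m ℕ.∸ d) ℕ.⊓ L) 0
    unchanged r≡ = subst₂ (λ x z → c * ℕ→ℚ x - ℕ→ℚ z ≤ - ℕ→ℚ 0 * (ℕ→ℚ (δ i j 1) - y m j) + total (shortage L d B j) X)
      (trans (sym (marked≡ _ (ℕP.m⊓n≤m (m ℕ.∸ d) L))) (cong marked' r≡))
      (trans (sym (kept≡ _ (ℕP.m⊓n≤m (m ℕ.∸ d) L))) (cong kept' r≡))
      (≤-trans IH (≤-reflexive (eq (ℕ→ℚ (δ i j 1) - y m j) (total (shortage L d B j) X))))
      where
      eq : ∀ x t → t ≡ - 0ℚ * x + t
      eq = solve-∀ ring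
    grown : ∀ b → b ≡ B (i Vec.∷ X) (m ℕ.∸ d) → d ≤ℕ m → m ℕ.∸ d ℕ.< L → Goal (suc (m ℕ.∸ d)) b
    grown b b≡ d≤m <L = subst₂ (λ x z → c * ℕ→ℚ x - ℕ→ℚ z ≤ - ℕ→ℚ b * (ℕ→ℚ (δ i j 1) - y m j) + total (shortage L d B j) X)
      (cong₂ ℕ._+_ b≡ (sym (marked≡ _ ℕP.≤-refl)))
      (cong₂ ℕ._+_ (cong₂ ℕ._*_ b≡ (trans (sym (hit-head j i X)) (cong (hit j (i Vec.∷ X)) (sym (ℕP.m∸n+n≡m d≤m)))))
        (sym (kept≡ _ ℕP.≤-refl)))
      (≤-by (ℕ→ℚ b * (y m j - c) + (total (shortage L d B j) X - (c * a - z)))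
        (0≤-+ (0≤-* (0≤ℕ→ℚ b) (0≤-diff (low m m<))) (0≤-diff IH'))
        (trans (cong₂ (λ u v → c * u - v + (ℕ→ℚ b * (y m j - c) + (total (shortage L d B j) X - (c * a - z))))
            (ℕ→ℚ-+ b (marked (m ℕ.∸ d))) (trans (ℕ→ℚ-+ (b ℕ.* δ i j 1) (kept (m ℕ.∸ d))) (cong (_+ z) (ℕ→ℚ-* b (δ i j 1)))))
          (eq c (ℕ→ℚ b) a (ℕ→ℚ (δ i j 1)) z (y m j) (total (shortage L d B j) X))))
      where
      a = ℕ→ℚ (marked (m ℕ.∸ d))
      z = ℕ→ℚ (kept (m ℕ.∸ d))
      IH' : c * a - z ≤ total (shortage L d B j) X
      IH' = subst (λ r → c * ℕ→ℚ (marked r) - ℕ→ℚ (kept r) ≤ total (shortage L d B j) X) (ℕP.m≤n⇒m⊓n≡m (ℕP.<⇒≤ <L)) IH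
      m< : m ℕ.< L ℕ.+ d
      m< = subst (ℕ._< L ℕ.+ d) (ℕP.m∸n+n≡m d≤m) (ℕP.+-monoˡ-< d <L)
      eq : ∀ c b a e z y t → c * (b + a) - (b * e + z) + (b * (y - c) + (t - (c * a - z))) ≡ - b * (e - y) + t
      eq = solve-∀ ring
    go : Goal ((suc m ℕ.∸ d) ℕ.⊓ L) (guard d L (B X) m)
    go = cases (d ℕP.≤? m) ((m ℕ.∸ d) ℕP.<? L)
      where
      cases : Dec (d ≤ℕ m) → Dec (m ℕ.∸ d ℕ.< L) → Goal ((suc m ℕ.∸ d) ℕ.⊓ L) (guard d L (B X) m)
      cases (yes d≤m) (yes <L) = subst₂ Goal
        (sym (trans (cong (ℕ._⊓ L) (ℕP.+-∸-assoc 1 d≤m)) (ℕP.m≤n⇒m⊓n≡m <L))) (sym (guard-inside d L (B X) m d≤m <L))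
        (grown (B X (m ℕ.∸ d)) (sym (stable i X (m ℕ.∸ d) (ℕP.≤-reflexive (ℕP.m∸n+n≡m d≤m)))) d≤m <L)
      cases (yes d≤m) (no ≮L) = subst (Goal ((suc m ℕ.∸ d) ℕ.⊓ L)) (sym (guard-outside d L (B X) m (λ _ → ≮L)))
        (unchanged (trans (ℕP.m≥n⇒m⊓n≡n (ℕP.≮⇒≥ ≮L))
          (sym (ℕP.m≥n⇒m⊓n≡n (ℕP.≤-trans (ℕP.≮⇒≥ ≮L) (ℕP.∸-monoˡ-≤ d (ℕP.n≤1+n m)))))))
      cases (no d≰m) _ = subst (Goal ((suc m ℕ.∸ d) ℕ.⊓ L)) (sym (guard-outside d L (B X) m (λ d≤m → contradiction d≤m d≰m)))
        (unchanged (trans (cong (ℕ._⊓ L) (ℕP.m≤n⇒m∸n≡0 (ℕP.<⇒≤ (ℕP.≰⇒> d≰m))))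
          (sym (cong (ℕ._⊓ L) (ℕP.m≤n⇒m∸n≡0 (ℕP.≰⇒> d≰m))))))

  module BadEvents (r : ℚ) (0≤r : 0ℚ ≤ r) (rn≡1 : r * ℕ→ℚ n ≡ 1ℚ) (L : ℕ) where

    allOf : ∀ {A : Set} {m} → (Fin m → A) → List A
    allOf = List.tabulate

    -- With d = 0 and every element marked, this measures how many elements up to L lie in Q_j.
    scarcity : Fin k → Process k
    scarcity = shortage L 0 (λ _ _ → 1)

    -- The second stage: the marked elements are those already found in Q_j'', and their partners at
    -- distance d are awaited in Q_j'.
    missing : ℕ → Fin k → Fin k → Process k
    missing d j' j'' = shortage L d (λ X → hit j'' X) j'

    missingAll : List (Process k)
    missingAll = List.concat (allOf {m = L} (λ d → List.concat (allOf (λ j' → allOf (λ j'' →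
      missing (suc (toℕ d)) j' j'')))))

    events : List (Process k)
    events = allOf oversize ++ allOf (oversum r 0≤r rn≡1) ++ allOf (undersum r 0≤r rn≡1) ++ allOf scarcity ++ missingAll

    events-centered : All (Centered n) events
    events-centered = AllP.++⁺ (AllP.tabulate⁺ oversize-centered)
      (AllP.++⁺ (AllP.tabulate⁺ (oversum-centered r 0≤r rn≡1))
        (AllP.++⁺ (AllP.tabulate⁺ (undersum-centered r 0≤r rn≡1))
          (AllP.++⁺ (AllP.tabulate⁺ (λ j → shortage-centered L 0 (λ _ _ → 1) j (λ _ _ → ℕP.≤-refl)))
            (AllP.concat⁺ (AllP.tabulate⁺ {n = L} (λ d → AllP.concat⁺ (AllP.tabulate⁺ (λ j' → AllP.tabulate⁺ (λ j'' →
              shortage-centered L (suc (toℕ d)) (λ X → hit j'' X) j' (λ X i → hit≤1 j'' X i))))))))))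

    length-concat-tabulate : ∀ {A : Set} {m} (f : Fin m → List A) c → (∀ i → length (f i) ≡ c) →
      length (List.concat (List.tabulate f)) ≡ m ℕ.* c
    length-concat-tabulate {m = zero} f c eq = refl
    length-concat-tabulate {m = suc m} f c eq = trans (ListP.length-++ (f Fin.zero))
      (cong₂ ℕ._+_ (eq Fin.zero) (length-concat-tabulate (λ i → f (Fin.suc i)) c (λ i → eq (Fin.suc i))))

    events-length : 1 ≤ℕ n → L ≤ℕ n → length events ≤ℕ (4 ℕ.* k ℕ.+ k ℕ.* k) ℕ.* n
    events-length 1≤n L≤n = ℕP.≤-trans (ℕP.≤-reflexive len) (ℕP.≤-trans
      (ℕP.+-mono-≤ (ℕP.m≤m*n (4 ℕ.* k) n {{ℕ.>-nonZero 1≤n}}) (ℕP.*-monoʳ-≤ (k ℕ.* k) L≤n))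
      (ℕP.≤-reflexive (sym (ℕP.*-distribʳ-+ n (4 ℕ.* k) (k ℕ.* k)))))
      where
      part : ∀ (f : Fin k → Process k) xs → length (allOf f ++ xs) ≡ k ℕ.+ length xs
      part f xs = trans (ListP.length-++ (allOf f)) (cong (ℕ._+ length xs) (ListP.length-tabulate f))
      lenM : length missingAll ≡ L ℕ.* (k ℕ.* k)
      lenM = length-concat-tabulate {m = L} _ (k ℕ.* k) (λ d →
        length-concat-tabulate {m = k} _ k (λ j' → ListP.length-tabulate {n = k} (λ j'' → missing (suc (toℕ d)) j' j'')))
      shape : ∀ a b → a ℕ.+ (a ℕ.+ (a ℕ.+ (a ℕ.+ b))) ≡ 4 ℕ.* a ℕ.+ b
      shape a b rewrite ℕP.+-identityʳ a | ℕP.+-assoc a (a ℕ.+ (a ℕ.+ a)) b | ℕP.+-assoc a (a ℕ.+ a) b | ℕP.+-assoc a a b = refl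
      len : length events ≡ 4 ℕ.* k ℕ.+ k ℕ.* k ℕ.* L
      len = trans (part oversize _) (trans (cong (k ℕ.+_) (trans (part (oversum r 0≤r rn≡1) _)
        (cong (k ℕ.+_) (trans (part (undersum r 0≤r rn≡1) _) (cong (k ℕ.+_) (trans (part scarcity _)
          (cong (k ℕ.+_) (trans lenM (ℕP.*-comm L (k ℕ.* k))))))))))
        (shape k (k ℕ.* k ℕ.* L)))

    record Typical (τ : ℚ) (X : Outcome k n) : Set where
      field
        size< : ∀ j → ℕ→ℚ (size X j) - α j * ℕ→ℚ n < τ
        sum< : ∀ j → r * (ℕ→ℚ (sumQ X j) - ℕ→ℚ (sTarget n k)) < τ
        sum> : ∀ j → - r * (ℕ→ℚ (sumQ X j) - ℕ→ℚ (sTarget n k)) < τ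
        many : ∀ j → c * ℕ→ℚ L - ℕ→ℚ (rsum L (hit j X)) < τ
        paired : ∀ j' j'' d → 1 ≤ℕ d → d ≤ℕ L →
          c * ℕ→ℚ (rsum L (hit j'' X)) - ℕ→ℚ (pairs L d j' j'' X) < τ

    rsum-ones : ∀ L → rsum L (λ _ → 1) ≡ L
    rsum-ones zero = refl
    rsum-ones (suc L) = cong suc (rsum-ones L)

    typical : ∀ {τ} (X : Outcome k n) → L ℕ.+ L ≤ℕ n → (∀ m → m ℕ.< L ℕ.+ L → ∀ j → c ≤ y m j) →
      All (λ Y → total Y X < τ) events → Typical τ X
    typical {τ} X 2L≤n low all = record
      { size< = λ j → subst (_< τ) (oversize-total j X) (AllP.tabulate⁻ all₁ j)
      ; sum< = λ j → subst (_< τ) (sum-total r 0≤r rn≡1 r j X) (AllP.tabulate⁻ all₂ j)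
      ; sum> = λ j → subst (_< τ) (sum-total r 0≤r rn≡1 (- r) j X) (AllP.tabulate⁻ all₃ j)
      ; many = λ j → ℚP.≤-<-trans (subst₂ (λ a b → c * ℕ→ℚ a - ℕ→ℚ b ≤ total (scarcity j) X)
          (trans (cong (λ l → rsum l (λ _ → 1)) n⊓L) (rsum-ones L))
          (trans (cong (λ l → rsum l (λ i → 1 ℕ.* hit j X (i ℕ.+ 0))) n⊓L)
            (rsum-cong L (λ i _ → trans (ℕP.*-identityˡ _) (cong (hit j X) (ℕP.+-identityʳ i)))))
          (shortage-total L 0 (λ _ _ → 1) j (λ _ _ _ _ → refl)
            (λ m m<L → low m (ℕP.≤-trans m<L (ℕP.+-monoʳ-≤ L z≤n)) j) X)) (AllP.tabulate⁻ all₄ j)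
      ; paired = paired }
      where
      rest₁ = AllP.++⁻ʳ (allOf oversize) all
      rest₂ = AllP.++⁻ʳ (allOf (oversum r 0≤r rn≡1)) rest₁
      rest₃ = AllP.++⁻ʳ (allOf (undersum r 0≤r rn≡1)) rest₂
      all₁ = AllP.++⁻ˡ (allOf oversize) all
      all₂ = AllP.++⁻ˡ (allOf (oversum r 0≤r rn≡1)) rest₁
      all₃ = AllP.++⁻ˡ (allOf (undersum r 0≤r rn≡1)) rest₂
      all₄ = AllP.++⁻ˡ (allOf scarcity) rest₃
      all₅ = AllP.++⁻ʳ (allOf scarcity) rest₃
      n⊓L : n ℕ.⊓ L ≡ L
      n⊓L = ℕP.m≥n⇒m⊓n≡n (ℕP.≤-trans (ℕP.m≤m+n L L) 2L≤n)
      single : ∀ d j' j'' → d ℕ.< L → total (missing (suc d) j' j'') X < τ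
      single d j' j'' d<L = subst (λ i → total (missing (suc i) j' j'') X < τ) (FinP.toℕ-fromℕ< d<L)
        (AllP.tabulate⁻ (AllP.tabulate⁻ (AllP.concat⁻ (AllP.tabulate⁻ (AllP.concat⁻ all₅) (Fin.fromℕ< d<L))) j') j'')
      paired : ∀ j' j'' d → 1 ≤ℕ d → d ≤ℕ L →
        c * ℕ→ℚ (rsum L (hit j'' X)) - ℕ→ℚ (pairs L d j' j'' X) < τ
      paired j' j'' (suc d) _ d<L = ℚP.≤-<-trans
        (subst (λ l → c * ℕ→ℚ (rsum l (hit j'' X)) - ℕ→ℚ (rsum l (λ i → hit j'' X i ℕ.* hit j' X (i ℕ.+ suc d)))
            ≤ total (missing (suc d) j' j'') X)
          (ℕP.m≥n⇒m⊓n≡n (ℕP.m+n≤o⇒m≤o∸n L (ℕP.≤-trans (ℕP.+-monoʳ-≤ L d<L) 2L≤n)))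
          (shortage-total L (suc d) (λ X → hit j'' X) j'
            (λ i X i' i'+d≤m → hit-tail j'' i X i' (ℕP.≤-trans (s≤s (ℕP.m≤m+n i' d))
              (ℕP.≤-trans (ℕP.≤-reflexive (sym (ℕP.+-suc i' d))) i'+d≤m)))
            (λ m m< → low m (ℕP.≤-trans m< (ℕP.+-monoʳ-≤ L d<L)) j') X))
        (single d j' j'' d<L)

-- Typical outcomes are repaired successfully

clear-∸ : ∀ E a b x → E ℕ.* a ℕ.< E ℕ.* b ℕ.+ x → E ℕ.* (a ℕ.∸ b) ≤ℕ x
clear-∸ E a b x lt = ℕP.≤-trans (ℕP.≤-reflexive (ℕP.*-distribˡ-∸ E a b))
  (ℕP.m≤n+o⇒m∸n≤o (E ℕ.* a) (E ℕ.* b) (ℕP.<⇒≤ lt))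

clear-dist : ∀ E a b x → E ℕ.* a ℕ.< E ℕ.* b ℕ.+ x → E ℕ.* b ℕ.< E ℕ.* a ℕ.+ x → E ℕ.* ℕ.∣ a - b ∣ ≤ℕ x
clear-dist E a b x a< b< with ℕP.≤-total a b
... | inj₁ a≤b = subst (λ d → E ℕ.* d ≤ℕ x) (sym (ℕP.m≤n⇒∣m-n∣≡n∸m a≤b)) (clear-∸ E b a x b<)
... | inj₂ b≤a = subst (λ d → E ℕ.* d ≤ℕ x) (sym (ℕP.m≤n⇒∣n-m∣≡n∸m b≤a)) (clear-∸ E a b x a<)

module Outcomes {k : ℕ} .{{_ : NonZero k}} {α : Fin k → ℚ} {n : ℕ} {C c : ℚ} {y : ℕ → Fin k → ℚ}
  (fluid : Fluid k α n C c y) (1≤n : 1 ≤ℕ n) (0≤c : 0ℚ ≤ c) (c≤1 : c ≤ 1ℚ)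
  (exact : ∀ j → α j * ℕ→ℚ n ≡ ℕ→ℚ (targetSize α n j)) (divides : sTarget n k ℕ.* (2 ℕ.* k) ≡ n ℕ.* suc n)
  (E : ℕ) (ε : ℚ) (0<ε : 0ℚ < ε) (εE≡1 : ε * ℕ→ℚ E ≡ 1ℚ)
  (r : ℚ) (0≤r : 0ℚ ≤ r) (rn≡1 : r * ℕ→ℚ n ≡ 1ℚ) where

  private
    N = ℕ→ℚ n

  open Events fluid using (module BadEvents)
  open BadEvents r 0≤r rn≡1 public

  0≤εN : 0ℚ ≤ ε * N
  0≤εN = 0≤-* (<⇒≤ 0<ε) (0≤ℕ→ℚ n)

  0<E : 0ℚ < ℕ→ℚ E
  0<E = 0<-cancelʳ (<⇒≤ 0<ε) (subst (0ℚ <_) (trans (sym εE≡1) (ℚP.*-comm ε (ℕ→ℚ E))) (ℚP.positive⁻¹ 1ℚ))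

  clear : ∀ a b x → ℕ→ℚ a - ℕ→ℚ b < ε * ℕ→ℚ x → E ℕ.* a ℕ.< E ℕ.* b ℕ.+ x
  clear a b x lt = ℕ→ℚ-cancel-< (<-by (ℕ→ℚ E * (ε * ℕ→ℚ x - (ℕ→ℚ a - ℕ→ℚ b))) (0<-* 0<E (0<-diff lt))
    (begin
      ℕ→ℚ (E ℕ.* a) + ℕ→ℚ E * (ε * ℕ→ℚ x - (ℕ→ℚ a - ℕ→ℚ b))
        ≡⟨ cong (_+ ℕ→ℚ E * (ε * ℕ→ℚ x - (ℕ→ℚ a - ℕ→ℚ b))) (ℕ→ℚ-* E a) ⟩
      ℕ→ℚ E * ℕ→ℚ a + ℕ→ℚ E * (ε * ℕ→ℚ x - (ℕ→ℚ a - ℕ→ℚ b)) ≡⟨ eq (ℕ→ℚ E) (ℕ→ℚ a) (ℕ→ℚ b) ε (ℕ→ℚ x) ⟩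
      ℕ→ℚ E * ℕ→ℚ b + ε * ℕ→ℚ E * ℕ→ℚ x
        ≡⟨ cong₂ _+_ (sym (ℕ→ℚ-* E b)) (trans (cong (_* ℕ→ℚ x) εE≡1) (ℚP.*-identityˡ (ℕ→ℚ x))) ⟩
      ℕ→ℚ (E ℕ.* b) + ℕ→ℚ x ≡⟨ sym (ℕ→ℚ-+ (E ℕ.* b) x) ⟩
      ℕ→ℚ (E ℕ.* b ℕ.+ x) ∎))
    where
    open ≡-Reasoning
    eq : ∀ E a b ε x → E * a + E * (ε * x - (a - b)) ≡ E * b + ε * E * x
    eq = solve-∀ ring

  rescale : ∀ d → r * d < ε * N → d < ε * ℕ→ℚ (n ℕ.* n)
  rescale d lt = <-by ((ε * N - r * d) * N) (0<-* (0<-diff lt) (ℕ→ℚ-mono-< {0} {n} 1≤n))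
    (trans (eq d ε N r) (trans (cong (λ z → ε * (N * N) + d * (1ℚ - z)) rn≡1)
      (trans (drop (ε * (N * N)) d) (cong (ε *_) (sym (ℕ→ℚ-* n n))))))
    where
    eq : ∀ d ε N r → d + (ε * N - r * d) * N ≡ ε * (N * N) + d * (1ℚ - r * N)
    eq = solve-∀ ring
    drop : ∀ x d → x + d * (1ℚ - 1ℚ) ≡ x
    drop = solve-∀ ring

  val-total : sumFinℕ {n} val ≡ k ℕ.* sTarget n k
  val-total = ℕP.*-cancelˡ-≡ _ _ 2 (trans (Repair.double-total n) (trans (sym divides) (eq (sTarget n k) k)))
    where
    eq : ∀ s k → s ℕ.* (2 ℕ.* k) ≡ 2 ℕ.* (k ℕ.* s)
    eq s k = trans (ℕP.*-comm s (2 ℕ.* k)) (ℕP.*-assoc 2 k s)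

  module _ (L w Q G g : ℕ) (1≤L : 1 ≤ℕ L) (1≤w : 1 ≤ℕ w) (1≤Q : 1 ≤ℕ Q)
    (G≡ : G ≡ 32 ℕ.* Q) (E≡ : E ≡ 3 ℕ.* (k ℕ.* (w ℕ.* w)) ℕ.* G) (4Qw≤E : 4 ℕ.* (Q ℕ.* w) ≤ℕ E)
    (n≤ : n ≤ℕ w ℕ.* L) (Gg≤L : G ℕ.* g ≤ℕ L) (L≤Gg : L ≤ℕ G ℕ.* suc g)
    (L-large : 4 ℕ.* (Q ℕ.* (5 ℕ.+ 4 ℕ.* k)) ≤ℕ L) (1≤k : 1 ≤ℕ k) (ccQ : 1ℚ ≤ c * c * ℕ→ℚ Q)
    (X : Outcome k n) (typ : Typical L (ε * N) X) where

    open Typical L typ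
    open Repair.Potential k α n val-total L 1≤L using (excess; Ψ; ¬Fails3)

    excess≤ : E ℕ.* excess X ≤ℕ k ℕ.* n
    excess≤ = Repair.scaled-sum≤ E n _ (λ j → clear-∸ E (size X j) (targetSize α n j) n
      (clear (size X j) (targetSize α n j) n (subst (λ z → ℕ→ℚ (size X j) - z < ε * N) (exact j) (size< j))))

    Ψ≤ : E ℕ.* Ψ X ≤ℕ k ℕ.* (n ℕ.* n)
    Ψ≤ = Repair.scaled-sum≤ E (n ℕ.* n) _ (λ j → clear-dist E (sumQ X j) (sTarget n k) (n ℕ.* n)
      (clear _ _ _ (rescale _ (sum< j)))
      (clear _ _ _ (rescale _ (subst (_< ε * N) (flip r (ℕ→ℚ (sumQ X j)) (ℕ→ℚ (sTarget n k))) (sum> j)))))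
      where
      flip : ∀ r a b → - r * (a - b) ≡ r * (b - a)
      flip = solve-∀ ring

    4QεN≤L : ℕ→ℚ (4 ℕ.* Q) * (ε * N) ≤ ℕ→ℚ L
    4QεN≤L = begin
      ℕ→ℚ (4 ℕ.* Q) * (ε * N) ≡⟨ eq (ℕ→ℚ (4 ℕ.* Q)) ε N ⟩
      ε * (ℕ→ℚ (4 ℕ.* Q) * N) ≡⟨ cong (ε *_) (sym (ℕ→ℚ-* (4 ℕ.* Q) n)) ⟩
      ε * ℕ→ℚ (4 ℕ.* Q ℕ.* n) ≤⟨ *-monoʳ (<⇒≤ 0<ε) (ℕ→ℚ-mono bound) ⟩
      ε * ℕ→ℚ (E ℕ.* L) ≡⟨ cong (ε *_) (ℕ→ℚ-* E L) ⟩
      ε * (ℕ→ℚ E * ℕ→ℚ L) ≡⟨ sym (ℚP.*-assoc ε (ℕ→ℚ E) (ℕ→ℚ L)) ⟩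
      ε * ℕ→ℚ E * ℕ→ℚ L ≡⟨ cong (_* ℕ→ℚ L) εE≡1 ⟩
      1ℚ * ℕ→ℚ L ≡⟨ ℚP.*-identityˡ (ℕ→ℚ L) ⟩
      ℕ→ℚ L ∎
      where
      open ≤-Reasoning
      eq : ∀ q ε N → q * (ε * N) ≡ ε * (q * N)
      eq = solve-∀ ring
      bound : 4 ℕ.* Q ℕ.* n ≤ℕ E ℕ.* L
      bound = ℕP.≤-trans (ℕP.*-monoʳ-≤ (4 ℕ.* Q) n≤) (ℕP.≤-trans
        (ℕP.≤-reflexive (trans (sym (ℕP.*-assoc (4 ℕ.* Q) w L)) (cong (ℕ._* L) (ℕP.*-assoc 4 Q w))))
        (ℕP.*-monoˡ-≤ L 4Qw≤E))

    -- With τ = εN, the two stages W > cL - τ and P > cW - τ give P > c²L - 2τ, using c ≤ 1. Then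
    -- c²Q ≥ 1 and 4Qτ ≤ L leave more than L/(2Q).
    pairs> : ∀ j' j'' d → 1 ≤ℕ d → d ≤ℕ L → L ℕ.< 2 ℕ.* (Q ℕ.* pairs L d j' j'' X)
    pairs> j' j'' d 1≤d d≤L = ℕ→ℚ-cancel-< (<-by
      (2ℚ * q * (ε * N - (c * W - P) + (c * (ε * N - (c * l - W)) + (1ℚ - c) * (ε * N))) +
        (2ℚ * l * (c * c * q - 1ℚ) + (l - ℕ→ℚ (4 ℕ.* Q) * (ε * N))))
      (ℚP.+-mono-<-≤ (0<-* (0<-* (ℚP.positive⁻¹ 2ℚ) (ℕ→ℚ-mono-< {0} {Q} 1≤Q))
          (ℚP.+-mono-<-≤ (0<-diff (paired j' j'' d 1≤d d≤L))
            (0≤-+ (0≤-* 0≤c (0≤-diff (<⇒≤ (many j'')))) (0≤-* (0≤-diff c≤1) 0≤εN))))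
        (0≤-+ (0≤-* (0≤-* 0≤2 (0≤ℕ→ℚ L)) (0≤-diff ccQ)) (0≤-diff 4QεN≤L)))
      (trans (cong (λ z → l + (2ℚ * q * (ε * N - (c * W - P) + (c * (ε * N - (c * l - W)) + (1ℚ - c) * (ε * N))) +
          (2ℚ * l * (c * c * q - 1ℚ) + (l - z * (ε * N))))) (ℕ→ℚ-* 4 Q))
        (trans (eq l q (ε * N) c W P) (sym (trans (ℕ→ℚ-* 2 (Q ℕ.* p)) (cong (2ℚ *_) (ℕ→ℚ-* Q p)))))))
      where
      l = ℕ→ℚ L
      q = ℕ→ℚ Q
      p = pairs L d j' j'' X
      P = ℕ→ℚ p
      W = ℕ→ℚ (rsum L (hit j'' X))
      eq : ∀ l q t c W P → l + (2ℚ * q * (t - (c * W - P) + (c * (t - (c * l - W)) + (1ℚ - c) * t)) +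
        (2ℚ * l * (c * c * q - 1ℚ) + (l - 4ℚ * q * t))) ≡ 2ℚ * (q * P)
      eq = solve-∀ ring

    succeeds : ¬ Fails k α n X
    succeeds = ¬Fails3 (excess X) B.t ℕP.≤-refl B.potential-bound
      (λ j' j'' d 1≤d d≤L → B.pairs-bound (pairs L d j' j'' X) (pairs> j' j'' d 1≤d d≤L))
      where
      module B = Repair.Budget k n L w Q G E (excess X) (Ψ X) g 1≤k 1≤w 1≤Q G≡ E≡ n≤ excess≤ Ψ≤ Gg≤L L≤Gg L-large

-- Exponential decay and the choice of constants

probOf-𝔼 : ∀ (y : ℕ → Fin k → ℚ) .{{_ : NonZero k}} (α : Fin k → ℚ) n → (∀ X → weightOf y X ≡ prob k α n X) →
  ∀ D → probOf k α n D ≡ 𝔼 y n (λ X → if D X then 1ℚ else 0ℚ)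
probOf-𝔼 {k} y α n wp D = cong sumℚ (ListP.map-cong pointwise (allOutcomes k n))
  where
  pointwise : ∀ X → (if D X then prob k α n X else 0ℚ) ≡ (if D X then 1ℚ else 0ℚ) * weightOf y X
  pointwise X = trans (cong (λ z → if D X then z else 0ℚ) (sym (wp X))) (select (D X) (weightOf y X))
    where
    select : ∀ b z → (if b then z else 0ℚ) ≡ (if b then 1ℚ else 0ℚ) * z
    select true z = sym (ℚP.*-identityˡ z)
    select false z = sym (ℚP.*-zeroˡ z)

^-mono : ∀ {p q} n → 0ℚ ≤ p → p ≤ q → p ^ℚ n ≤ q ^ℚ n
^-mono zero 0≤p p≤q = ≤-refl
^-mono (suc n) 0≤p p≤q = *-mono 0≤p (0≤-^ n (≤-trans 0≤p p≤q)) p≤q (^-mono n 0≤p p≤q)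

cube-^ : ∀ p n → (p * (p * p)) ^ℚ n ≡ p ^ℚ n * (p ^ℚ n * p ^ℚ n)
cube-^ p zero = refl
cube-^ p (suc n) = trans (cong (p * (p * p) *_) (cube-^ p n)) (eq p (p ^ℚ n))
  where
  eq : ∀ p x → p * (p * p) * (x * (x * x)) ≡ p * x * (p * x * (p * x))
  eq = solve-∀ ring

-- Each step uses (1 - t)(1 + (n+1) t) = 1 + nt - (n+1) t². This is the rational tool by which a
-- power beats a polynomial factor.
decay : ∀ t n → 0ℚ ≤ t → t ≤ 1ℚ → (1ℚ - t) ^ℚ n * (1ℚ + ℕ→ℚ n * t) ≤ 1ℚ
decay t zero 0≤t t≤1 = ≤-reflexive (eq t)
  where
  eq : ∀ t → 1ℚ * (1ℚ + 0ℚ * t) ≡ 1ℚ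
  eq = solve-∀ ring
decay t (suc n) 0≤t t≤1 = ≤-trans (≤-by ((1ℚ - t) ^ℚ n * ((ℕ→ℚ n + 1ℚ) * (t * t)))
  (0≤-* (0≤-^ n (0≤-diff t≤1)) (0≤-* (0≤-+ (0≤ℕ→ℚ n) 0≤1) (0≤-square t)))
  (trans (cong (λ z → (1ℚ - t) * (1ℚ - t) ^ℚ n * (1ℚ + z * t) + (1ℚ - t) ^ℚ n * ((ℕ→ℚ n + 1ℚ) * (t * t))) (ℕ→ℚ-suc n))
    (eq t ((1ℚ - t) ^ℚ n) (ℕ→ℚ n)))) (decay t n 0≤t t≤1)
  where
  eq : ∀ t x n → (1ℚ - t) * x * (1ℚ + (n + 1ℚ) * t) + x * ((n + 1ℚ) * (t * t)) ≡ x * (1ℚ + n * t)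
  eq = solve-∀ ring

-- Of the three factors (1 - t)^n above ρ^n, two absorb the number of events: B n ≤ (nt)², and
-- `decay` makes (1 - t)^n nt at most 1. The third is the final bound.
absorb : ∀ t ρ B n → 0ℚ ≤ t → t ≤ 1ℚ → 0ℚ ≤ ρ → ρ ≤ (1ℚ - t) * ((1ℚ - t) * (1ℚ - t)) → 0ℚ ≤ B →
  B ≤ ℕ→ℚ n * (t * t) → B * ℕ→ℚ n * ρ ^ℚ n ≤ (1ℚ - t) ^ℚ n
absorb t ρ B n 0≤t t≤1 0≤ρ ρ≤ 0≤B B≤ = begin
  B * ℕ→ℚ n * ρ ^ℚ n ≤⟨ *-mono (0≤-* 0≤B 0≤m) (0≤-* 0≤z (0≤-* 0≤z 0≤z)) (*-monoˡ 0≤m B≤)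
    (≤-trans (^-mono n 0≤ρ ρ≤) (≤-reflexive (cube-^ (1ℚ - t) n))) ⟩
  m * (t * t) * m * (z * (z * z)) ≡⟨ eq m t z ⟩
  z * (z * (m * t) * (z * (m * t))) ≤⟨ *-monoʳ 0≤z (*-mono (0≤-* 0≤z 0≤mt) 0≤1 zmt≤1 zmt≤1) ⟩
  z * (1ℚ * 1ℚ) ≡⟨ ℚP.*-identityʳ z ⟩
  z ∎
  where
  open ≤-Reasoning
  m = ℕ→ℚ n
  z = (1ℚ - t) ^ℚ n
  0≤m = 0≤ℕ→ℚ n
  0≤z = 0≤-^ n (0≤-diff t≤1)
  0≤mt = 0≤-* 0≤m 0≤t
  zmt≤1 : z * (m * t) ≤ 1ℚ
  zmt≤1 = ≤-trans (*-monoʳ 0≤z (≤-by 1ℚ 0≤1 (ℚP.+-comm (m * t) 1ℚ))) (decay t n 0≤t t≤1)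
  eq : ∀ m t x → m * (t * t) * m * (x * (x * x)) ≡ x * (x * (m * t) * (x * (m * t)))
  eq = solve-∀ ring

module Assembly (k' : ℕ) (α : Fin (suc k') → ℚ) (param : IsLinearFamilyParam (suc k') α)
  (q : ℕ) (1≤q : 1 ≤ℕ q) (ι : ℚ) (0<ι : 0ℚ < ι) (ιq≡1 : ι * ℕ→ℚ q ≡ 1ℚ)
  (slack≥ι : ∀ j → j ℕ.< k' → ι ≤ slack (suc k') α (suc j)) (α₀≥ι : ι ≤ α Fin.zero)
  (Q w G E : ℕ) (1≤Q : 1 ≤ℕ Q) (w≡ : w ≡ 8 ℕ.* q) (G≡ : G ≡ 32 ℕ.* Q)
  (E≡ : E ≡ 3 ℕ.* (suc k' ℕ.* (w ℕ.* w)) ℕ.* G)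
  (ccQ : 1ℚ ≤ ((½ * ι) ^ℚ k') * ((½ * ι) ^ℚ k') * ℕ→ℚ Q)
  (ε : ℚ) (0<ε : 0ℚ < ε) (εE≡1 : ε * ℕ→ℚ E ≡ 1ℚ)
  (h t : ℚ) (0≤h : 0ℚ ≤ h) (h≤½ : h ≤ ½) (4h≡ε : 4ℚ * h ≡ ε)
  (0≤t : 0ℚ ≤ t) (t≤1 : t ≤ 1ℚ) (t≡ : t ≡ ½ * (h * h))
  (u : ℕ) (ttu : 1ℚ ≤ t * t * ℕ→ℚ u) where

  private
    K = suc k'
    1≤w : 1 ≤ℕ w
    1≤w = subst (1 ≤ℕ_) (sym w≡) (ℕP.*-mono-≤ {1} {8} (s≤s z≤n) 1≤q)
    instance
      4q≢0 : NonZero (4 ℕ.* q)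
      4q≢0 = ℕ.>-nonZero (ℕP.*-mono-≤ {1} {4} (s≤s z≤n) 1≤q)
      G≢0 : NonZero G
      G≢0 = ℕ.>-nonZero (subst (1 ≤ℕ_) (sym G≡) (ℕP.*-mono-≤ {1} {32} (s≤s z≤n) 1≤Q))

  open Family k' α param q 1≤q ι 0<ι ιq≡1 slack≥ι α₀≥ι using (κ; 0<κ; κ≤ι; ι≤1; module Instance)

  b large threshold : ℕ
  b = 4 ℕ.* K ℕ.+ K ℕ.* K
  large = 4 ℕ.* (Q ℕ.* (5 ℕ.+ 4 ℕ.* K))
  -- The summands ensure ι n ≥ 1, L ≥ `large` and b ≤ n t², in this order.
  threshold = q ℕ.+ large ℕ.* (4 ℕ.* q) ℕ.+ b ℕ.* u

  κ≤1 : κ ≤ 1ℚ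
  κ≤1 = ≤-trans κ≤ι ι≤1

  ^≤1 : ∀ m → κ ^ℚ m ≤ 1ℚ
  ^≤1 zero = ≤-refl
  ^≤1 (suc m) = *-mono (<⇒≤ 0<κ) 0≤1 κ≤1 (^≤1 m)

  ρ : ℚ
  ρ = 1ℚ - 2ℚ * (h * h)

  0≤ρ : 0ℚ ≤ ρ
  0≤ρ = 0≤-diff (≤-trans (*-monoʳ 0≤2 (*-mono 0≤h 0≤½ h≤½ h≤½)) (≤-by ½ 0≤½ refl))

  -- With t = h²/2 one has ρ = 1 - 4t, whereas the cube is at least 1 - 3t.
  ρ≤ : ρ ≤ (1ℚ - t) * ((1ℚ - t) * (1ℚ - t))
  ρ≤ = ≤-by (t + t * t * (2ℚ + (1ℚ - t))) (0≤-+ 0≤t (0≤-* (0≤-square t) (0≤-+ 0≤2 (0≤-diff t≤1))))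
    (trans (cong (λ z → 1ℚ - z + (t + t * t * (2ℚ + (1ℚ - t)))) (trans (eq₁ h) (cong (4ℚ *_) (sym t≡)))) (eq₂ t))
    where
    eq₁ : ∀ h → 2ℚ * (h * h) ≡ 4ℚ * (½ * (h * h))
    eq₁ = solve-∀ ring
    eq₂ : ∀ t → 1ℚ - 4ℚ * t + (t + t * t * (2ℚ + (1ℚ - t))) ≡ (1ℚ - t) * ((1ℚ - t) * (1ℚ - t))
    eq₂ = solve-∀ ring

  module AtSize (e : ℕ) (N≤n : threshold ≤ℕ suc e) (inFamily : InFamily K α (suc e)) where

    ν L g : ℕ
    ν = suc e
    L = ν ℕ./ (4 ℕ.* q)
    g = L ℕ./ G

    q≤n : q ≤ℕ ν
    q≤n = ℕP.≤-trans (ℕP.≤-trans (ℕP.m≤m+n q _) (ℕP.m≤m+n _ (b ℕ.* u))) N≤n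

    large≤L : large ≤ℕ L
    large≤L = ℕP.≤-trans (ℕP.≤-reflexive (sym (DivMod.m*n/n≡m large (4 ℕ.* q))))
      (DivMod./-monoˡ-≤ (4 ℕ.* q) (ℕP.≤-trans (ℕP.≤-trans (ℕP.m≤n+m _ q) (ℕP.m≤m+n _ (b ℕ.* u))) N≤n))

    1≤L : 1 ≤ℕ L
    1≤L = ℕP.≤-trans (ℕP.*-mono-≤ {1} {4} (s≤s z≤n) (ℕP.*-mono-≤ {1} {Q} 1≤Q (s≤s z≤n))) large≤L

    n≤ : ν ≤ℕ w ℕ.* L
    n≤ = subst (λ z → ν ≤ℕ z ℕ.* L) (sym w≡) (proj₁ (Repair.window ν q 1≤q 1≤L))

    2L≤n : L ℕ.+ L ≤ℕ ν
    2L≤n = proj₂ (Repair.window ν q 1≤q 1≤L)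

    Gg≤L : G ℕ.* g ≤ℕ L
    Gg≤L = ℕP.≤-trans (ℕP.≤-reflexive (ℕP.*-comm G g)) (DivMod.m/n*n≤m L G)

    unit : ∃ λ r → 0ℚ < r × r * ℕ→ℚ ν ≡ 1ℚ
    unit = inverse (ℕ→ℚ ν) (ℕ→ℚ-mono-< {0} {ν} (s≤s z≤n))

    open Instance e q≤n inFamily using (y; fluid; C; part-def; targetSize-part; sTarget-2k)
    open Fluid fluid using (distribution; weight-prob; spread)
    open Expectation distribution using (exceeds; exceeds-false; union-bound)
    open Outcomes {k = K} fluid (s≤s z≤n) (<⇒≤ (0<-^ k' 0<κ)) (^≤1 k')
      (λ j → trans (part-def j) (cong ℕ→ℚ (sym (targetSize-part j)))) sTarget-2k E ε 0<ε εE≡1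
      (proj₁ unit) (<⇒≤ (proj₁ (proj₂ unit))) (proj₂ (proj₂ unit))

    -- As C = n/(2q) and L ≤ n/(4q), both members of every counted pair are in the range of
    -- `spread`.
    small : ∀ m → m ℕ.< L ℕ.+ L → ℕ→ℚ (suc m) ≤ C
    small m m<2L = begin
      ℕ→ℚ (suc m) ≤⟨ ℕ→ℚ-mono m<2L ⟩
      ℕ→ℚ (L ℕ.+ L) ≡⟨ ℕ→ℚ-+ L L ⟩
      ℕ→ℚ L + ℕ→ℚ L ≡⟨ sym (trans (eq ι (ℕ→ℚ L) (ℕ→ℚ q))
        (trans (cong (λ z → (ℕ→ℚ L + ℕ→ℚ L) * z) ιq≡1) (ℚP.*-identityʳ _))) ⟩
      ½ * ι * (ℕ→ℚ L * (4ℚ * ℕ→ℚ q)) ≡⟨ cong (½ * ι *_) (trans (cong (ℕ→ℚ L *_) (sym (ℕ→ℚ-* 4 q)))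
        (sym (ℕ→ℚ-* L (4 ℕ.* q)))) ⟩
      ½ * ι * ℕ→ℚ (L ℕ.* (4 ℕ.* q)) ≤⟨ *-monoʳ (<⇒≤ 0<κ) (ℕ→ℚ-mono (DivMod.m/n*n≤m ν (4 ℕ.* q))) ⟩
      C ∎
      where
      open ≤-Reasoning
      eq : ∀ ι l q → ½ * ι * (l * (4ℚ * q)) ≡ (l + l) * (ι * q)
      eq = solve-∀ ring

    D : Outcome K ν → Bool
    D = exceeds h ν (events L)

    detects : ∀ X → Fails K α ν X → D X ≡ true
    detects X fails = ¬false⇒true (λ eq → contradiction fails
      (succeeds L w Q G g 1≤L 1≤w 1≤Q G≡ E≡ 4Qw≤E n≤ Gg≤L (ℕP.<⇒≤ (Repair.m<n*suc[m/n] L G)) large≤L (s≤s z≤n) ccQ X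
        (subst (λ τ → Typical L τ X) (cong (_* ℕ→ℚ ν) 4h≡ε)
          (typical L X 2L≤n (λ m m<2L → spread m (ℕP.≤-trans m<2L 2L≤n) (small m m<2L))
            (exceeds-false (events L) X eq)))))
      where
      ¬false⇒true : ∀ {b} → b ≢ false → b ≡ true
      ¬false⇒true {true} _ = refl
      ¬false⇒true {false} ≢false = contradiction refl ≢false
      4Qw≤E : 4 ℕ.* (Q ℕ.* w) ≤ℕ E
      4Qw≤E = subst (4 ℕ.* (Q ℕ.* w) ≤ℕ_) (trans (cong (3 ℕ.* (K ℕ.* (w ℕ.* w)) ℕ.*_) (sym G≡)) (sym E≡))
        (Repair.budget-constant K w Q (s≤s z≤n) 1≤w)

    unlikely : probOf K α ν D ≤ (1ℚ - t) ^ℚ ν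
    unlikely = begin
      probOf K α ν D ≡⟨ probOf-𝔼 y α ν weight-prob D ⟩
      𝔼 y ν (λ X → if D X then 1ℚ else 0ℚ) ≤⟨ union-bound 0≤h h≤½ ν (events L) (events-centered L) ⟩
      ℕ→ℚ (length (events L)) * ρ ^ℚ ν ≤⟨ *-monoˡ (0≤-^ ν 0≤ρ) (ℕ→ℚ-mono (events-length L (s≤s z≤n) L≤n)) ⟩
      ℕ→ℚ (b ℕ.* ν) * ρ ^ℚ ν ≡⟨ cong (_* ρ ^ℚ ν) (ℕ→ℚ-* b ν) ⟩
      ℕ→ℚ b * ℕ→ℚ ν * ρ ^ℚ ν ≤⟨ absorb t ρ (ℕ→ℚ b) ν 0≤t t≤1 0≤ρ ρ≤ (0≤ℕ→ℚ b) b≤ ⟩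
      (1ℚ - t) ^ℚ ν ∎
      where
      open ≤-Reasoning
      L≤n : L ≤ℕ ν
      L≤n = ℕP.≤-trans (ℕP.m≤m+n L L) 2L≤n
      b≤ : ℕ→ℚ b ≤ ℕ→ℚ ν * (t * t)
      b≤ = ≤-trans (≤-trans (≤-reflexive (sym (ℚP.*-identityʳ (ℕ→ℚ b)))) (*-monoʳ (0≤ℕ→ℚ b) ttu))
        (≤-trans (≤-reflexive (trans (eq (ℕ→ℚ b) (t * t) (ℕ→ℚ u)) (cong (_* (t * t)) (sym (ℕ→ℚ-* b u)))))
          (*-monoˡ (0≤-square t) (ℕ→ℚ-mono (ℕP.≤-trans (ℕP.m≤n+m (b ℕ.* u) (q ℕ.+ large ℕ.* (4 ℕ.* q))) N≤n))))
        where
        eq : ∀ b t u → b * (t * u) ≡ b * u * t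
        eq = solve-∀ ring

-- There is no slack at index 0; this place is taken by the smallest α, so that one reciprocal bound
-- covers all quantities.
margin : (k' : ℕ) → (Fin (suc k') → ℚ) → ℕ → ℚ
margin k' α zero = α Fin.zero
margin k' α (suc j) = slack (suc k') α (suc j)

margin-positive : ∀ k' α → IsLinearFamilyParam (suc k') α → ∀ j → j ℕ.< suc k' → 0ℚ < margin k' α j
margin-positive k' α (0<α , _) zero _ = 0<α Fin.zero
margin-positive k' α (_ , _ , _ , 0<slack) (suc j) j<k = 0<slack (suc j) (s≤s z≤n) j<k

module Constants (k' : ℕ) (α : Fin (suc k') → ℚ) (param : IsLinearFamilyParam (suc k') α)
  (q : ℕ) (1≤q : 1 ≤ℕ q) (margin≥ : ∀ j → j ℕ.< suc k' → 1ℚ ≤ margin k' α j * ℕ→ℚ q)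
  (ι : ℚ) (0<ι : 0ℚ < ι) (ιq≡1 : ι * ℕ→ℚ q ≡ 1ℚ)
  (r : ℕ) (1≤r : 1 ≤ℕ r) (c₀r≥1 : 1ℚ ≤ ((½ * ι) ^ℚ k') * ℕ→ℚ r) where

  dominate : ∀ {p} → 1ℚ ≤ p * ℕ→ℚ q → ι ≤ p
  dominate {p} 1≤pq = *-cancelʳ (ℕ→ℚ-mono-< {0} {q} 1≤q) (≤-trans (≤-reflexive ιq≡1) 1≤pq)
  Q w G E : ℕ
  -- Since r is at least 1/c for c = (½ι)^k', this gives c² Q ≥ 1.
  Q = r ℕ.* r
  w = 8 ℕ.* q
  G = 32 ℕ.* Q
  E = 3 ℕ.* (suc k' ℕ.* (w ℕ.* w)) ℕ.* G
  1≤Q : 1 ≤ℕ Q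
  1≤Q = ℕP.*-mono-≤ 1≤r 1≤r
  1≤w : 1 ≤ℕ w
  1≤w = ℕP.*-mono-≤ {1} {8} (s≤s z≤n) 1≤q
  1≤E : 1 ≤ℕ E
  1≤E = ℕP.≤-trans (ℕP.*-mono-≤ {1} {4} (s≤s z≤n) (ℕP.*-mono-≤ 1≤Q 1≤w)) (Repair.budget-constant (suc k') w Q (s≤s z≤n) 1≤w)
  ccQ : 1ℚ ≤ ((½ * ι) ^ℚ k') * ((½ * ι) ^ℚ k') * ℕ→ℚ Q
  ccQ = ≤-trans (*-mono 0≤1 (≤-trans 0≤1 c₀r≥1) c₀r≥1 c₀r≥1)
    (≤-reflexive (trans (eq ((½ * ι) ^ℚ k') (ℕ→ℚ r)) (cong (((½ * ι) ^ℚ k') * ((½ * ι) ^ℚ k') *_) (sym (ℕ→ℚ-* r r)))))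
    where
    eq : ∀ c r → c * r * (c * r) ≡ c * c * (r * r)
    eq = solve-∀ ring
  rate : ∃ λ ε → 0ℚ < ε × ε * ℕ→ℚ E ≡ 1ℚ
  rate = inverse (ℕ→ℚ E) (ℕ→ℚ-mono-< {0} {E} 1≤E)
  ε h t : ℚ
  ε = proj₁ rate
  -- The concentration bound has threshold 4hn, which is to be εn.
  h = ½ * ½ * ε
  t = ½ * (h * h)
  0<ε = proj₁ (proj₂ rate)
  ε≤1 : ε ≤ 1ℚ
  ε≤1 = ≤-trans (≤-reflexive (sym (ℚP.*-identityʳ ε)))
    (≤-trans (*-monoʳ (<⇒≤ 0<ε) (ℕ→ℚ-mono {1} {E} 1≤E)) (≤-reflexive (proj₂ (proj₂ rate))))
  0<h : 0ℚ < h
  0<h = 0<-* (ℚP.positive⁻¹ (½ * ½)) 0<ε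
  h≤½ : h ≤ ½
  h≤½ = ≤-trans (*-monoʳ (ℚP.nonNegative⁻¹ (½ * ½)) ε≤1) (≤-by (½ * ½) (ℚP.nonNegative⁻¹ (½ * ½)) refl)
  0<t : 0ℚ < t
  0<t = 0<-* (ℚP.positive⁻¹ ½) (0<-* 0<h 0<h)
  t<1 : t < 1ℚ
  t<1 = ℚP.≤-<-trans (*-monoʳ 0≤½ (*-mono (<⇒≤ 0<h) 0≤½ h≤½ h≤½))
    (<-by (½ + ½ * (½ + ½ * ½)) (ℚP.positive⁻¹ (½ + ½ * (½ + ½ * ½))) refl)
  restore : ∀ t → 1ℚ - t + t ≡ 1ℚ
  restore = solve-∀ ring
  fourth : ∀ ε → 4ℚ * (½ * ½ * ε) ≡ ε
  fourth = solve-∀ ring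
  late : ∃ λ u → 1 ≤ℕ u × 1ℚ ≤ t * t * ℕ→ℚ u
  late = reciprocal-bound (t * t) (0<-* 0<t 0<t)
  module A = Assembly k' α param q 1≤q ι 0<ι ιq≡1 (λ j j<k' → dominate (margin≥ (suc j) (s≤s j<k'))) (dominate (margin≥ 0 (s≤s z≤n)))
    Q w G E 1≤Q refl refl refl ccQ ε 0<ε (proj₂ (proj₂ rate)) h t (<⇒≤ 0<h) h≤½ (fourth ε) (<⇒≤ 0<t) (<⇒≤ t<1) refl
    (proj₁ late) (proj₂ (proj₂ late))
  bounded : ∀ n → A.threshold ≤ℕ n → InFamily (suc k') α n → Σ (Outcome (suc k') n → Bool) λ D →
    (∀ X → Fails (suc k') α n X → D X ≡ true) × (probOf (suc k') α n D ≤ ((1ℚ - t) ^ℚ n))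
  bounded zero _ (() , _)
  bounded (suc e) N≤n inFamily = AtSize.D , AtSize.detects , AtSize.unlikely
    where module AtSize = A.AtSize e N≤n inFamily

theorem1p11 : (k : ℕ) .{{_ : NonZero k}} (α : Fin k → ℚ) →
    IsLinearFamilyParam k α →
    Σ ℚ λ c → (0ℚ < c) × (c < 1ℚ) × Σ ℕ λ N →
    ∀ n → N ≤ℕ n → InFamily k α n →
    Σ (Outcome k n → Bool) λ D →
    (∀ X → Fails k α n X → D X ≡ true) ×
    (probOf k α n D ≤ (c ^ℚ n))
theorem1p11 zero α (_ , _ , Σ≡1 , _) = contradiction Σ≡1 (λ ())
theorem1p11 (suc k') α param = 1ℚ - t , 0<-diff t<1 , <-by t 0<t (restore t) , A.threshold , bounded
  where
  margins = uniform-reciprocal (suc k') (margin k' α) (margin-positive k' α param)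
  q = proj₁ margins
  1≤q = proj₁ (proj₂ margins)
  reciprocal : ∃ λ ι → 0ℚ < ι × ι * ℕ→ℚ q ≡ 1ℚ
  reciprocal = inverse (ℕ→ℚ q) (ℕ→ℚ-mono-< {0} {q} 1≤q)
  ι = proj₁ reciprocal
  0<ι = proj₁ (proj₂ reciprocal)
  denominator : ∃ λ r → 1 ≤ℕ r × 1ℚ ≤ ((½ * ι) ^ℚ k') * ℕ→ℚ r
  denominator = reciprocal-bound ((½ * ι) ^ℚ k') (0<-^ k' (0<-* (ℚP.positive⁻¹ ½) 0<ι))
  open Constants k' α param q 1≤q (proj₂ (proj₂ margins)) ι 0<ι (proj₂ (proj₂ reciprocal))
    (proj₁ denominator) (proj₁ (proj₂ denominator)) (proj₂ (proj₂ denominator))
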